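{- Let $s,t$ be coprime integers greater than $1$, let $\sigma$ be an $s$-core, $\tau$ a $t$-core, and $n\ge0$. The following are equivalent: (1) There are exactly two partitions of $n$ with $s$-core $\sigma$ and $t$-core $\tau$, and they form a conjugate pair; (2) $\sigma'=\sigma$, $\tau'=\tau$, $\mathrm{cor}_t(\sigma)$ is obtained from $\mathrm{cor}_s(\tau)$ by adding or removing a rim hook, and $n=|\sigma|+s(\mathrm{wei}_s(\tau)+1)=|\tau|+t(\mathrm{wei}_t(\sigma)+1)$; (3) $\sigma'=\sigma$, $\tau'=\tau$, and $n=m_{\sigma,\tau}=|\sigma|+s(\mathrm{wei}_s(\tau)+1)=|\tau|+t(\mathrm{wei}_t(\sigma)+1)$.
   Context: Partitions, size $|\lambda|$, conjugate $\lambda'$ (reflection of the Young diagram in the main diagonal). A rim hook of $\lambda$ is a connected set of nodes of the rim of the Young diagram (nodes $(r,c)$ with $(r+1,c+1)$ not a node) whose removal leaves a partition's diagram; a rim $s$-hook is one with $s$ nodes. $\lambda$ is an $s$-core if it has no rim $s$-hook; $\mathrm{cor}_s(\lambda)$ is obtained by repeatedly removing rim $s$-hooks and $\mathrm{wei}_s(\lambda)$ is the number removed. $m_{\sigma,\tau}$ is the smallest $n$ for which there is a partition of $n$ with $s$-core $\sigma$ and $t$-core $\tau$. -}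

module Defs where

open import Data.Nat using (ℕ; zero; suc; _+_; _*_; _≤_; _<_; _<?_)
open import Data.Nat.ListAction using (sum)
open import Data.List using (List; []; _∷_; map; length; filter; upTo)
open import Data.Product using (_×_; Σ; ∃; _,_)
open import Data.Sum using (_⊎_)
open import Relation.Nullary using (¬_)
open import Relation.Binary.PropositionalEquality using (_≡_; _≢_)

-- A partition is represented by its list of parts (row lengths), in
-- weakly decreasing order, all parts positive.

part : List ℕ → ℕ → ℕ
part []       _       = 0
part (x ∷ _)  zero    = x
part (_ ∷ xs) (suc i) = part xs i

IsPositive : List ℕ → Set
IsPositive xs = ∀ i → i < length xs → 0 < part xs i

IsPartition : List ℕ → Set
IsPartition xs = (∀ i → part xs (suc i) ≤ part xs i) × IsPositive xs

size : List ℕ → ℕ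
size = sum

Node : Set
Node = ℕ × ℕ

InDiag : List ℕ → Node → Set
InDiag la (r , c) = c < part la r

hd : List ℕ → ℕ
hd []      = 0
hd (x ∷ _) = x

conj : List ℕ → List ℕ
conj la = map (λ j → length (filter (j <?_) la)) (upTo (hd la))

data Adj : Node → Node → Set where
  right : ∀ {r c} → Adj (r , c) (r , suc c)
  left  : ∀ {r c} → Adj (r , suc c) (r , c)
  down  : ∀ {r c} → Adj (r , c) (suc r , c)
  up    : ∀ {r c} → Adj (suc r , c) (r , c)

data Conn (P : Node → Set) : Node → Node → Set where
  here  : ∀ {a} → P a → Conn P a a
  there : ∀ {a b d} → P a → Adj a b → Conn P b d → Conn P a d

Skew : List ℕ → List ℕ → Node → Set
Skew la mu x = InDiag la x × ¬ InDiag mu x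

InRim : List ℕ → Node → Set
InRim la (r , c) = InDiag la (r , c) × ¬ InDiag la (suc r , suc c)

record RimHookRemoval (la mu : List ℕ) : Set where
  field
    partλ     : IsPartition la
    partμ     : IsPartition mu
    sub       : ∀ x → InDiag mu x → InDiag la x
    rim       : ∀ x → Skew la mu x → InRim la x
    nonempty  : ∃ λ x → Skew la mu x
    connected : ∀ x y → Skew la mu x → Skew la mu y → Conn (Skew la mu) x y

RimSHook : ℕ → List ℕ → List ℕ → Set
RimSHook s la mu = RimHookRemoval la mu × size la ≡ size mu + s

IsCore : ℕ → List ℕ → Set
IsCore s la = IsPartition la × (∀ mu → ¬ RimSHook s la mu)

data Reach (s : ℕ) : ℕ → List ℕ → List ℕ → Set where
  done : ∀ {la} → Reach s 0 la la
  step : ∀ {k la mu ka} → RimSHook s la mu → Reach s k mu ka → Reach s (suc k) la ka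

-- CoreWeight s λ κ w : repeatedly removing rim s-hooks from λ until none remain
-- removes w hooks and ends at κ, i.e. cor_s(λ) = κ and wei_s(λ) = w
CoreWeight : ℕ → List ℕ → List ℕ → ℕ → Set
CoreWeight s la ka w = Reach s w la ka × IsCore s ka

HasCore : ℕ → List ℕ → List ℕ → Set
HasCore s la ka = ∃ λ w → CoreWeight s la ka w

Good : ℕ → ℕ → List ℕ → List ℕ → ℕ → List ℕ → Set
Good s t σ τ n la = IsPartition la × size la ≡ n × HasCore s la σ × HasCore t la τ

IsMinSize : ℕ → ℕ → List ℕ → List ℕ → ℕ → Set
IsMinSize s t σ τ n =
  (∃ λ la → Good s t σ τ n la) ×
  (∀ m la → Good s t σ τ m la → n ≤ m)

Cond1 : ℕ → ℕ → List ℕ → List ℕ → ℕ → Set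
Cond1 s t σ τ n =
  Σ (List ℕ) λ la → Σ (List ℕ) λ mu →
    Good s t σ τ n la × Good s t σ τ n mu × la ≢ mu × conj la ≡ mu ×
    (∀ nu → Good s t σ τ n nu → nu ≡ la ⊎ nu ≡ mu)

Wei : ℕ → List ℕ → ℕ → Set
Wei s la w = ∃ λ ka → CoreWeight s la ka w

SizeCond : ℕ → ℕ → List ℕ → List ℕ → ℕ → Set
SizeCond s t σ τ n =
  (∃ λ u → Wei s τ u × n ≡ size σ + s * (u + 1)) ×
  (∃ λ v → Wei t σ v × n ≡ size τ + t * (v + 1))

Cond2 : ℕ → ℕ → List ℕ → List ℕ → ℕ → Set
Cond2 s t σ τ n =
  conj σ ≡ σ × conj τ ≡ τ ×
  (Σ (List ℕ) λ α → Σ (List ℕ) λ β → HasCore t σ α × HasCore s τ β ×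
     (RimHookRemoval α β ⊎ RimHookRemoval β α)) ×
  SizeCond s t σ τ n

Cond3 : ℕ → ℕ → List ℕ → List ℕ → ℕ → Set
Cond3 s t σ τ n =
  conj σ ≡ σ × conj τ ≡ τ × IsMinSize s t σ τ n × SizeCond s t σ τ n

{-# OPTIONS --safe #-}

-- A partition la is encoded by its bead set {la_i - i : i ≥ 0} ⊂ ℤ.  Removing a
-- rim h-hook moves one bead from x to x - h; being an s-core means being closed
-- under x ↦ x - s; the s-core only depends on the number of beads in each
-- residue class mod s.
--
-- Suppose the t-core τ is not an s-core, say x₀ ∈ τ and x₀ - s ∉ τ.  Exchanging
-- the residue classes of x₀ and x₀ - s mod t by a shift of s is a bijection of ℤ
-- preserving classes mod s and commuting with shifts by t.  It maps the
-- partitions with cores (σ, τ) to those with cores (σ, τ′) for a smaller t-core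
-- τ′, changing sizes by a constant.  Iterating, and then exchanging the roles of
-- s and t, one may replace σ by κ = cor_t(σ) and τ by ρ = cor_s(τ), both of which
-- are closed under -s and -t; the size condition becomes N = |κ| + s = |ρ| + t.
--
-- In that case a partition of N with cores (κ, ρ) arises from κ by one move
-- x → x + s and from ρ by one move y → y + t.  Closedness of κ forces x = y or
-- x + s = y + t, so that κ and ρ differ by one bead z → z′ = z + s - t, and the
-- partition is κ[z → z + s] or κ[z - t → z′]; conversely both occur.
-- If there are exactly two partitions, then N is minimal, and each s-inversion
-- x ∈ la, x - δ ∉ la is completed by counting to a parallelogram whose flip is
-- the other partition; hence there is a single inversion and N = |κ| + s.
module Submission where

open import Defs
open import Data.Nat as ℕ using (ℕ; zero; suc; _≤_; _<_; z≤n; s≤s)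
import Data.Nat.Properties as ℕₚ
open import Data.Nat.Coprimality using (Coprime)
open import Data.Nat.Divisibility using (∣⇒≤; divides; ∣-refl)
open import Data.Nat.Induction using (<-wellFounded)
open import Data.Nat.Tactic.RingSolver using () renaming (solve-∀ to ℕ-solve-∀)
open import Data.Integer as ℤ using (ℤ; +_; -[1+_]; _+_; _-_; _*_; -_; 0ℤ; 1ℤ)
import Data.Integer.Properties as ℤₚ
open import Data.Integer.Divisibility.Signed using (_∣?_) renaming (divides to dividesᶻ)
open import Data.Integer.Tactic.RingSolver using (solve-∀)
open import Data.Bool using (Bool; true; false; not; _∨_)
open import Data.Bool.Properties using (∨-zeroʳ; not-involutive) renaming (_≟_ to _≟ᵇ_)
open import Data.List using (List; []; _∷_; length; map; filter; upTo; applyUpTo)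
open import Data.List.Properties using (length-map; length-upTo; filter-accept; filter-reject)
open import Data.Product using (_×_; Σ; _,_; proj₁; proj₂)
open import Data.Sum using (_⊎_; inj₁; inj₂)
open import Data.Empty using (⊥; ⊥-elim)
open import Induction.WellFounded using (Acc; acc)
open import Relation.Nullary using (¬_; Dec; yes; no; does)
open import Relation.Nullary.Decidable using (dec-true; dec-false; _×-dec_)
open import Relation.Binary.PropositionalEquality using (_≡_; _≢_; _≗_; refl; sym; trans; cong; cong₂; subst; subst₂; module ≡-Reasoning)
open import Algebra.Properties.AbelianGroup ℤₚ.+-0-abelianGroup using () renaming (∙-cancelˡ to +-cancelˡ-≡; ∙-cancelʳ to +-cancelʳ-≡)

-- Cores are handled through `Eqv`, moves of single beads within residue classes in either
-- direction, rather than through hook removals. The invariant is the number of beads in each class.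
-- This number is infinite, so it is compared in large symmetric windows (`Balanced`), and
-- uniqueness of cores follows without a confluence argument. Likewise the exchange of two infinite
-- columns has to be shown to give a partition: outside a finite window the columns agree, so
-- finitely many bead moves suffice. The change of size comes from a path of t-moves from ν to τ.
-- The exchange preserves the displacement of each move, so |ν| - |ν′| = |τ| - |τ′|. Over the whole
-- reduction this gives N = n + |κ| + |ρ| - |σ| - |τ|. The exchanges need not respect conjugation.
-- Conjugate pairs are therefore recognised only after returning to σ and τ: the two partitions
-- still differ by trading two beads for two others, and such partitions of equal size cannot both
-- be self-conjugate.

bool-clash : ∀ {b} → b ≡ true → b ≡ false → ⊥
bool-clash refl ()

-- Integer inequalities are proved by exhibiting the difference of the two
-- sides as a sum of differences known to be nonnegative.

≤-by : ∀ {a b} e → 0ℤ ℤ.≤ e → b ≡ a + e → a ℤ.≤ b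
≤-by {a} e 0≤e refl = subst (ℤ._≤ a + e) (ℤₚ.+-identityʳ a) (ℤₚ.+-monoʳ-≤ a 0≤e)

infixl 5 _⊕_
_⊕_ : ∀ {a b} → 0ℤ ℤ.≤ a → 0ℤ ℤ.≤ b → 0ℤ ℤ.≤ a + b
_⊕_ = ℤₚ.+-mono-≤

gap : ∀ {a b} → a ℤ.≤ b → 0ℤ ℤ.≤ b - a
gap = ℤₚ.i≤j⇒0≤j-i

0≤+ : ∀ n → 0ℤ ℤ.≤ + n
0≤+ n = ℤ.+≤+ z≤n

neg-impossible : ∀ {e} → 0ℤ ℤ.≤ e → e ≡ - 1ℤ → ⊥
neg-impossible () refl

split : ∀ x y → x ℤ.≤ y ⊎ y + 1ℤ ℤ.≤ x
split x y with x ℤ.≤? y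
... | yes p = inj₁ p
... | no ¬p = inj₂ (subst (ℤ._≤ x) (ℤₚ.+-comm 1ℤ y) (ℤₚ.i<j⇒suc[i]≤j (ℤₚ.≰⇒> ¬p)))

i≤∣i∣ : ∀ i → i ℤ.≤ + ℤ.∣ i ∣
i≤∣i∣ (+ n)    = ℤₚ.≤-refl
i≤∣i∣ -[1+ n ] = ℤ.-≤+

-∣i∣≤i : ∀ i → - (+ ℤ.∣ i ∣) ℤ.≤ i
-∣i∣≤i (+ n)    = ℤₚ.neg-≤-pos
-∣i∣≤i -[1+ n ] = ℤₚ.≤-refl

≤⇒∃ : ∀ {x y} → x ℤ.≤ y → Σ ℕ λ k → y ≡ x + + k
≤⇒∃ {x} {y} p = ℤ.∣ y - x ∣ , trans (eq x y) (cong (_+_ x) (sym (ℤₚ.0≤i⇒+∣i∣≡i (gap p))))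
  where eq : ∀ x y → y ≡ x + (y - x)
        eq = solve-∀

≢⇒< : ∀ {x y} → x ℤ.≤ y → x ≢ y → x + 1ℤ ℤ.≤ y
≢⇒< {x} {y} x≤y x≢y with split y x
... | inj₁ y≤x = ⊥-elim (x≢y (ℤₚ.≤-antisym x≤y y≤x))
... | inj₂ q = q

-- Opaque, so that case distinctions do not rewrite bead configurations.
abstract
  eq? : (x y : ℤ) → Dec (x ≡ y)
  eq? = ℤ._≟_

x+1+k≢x : ∀ x k → x ≢ x + + suc k
x+1+k≢x x k p with +-cancelˡ-≡ x 0ℤ (+ suc k) (trans (ℤₚ.+-identityʳ x) p)
... | ()

-- Beads

is : ℤ → ℤ → Bool
is x y = does (x ℤ.≟ y)

is-refl : ∀ x → is x x ≡ true
is-refl x = dec-true (x ℤ.≟ x) refl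

is-≢ : ∀ {x y} → x ≢ y → is x y ≡ false
is-≢ {x} {y} = dec-false (x ℤ.≟ y)

nonpos : ℤ → Bool
nonpos x = does (x ℤ.≤? 0ℤ)

nonpos-true : ∀ {x} → x ℤ.≤ 0ℤ → nonpos x ≡ true
nonpos-true {x} = dec-true (x ℤ.≤? 0ℤ)

nonpos-false : ∀ {x} → 1ℤ ℤ.≤ x → nonpos x ≡ false
nonpos-false {x} 1≤x = dec-false (x ℤ.≤? 0ℤ) λ x≤0 → case (ℤₚ.≤-trans 1≤x x≤0)
  where case : ¬ (1ℤ ℤ.≤ 0ℤ)
        case (ℤ.+≤+ ())

-- bead la x holds iff x = la_i - i for some i ≥ 0 (with la_i = 0 beyond the last part).
bead : List ℕ → ℤ → Bool
bead []       x = nonpos x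
bead (p ∷ ps) x = is x (+ p) ∨ bead ps (x + 1ℤ)

bead-here : ∀ p ps → bead (p ∷ ps) (+ p) ≡ true
bead-here p ps = cong (_∨ bead ps (+ p + 1ℤ)) (is-refl (+ p))

bead-there : ∀ {p} ps {x} → x ≢ + p → bead (p ∷ ps) x ≡ bead ps (x + 1ℤ)
bead-there ps {x} x≢p = cong (_∨ bead ps (x + 1ℤ)) (is-≢ x≢p)

bead-tail : ∀ p ps {x} → bead ps (x + 1ℤ) ≡ true → bead (p ∷ ps) x ≡ true
bead-tail p ps {x} b = trans (cong (is x (+ p) ∨_) b) (∨-zeroʳ _)

data Ptn : List ℕ → Set where
  nil  : Ptn []
  cons : ∀ {p ps} → 0 < p → hd ps ≤ p → Ptn ps → Ptn (p ∷ ps)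

part₀ : ∀ xs → part xs 0 ≡ hd xs
part₀ []      = refl
part₀ (_ ∷ _) = refl

toPtn : ∀ {la} → IsPartition la → Ptn la
toPtn {[]} _ = nil
toPtn {p ∷ ps} (dec , pos) = cons (pos 0 (s≤s z≤n)) (subst (_≤ p) (part₀ ps) (dec 0))
  (toPtn ((λ i → dec (suc i)) , λ i i< → pos (suc i) (s≤s i<)))

fromPtn : ∀ {la} → Ptn la → IsPartition la
fromPtn nil = (λ _ → z≤n) , λ _ ()
fromPtn {p ∷ ps} (cons 0<p h P) with fromPtn P
... | dec , pos = (λ { zero → subst (_≤ p) (sym (part₀ ps)) h ; (suc i) → dec i })
                , λ { zero _ → 0<p ; (suc i) (s≤s i<) → pos i i< }

bead-high : ∀ {la x} → Ptn la → + hd la + 1ℤ ℤ.≤ x → bead la x ≡ false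
bead-high nil 1≤x = nonpos-false 1≤x
bead-high {p ∷ ps} {x} (cons _ h P) p<x =
  trans (bead-there ps {x} (λ { refl → neg-impossible (gap p<x) (e₁ (+ p)) }))
        (bead-high P (≤-by _ (gap p<x ⊕ gap (ℤ.+≤+ h) ⊕ 0≤+ 1) (e₂ (+ p) (+ hd ps) x)))
  where
  e₁ : ∀ p → p - (p + 1ℤ) ≡ - 1ℤ
  e₁ = solve-∀
  e₂ : ∀ p q x → x + 1ℤ ≡ q + 1ℤ + (x - (p + 1ℤ) + (p - q) + 1ℤ)
  e₂ = solve-∀

bead-low : ∀ la {x} → x ℤ.≤ - (+ length la) → bead la x ≡ true
bead-low [] x≤0 = nonpos-true x≤0
bead-low (p ∷ ps) {x} x≤ = bead-tail p ps {x} (bead-low ps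
  (≤-by _ (gap x≤) (e x (+ length ps))))
  where
  e : ∀ x l → - l ≡ x + 1ℤ + (- (1ℤ + l) - x)
  e = solve-∀

bead-≤hd : ∀ {la x} → Ptn la → bead la x ≡ true → x ℤ.≤ + hd la
bead-≤hd {la} {x} P b with split x (+ hd la)
... | inj₁ p = p
... | inj₂ q = ⊥-elim (bool-clash b (bead-high P q))

-- The largest bead is the first part, so the heads agree; deleting it leaves the bead sets of the
-- tails, shifted by one.
bead-injective : ∀ {la mu} → Ptn la → Ptn mu → bead la ≗ bead mu → la ≡ mu
bead-injective nil nil _ = refl
bead-injective nil (cons {p} {ps} 0<p _ _) eq =
  ⊥-elim (bool-clash (trans (eq (+ p)) (bead-here p ps)) (nonpos-false (ℤ.+≤+ 0<p)))
bead-injective (cons {p} {ps} 0<p _ _) nil eq =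
  ⊥-elim (bool-clash (trans (sym (eq (+ p))) (bead-here p ps)) (nonpos-false (ℤ.+≤+ 0<p)))
bead-injective {p ∷ ps} {q ∷ qs} P@(cons _ hp Pp) Q@(cons _ hq Pq) eq
  with ℤₚ.+-injective (ℤₚ.≤-antisym (bead-≤hd Q (trans (sym (eq (+ p))) (bead-here p ps)))
                                      (bead-≤hd P (trans (eq (+ q)) (bead-here q qs))))
... | refl = cong (p ∷_) (bead-injective Pp Pq λ x → subst (λ z → bead ps z ≡ bead qs z) (e x) (tails (x - 1ℤ)))
  where
  e : ∀ x → x - 1ℤ + 1ℤ ≡ x
  e = solve-∀
  tails : ∀ x → bead ps (x + 1ℤ) ≡ bead qs (x + 1ℤ)
  tails x with eq? x (+ p)
  -- At the head itself neither tail has a bead, since the first parts of the tails are at most `p`.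
  ... | yes refl = trans (bead-high Pp (ℤₚ.+-monoˡ-≤ 1ℤ (ℤ.+≤+ hp)))
                         (sym (bead-high Pq (ℤₚ.+-monoˡ-≤ 1ℤ (ℤ.+≤+ hq))))
  ... | no x≢p = trans (sym (bead-there ps x≢p)) (trans (eq x) (bead-there qs x≢p))

-- Moving one bead

record Mv (x y : ℤ) (a b : ℤ → Bool) : Set where
  constructor mv
  field
    ax   : a x ≡ true
    ay   : a y ≡ false
    bx   : b x ≡ false
    by   : b y ≡ true
    rest : ∀ z → z ≢ x → z ≢ y → a z ≡ b z

bead-≢ : ∀ {a : ℤ → Bool} {x y} → a x ≡ true → a y ≡ false → x ≢ y
bead-≢ p q refl = bool-clash p q

Mv-≢ : ∀ {x y a b} → Mv x y a b → x ≢ y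
Mv-≢ m = bead-≢ (Mv.ax m) (Mv.ay m)

Mv-sym : ∀ {x y a b} → Mv x y a b → Mv y x b a
Mv-sym (mv ax ay bx by rest) = mv by bx ay ax λ z p q → sym (rest z q p)

Mv-resp : ∀ {x y a a′ b b′} → a ≗ a′ → b ≗ b′ → Mv x y a b → Mv x y a′ b′
Mv-resp {x} {y} p q (mv ax ay bx by rest) =
  mv (trans (sym (p x)) ax) (trans (sym (p y)) ay) (trans (sym (q x)) bx) (trans (sym (q y)) by)
     λ z u v → trans (sym (p z)) (trans (rest z u v) (q z))

Mv-unique : ∀ {x y a b c} → Mv x y a b → Mv x y a c → b ≗ c
Mv-unique {x} {y} m n z with eq? z x | eq? z y
... | yes refl | _ = trans (Mv.bx m) (sym (Mv.bx n))
... | no _ | yes refl = trans (Mv.by m) (sym (Mv.by n))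
... | no p | no q = trans (sym (Mv.rest m z p q)) (Mv.rest n z p q)

-- Composition through a position `w` that is empty in `a`: one bead travels from `x` over `w` to
-- `y`.
Mv-onward : ∀ {x w y a b c} → x ≢ y → Mv x w a b → Mv w y b c → Mv x y a c
Mv-onward {x} {w} {y} {a} {b} {c} x≢y m n = record
  { ax = Mv.ax m
  ; ay = trans (Mv.rest m y (λ p → x≢y (sym p)) (λ p → Mv-≢ n (sym p))) (Mv.ay n)
  ; bx = trans (sym (Mv.rest n x (Mv-≢ m) x≢y)) (Mv.bx m)
  ; by = Mv.by n
  ; rest = r }
  where
  r : ∀ z → z ≢ x → z ≢ y → a z ≡ c z
  r z p q with eq? z w
  ... | yes refl = trans (Mv.ay m) (sym (Mv.bx n))
  ... | no u = trans (Mv.rest m z p u) (Mv.rest n z u q)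

-- Composition through a position `w` that is occupied in `a`: its bead leaves for `y` and the bead
-- at `x` takes its place, so the net effect does not involve `w`.
Mv-refill : ∀ {x w y a b c} → x ≢ y → Mv w y a b → Mv x w b c → Mv x y a c
Mv-refill {x} {w} {y} {a} {b} {c} x≢y m n = record
  { ax = trans (Mv.rest m x (Mv-≢ n) x≢y) (Mv.ax n)
  ; ay = Mv.ay m
  ; bx = Mv.bx n
  ; by = trans (sym (Mv.rest n y (λ p → x≢y (sym p)) (λ p → Mv-≢ m (sym p)))) (Mv.by m)
  ; rest = r }
  where
  r : ∀ z → z ≢ x → z ≢ y → a z ≡ c z
  r z p q with eq? z w
  ... | yes refl = trans (Mv.ax m) (sym (Mv.by n))
  ... | no u = trans (Mv.rest m z u q) (Mv.rest n z p u)

Mv-cons : ∀ {x y} p ps qs → x ≢ + p → y ≢ + p →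
  Mv (x + 1ℤ) (y + 1ℤ) (bead ps) (bead qs) → Mv x y (bead (p ∷ ps)) (bead (p ∷ qs))
Mv-cons {x} {y} p ps qs x≢p y≢p (mv ax ay bx by rest) = mv
  (trans (bead-there ps x≢p) ax) (trans (bead-there ps y≢p) ay)
  (trans (bead-there qs x≢p) bx) (trans (bead-there qs y≢p) by)
  λ z u v → cong (is z (+ p) ∨_)
    (rest (z + 1ℤ) (λ e → u (+-cancelʳ-≡ 1ℤ z x e)) (λ e → v (+-cancelʳ-≡ 1ℤ z y e)))

Mv-head : ∀ {p q} ps → p ≢ q → bead ps (+ p + 1ℤ) ≡ false → bead ps (+ q + 1ℤ) ≡ false →
  Mv (+ p) (+ q) (bead (p ∷ ps)) (bead (q ∷ ps))
Mv-head {p} {q} ps p≢q fp fq = mv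
  (bead-here p ps) (trans (bead-there ps (λ e → p≢q (sym (ℤₚ.+-injective e)))) fq)
  (trans (bead-there ps (λ e → p≢q (ℤₚ.+-injective e))) fp) (bead-here q ps)
  λ z u v → trans (bead-there ps u) (sym (bead-there ps v))

-- Needed when a part 1 shrinks to 0 and has to be dropped, or when the empty partition receives its
-- first part.
bead-0 : bead (0 ∷ []) ≗ bead []
bead-0 x with split x (- 1ℤ)
... | inj₁ x≤-1 = trans (bead-tail 0 [] {x} (bead-low [] {x + 1ℤ} (≤-by _ (gap x≤-1) (e x))))
                        (sym (nonpos-true (ℤₚ.≤-trans x≤-1 ℤ.-≤+)))
  where e : ∀ x → 0ℤ ≡ x + 1ℤ + (- 1ℤ - x)
        e = solve-∀
... | inj₂ 0≤x with eq? x 0ℤ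
...   | yes refl = refl
...   | no x≢0 = trans (bead-there [] x≢0) (trans (nonpos-false (ℤₚ.+-monoˡ-≤ 1ℤ 0≤x))
                   (sym (nonpos-false (≢⇒< 0≤x (λ e → x≢0 (sym e))))))

Moved : List ℕ → ℤ → ℤ → Set
Moved la x y = Σ (List ℕ) λ mu → Ptn mu × (+ size la + y ≡ + size mu + x) × Mv x y (bead la) (bead mu)

private
  unit-size : ∀ m x → 1ℤ + m + x ≡ m + (x + 1ℤ)
  unit-size = solve-∀
  tail-size : ∀ p a b x y → a + y ≡ b + x → p + a + y ≡ p + b + x
  tail-size p a b x y e = trans (ℤₚ.+-assoc p a y) (trans (cong (_+_ p) e) (sym (ℤₚ.+-assoc p b x)))
  shift-size : ∀ a b x → a + (x + 1ℤ) ≡ b + (x + 1ℤ + 1ℤ) → a + x ≡ b + (x + 1ℤ)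
  shift-size a b x e = +-cancelʳ-≡ 1ℤ (a + x) (b + (x + 1ℤ)) (trans (ℤₚ.+-assoc a x 1ℤ) (trans e (sym (ℤₚ.+-assoc b (x + 1ℤ) 1ℤ))))
  shift-size′ : ∀ a b x → a + (x + 1ℤ + 1ℤ) ≡ b + (x + 1ℤ) → a + (x + 1ℤ) ≡ b + x
  shift-size′ a b x e = sym (shift-size b a x (sym e))

hd-≤-pred : ∀ q ps → hd ps ≤ suc q → bead ps (+ q + 1ℤ) ≡ false → hd ps ≤ q
hd-≤-pred q [] _ _ = z≤n
hd-≤-pred q (r ∷ rs) r≤ g with ℕₚ.m≤n⇒m<n∨m≡n r≤
... | inj₁ (s≤s r≤q) = r≤q
... | inj₂ refl = ⊥-elim (bool-clash (trans (cong (bead (r ∷ rs)) (ℤₚ.+-comm (+ q) 1ℤ)) (bead-here r rs)) g)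

unit-down-head : ∀ q ps → hd ps ≤ suc q → Ptn ps → bead ps (+ q + 1ℤ) ≡ false →
  Σ (Moved (suc q ∷ ps) (+ q + 1ℤ) (+ q)) λ m → hd (proj₁ m) ≤ suc q
unit-down-head q ps h P g = result q ps h P g (subst (λ z → Mv z (+ q) (bead (suc q ∷ ps)) (bead (q ∷ ps))) (ℤₚ.+-comm 1ℤ (+ q))
  (Mv-head ps (λ e → ℕₚ.<⇒≢ ℕₚ.≤-refl (sym e)) (bead-high P (ℤₚ.+-monoˡ-≤ 1ℤ (ℤ.+≤+ h))) g))
  where
  result : ∀ q ps → hd ps ≤ suc q → Ptn ps → bead ps (+ q + 1ℤ) ≡ false →
    Mv (+ q + 1ℤ) (+ q) (bead (suc q ∷ ps)) (bead (q ∷ ps)) →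
    Σ (Moved (suc q ∷ ps) (+ q + 1ℤ) (+ q)) λ m → hd (proj₁ m) ≤ suc q
  result zero [] _ _ _ m = ([] , nil , refl , Mv-resp (λ _ → refl) bead-0 m) , z≤n
  result zero (r ∷ rs) h (cons 0<r _ _) g _ = ⊥-elim (ℕₚ.<⇒≱ 0<r (hd-≤-pred 0 (r ∷ rs) h g))
  result (suc q) ps h P g m = (suc q ∷ ps , cons (s≤s z≤n) (hd-≤-pred (suc q) ps h g) P
    , unit-size (+ suc q + + size ps) (+ suc q) , m) , ℕₚ.n≤1+n (suc q)

-- A unit move lowers one part by 1. The bound on the head is carried along so that the changed tail
-- can be put back below the rows above it.
unit-down : ∀ {la x} → Ptn la → bead la (x + 1ℤ) ≡ true → bead la x ≡ false →
  Σ (Moved la (x + 1ℤ) x) λ m → hd (proj₁ m) ≤ hd la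
unit-down {x = x} nil bt bf with split x 0ℤ
... | inj₁ x≤0 = ⊥-elim (bool-clash (nonpos-true x≤0) bf)
... | inj₂ 1≤x = ⊥-elim (bool-clash bt (nonpos-false (ℤₚ.≤-trans 1≤x (≤-by _ (0≤+ 1) refl))))
unit-down {p ∷ ps} {x} (cons 0<p h P) bt bf with eq? (x + 1ℤ) (+ p)
unit-down {suc q ∷ ps} {x} (cons 0<p h P) bt bf | yes e
  with +-cancelʳ-≡ 1ℤ x (+ q) (trans e (ℤₚ.+-comm 1ℤ (+ q)))
... | refl = unit-down-head q ps h P
               (trans (sym (bead-there ps (λ e′ → ℕₚ.<⇒≢ ℕₚ.≤-refl (ℤₚ.+-injective e′)))) bf)
unit-down {p ∷ ps} {x} (cons 0<p h P) bt bf | no x+1≢p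
  with unit-down {ps} {x + 1ℤ} P (trans (sym (bead-there ps x+1≢p)) bt) (trans (sym (bead-there ps x≢p)) bf)
  where
  x≢p : x ≢ + p
  x≢p refl = bool-clash (bead-here p ps) bf
... | (mu , Pm , sz , m) , h′ =
  (p ∷ mu , cons 0<p (ℕₚ.≤-trans h′ h) Pm
   , tail-size (+ p) (+ size ps) (+ size mu) (x + 1ℤ) x (shift-size (+ size ps) (+ size mu) x sz)
   , Mv-cons p ps mu x+1≢p (λ { refl → bool-clash (bead-here p ps) bf }) m) , ℕₚ.≤-refl

-- The alternative on the head again serves to reassemble the rows: if the head of the tail has
-- grown, the free position above it keeps it at most `p`.
unit-up : ∀ {la x} → Ptn la → bead la x ≡ true → bead la (x + 1ℤ) ≡ false →
  Σ (Moved la x (x + 1ℤ)) λ m → hd (proj₁ m) ≡ hd la ⊎ + hd (proj₁ m) ≡ x + 1ℤ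
unit-up {x = x} nil bt bf with eq? x 0ℤ
... | yes refl = (1 ∷ [] , cons (s≤s z≤n) z≤n nil , refl
                 , Mv-resp bead-0 (λ _ → refl) (Mv-head [] (λ ()) refl refl)) , inj₂ refl
... | no x≢0 with split x 0ℤ
...   | inj₁ x≤0 = ⊥-elim (bool-clash (nonpos-true (≢⇒< x≤0 x≢0)) bf)
...   | inj₂ 1≤x = ⊥-elim (bool-clash bt (nonpos-false 1≤x))
unit-up {p ∷ ps} {x} (cons 0<p h P) bt bf with eq? x (+ p)
... | yes refl = (suc p ∷ ps , cons (s≤s z≤n) (ℕₚ.m≤n⇒m≤1+n h) P
    , sym (unit-size (+ p + + size ps) (+ p))
    , subst (λ z → Mv (+ p) z (bead (p ∷ ps)) (bead (suc p ∷ ps))) (ℤₚ.+-comm 1ℤ (+ p))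
        (Mv-head ps (ℕₚ.<⇒≢ ℕₚ.≤-refl) (bead-high P (ℤₚ.+-monoˡ-≤ 1ℤ (ℤ.+≤+ h)))
           (bead-high P (ℤₚ.+-monoˡ-≤ 1ℤ (ℤ.+≤+ (ℕₚ.m≤n⇒m≤1+n h)))))) , inj₂ (ℤₚ.+-comm 1ℤ (+ p))
... | no x≢p with unit-up {ps} {x + 1ℤ} P bt′ (trans (sym (bead-there ps x+1≢p)) bf)
  where
  bt′ = trans (sym (bead-there ps x≢p)) bt
  x+1≢p : x + 1ℤ ≢ + p
  x+1≢p e = bool-clash (trans (cong (bead (p ∷ ps)) e) (bead-here p ps)) bf
... | (mu , Pm , sz , m) , h′ =
  (p ∷ mu , cons 0<p (hd≤p h′) Pm
   , tail-size (+ p) (+ size ps) (+ size mu) x (x + 1ℤ) (shift-size′ (+ size ps) (+ size mu) x sz)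
   , Mv-cons p ps mu x≢p x+1≢p m) , inj₁ refl
  where
  x+1≢p : x + 1ℤ ≢ + p
  x+1≢p e = bool-clash (trans (cong (bead (p ∷ ps)) e) (bead-here p ps)) bf
  hd≤p : hd mu ≡ hd ps ⊎ + hd mu ≡ x + 1ℤ + 1ℤ → hd mu ≤ p
  hd≤p (inj₁ e) = subst (_≤ p) (sym e) h
  hd≤p (inj₂ e) = ℤₚ.drop‿+≤+ (subst (ℤ._≤ + p) (sym e)
    (≢⇒< (ℤₚ.≤-trans (bead-≤hd P (Mv.ax m)) (ℤ.+≤+ h)) x+1≢p))

private
  w+1 : ∀ y h → y + (1ℤ + h) ≡ y + h + 1ℤ
  w+1 = solve-∀
  chain-size : ∀ a b c x w y → a + w ≡ b + x → b + y ≡ c + w → a + y ≡ c + x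
  chain-size a b c x w y p q = +-cancelʳ-≡ (b + w) (a + y) (c + x)
    (trans (e₁ a b w y) (trans (cong₂ _+_ p q) (e₂ b c x w)))
    where
    e₁ : ∀ a b w y → a + y + (b + w) ≡ a + w + (b + y)
    e₁ = solve-∀
    e₂ : ∀ b c x w → b + x + (c + w) ≡ c + x + (b + w)
    e₂ = solve-∀

-- Partitions are rebuilt only for unit moves. A longer move is split at the position `w` next to
-- `x`: `Mv-onward` if `w` is empty, `Mv-refill` if it is occupied. `move-up` splits next to `y`
-- instead.
move-down : ∀ h {la x y} → x ≡ y + + suc h → Ptn la → bead la x ≡ true → bead la y ≡ false → Moved la x y
move-down zero refl P bt bf = proj₁ (unit-down P bt bf)
move-down (suc h) {la} {x} {y} refl P bt bf = go (bead la w) refl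
  where
  w = y + + suc h
  x≡w+1 : x ≡ w + 1ℤ
  x≡w+1 = w+1 y (+ suc h)
  x≢y : x ≢ y
  x≢y e = x+1+k≢x y (suc h) (sym e)
  w≢y : w ≢ y
  w≢y e = x+1+k≢x y h (sym e)
  w≢x : w ≢ x
  w≢x e = x+1+k≢x w 0 (trans e x≡w+1)
  go : ∀ b → bead la w ≡ b → Moved la x y
  go false bw with proj₁ (unit-down {la} {w} P (subst (λ z → bead la z ≡ true) x≡w+1 bt) bw)
  ... | nu , Pn , sz , m with move-down h {nu} {w} {y} refl Pn (Mv.by m)
          (trans (sym (Mv.rest m y (λ e → x≢y (trans x≡w+1 (sym e))) (λ e → w≢y (sym e)))) bf)
  ... | mu , Pm , sz′ , m′ = mu , Pm
        , chain-size (+ size la) (+ size nu) (+ size mu) x w y (trans sz (cong (_+_ (+ size nu)) (sym x≡w+1))) sz′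
        , Mv-onward x≢y (subst (λ z → Mv z w (bead la) (bead nu)) (sym x≡w+1) m) m′
  go true bw with move-down h {la} {w} {y} refl P bw bf
  ... | nu , Pn , sz , m with proj₁ (unit-down {nu} {w} Pn
            (subst (λ z → bead nu z ≡ true) x≡w+1 (trans (sym (Mv.rest m x (λ e → w≢x (sym e)) x≢y)) bt)) (Mv.bx m))
  ... | mu , Pm , sz′ , m′ = mu , Pm
        , trans sz (trans sz′ (cong (_+_ (+ size mu)) (sym x≡w+1)))
        , Mv-refill x≢y m (subst (λ z → Mv z w (bead nu) (bead mu)) (sym x≡w+1) m′)

move-up : ∀ h {la x y} → y ≡ x + + suc h → Ptn la → bead la x ≡ true → bead la y ≡ false → Moved la x y
move-up zero refl P bt bf = proj₁ (unit-up P bt bf)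
move-up (suc h) {la} {x} {y} refl P bt bf = go (bead la w) refl
  where
  w = x + + suc h
  y≡w+1 : y ≡ w + 1ℤ
  y≡w+1 = w+1 x (+ suc h)
  x≢y : x ≢ y
  x≢y e = x+1+k≢x x (suc h) e
  w≢x : w ≢ x
  w≢x e = x+1+k≢x x h (sym e)
  w≢y : w ≢ y
  w≢y e = x+1+k≢x w 0 (trans e y≡w+1)
  go : ∀ b → bead la w ≡ b → Moved la x y
  go false bw with move-up h {la} {x} {w} refl P bt bw
  ... | nu , Pn , sz , m with proj₁ (unit-up {nu} {w} Pn (Mv.by m)
          (subst (λ z → bead nu z ≡ false) y≡w+1 (trans (sym (Mv.rest m y (λ e → x≢y (sym e)) (λ e → w≢y (sym e)))) bf)))
  ... | mu , Pm , sz′ , m′ = mu , Pm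
        , chain-size (+ size la) (+ size nu) (+ size mu) x w y sz (trans (cong (_+_ (+ size nu)) y≡w+1) sz′)
        , Mv-onward x≢y m (subst (λ z → Mv w z (bead nu) (bead mu)) (sym y≡w+1) m′)
  go true bw with proj₁ (unit-up {la} {w} P bw (subst (λ z → bead la z ≡ false) y≡w+1 bf))
  ... | nu , Pn , sz , m with move-up h {nu} {x} {w} refl Pn
          (trans (sym (Mv.rest m x (λ e → w≢x (sym e)) (λ e → x≢y (trans e (sym y≡w+1))))) bt) (Mv.bx m)
  ... | mu , Pm , sz′ , m′ = mu , Pm
        , trans (cong (_+_ (+ size la)) y≡w+1) (trans sz sz′)
        , Mv-refill x≢y (subst (λ z → Mv w z (bead la) (bead nu)) (sym y≡w+1) m) m′

abstract
  move : ∀ {la x y} → Ptn la → bead la x ≡ true → bead la y ≡ false → Moved la x y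
  move {la} {x} {y} P bt bf with split x y
  ... | inj₁ x≤y with ≤⇒∃ x≤y
  ...   | zero , e = ⊥-elim (bead-≢ {bead la} bt bf (sym (trans e (ℤₚ.+-identityʳ x))))
  ...   | suc h , e = move-up h e P bt bf
  move {la} {x} {y} P bt bf | inj₂ y<x with ≤⇒∃ y<x
  ... | h , e = move-down h (trans e (ℤₚ.+-assoc y 1ℤ (+ h))) P bt bf

  -- `move` produces some partition with the right size and the right bead set, and the bead set
  -- determines the partition.
  Mv-size : ∀ {la mu x y} → Ptn la → Ptn mu → Mv x y (bead la) (bead mu) → + size la + y ≡ + size mu + x
  Mv-size P Q m with move P (Mv.ax m) (Mv.ay m)
  ... | nu , R , sz , n with bead-injective R Q (Mv-unique n m)
  ... | refl = sz

-- Bead counts on diagonals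

⟦_⟧ : Bool → ℕ
⟦ true ⟧  = 1
⟦ false ⟧ = 0

lt : ℤ → ℤ → ℕ
lt d x = ⟦ does (d + 1ℤ ℤ.≤? x) ⟧

lt-1 : ∀ d {x} → d + 1ℤ ℤ.≤ x → lt d x ≡ 1
lt-1 d {x} p = cong ⟦_⟧ (dec-true (d + 1ℤ ℤ.≤? x) p)

<-clash : ∀ {d x} → x ℤ.≤ d → d + 1ℤ ℤ.≤ x → ⊥
<-clash {d} {x} p q = neg-impossible (gap p ⊕ gap q) (e d x)
  where e : ∀ d x → d - x + (x - (d + 1ℤ)) ≡ - 1ℤ
        e = solve-∀

lt-0 : ∀ {d x} → x ℤ.≤ d → lt d x ≡ 0
lt-0 {d} {x} p = cong ⟦_⟧ (dec-false (d + 1ℤ ℤ.≤? x) (<-clash p))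

lt-step : ∀ d x → lt d x ≡ lt (d + 1ℤ) x ℕ.+ ⟦ is (d + 1ℤ) x ⟧
lt-step d x with eq? (d + 1ℤ) x
... | yes refl = trans (lt-1 d ℤₚ.≤-refl) (sym (cong₂ ℕ._+_ (lt-0 {d + 1ℤ} ℤₚ.≤-refl) (cong ⟦_⟧ (is-refl (d + 1ℤ)))))
... | no ne with split x d
...   | inj₁ x≤d = trans (lt-0 x≤d) (sym (cong₂ ℕ._+_ (lt-0 (ℤₚ.≤-trans x≤d (≤-by {d} _ (0≤+ 1) refl))) (cong ⟦_⟧ (is-≢ ne))))
...   | inj₂ d<x = trans (lt-1 d d<x) (sym (cong₂ ℕ._+_ (lt-1 (d + 1ℤ) (≢⇒< d<x ne)) (cong ⟦_⟧ (is-≢ ne))))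

-- The beads of the empty partition are the nonpositive integers; for negative d exactly -d of them
-- lie beyond d.
deficit : ℤ → ℕ
deficit (+ _)    = 0
deficit -[1+ n ] = suc n

deficit-step : ∀ d → deficit d ≡ deficit (d + 1ℤ) ℕ.+ ⟦ nonpos (d + 1ℤ) ⟧
deficit-step (+ n) = sym (cong₂ ℕ._+_ {x = deficit (+ (n ℕ.+ 1))} {y = 0} refl
  (cong ⟦_⟧ (nonpos-false (ℤₚ.+-monoˡ-≤ 1ℤ (0≤+ n)))))
deficit-step -[1+ zero ] = refl
deficit-step -[1+ suc n ] = ℕₚ.+-comm 1 (suc n)

-- The number of beads at positions beyond d, so that (r , c) lies in the diagram
-- of la iff r < cnt la (c - r).
cnt : List ℕ → ℤ → ℕ
cnt []       d = deficit d
cnt (p ∷ ps) d = lt d (+ p) ℕ.+ cnt ps (d + 1ℤ)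

swap-middle : ∀ a b c d → (a ℕ.+ b) ℕ.+ (c ℕ.+ d) ≡ (a ℕ.+ c) ℕ.+ (b ℕ.+ d)
swap-middle a b c d = trans (ℕₚ.+-assoc a b (c ℕ.+ d)) (trans (cong (a ℕ.+_)
  (trans (sym (ℕₚ.+-assoc b c d)) (trans (cong (ℕ._+ d) (ℕₚ.+-comm b c)) (ℕₚ.+-assoc c b d))))
  (sym (ℕₚ.+-assoc a c (b ℕ.+ d))))
x≤x+1 : ∀ x → x ℤ.≤ x + 1ℤ
x≤x+1 x = ≤-by _ (0≤+ 1) refl

cnt-step : ∀ {la} → Ptn la → ∀ d → cnt la d ≡ cnt la (d + 1ℤ) ℕ.+ ⟦ bead la (d + 1ℤ) ⟧
cnt-step nil d = deficit-step d
cnt-step {p ∷ ps} (cons _ h P) d = trans (cong₂ ℕ._+_ (lt-step d (+ p)) (cnt-step P (d + 1ℤ)))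
  (trans (swap-middle (lt (d + 1ℤ) (+ p)) ⟦ is (d + 1ℤ) (+ p) ⟧ (cnt ps (d + 1ℤ + 1ℤ)) ⟦ bead ps (d + 1ℤ + 1ℤ) ⟧)
    (cong (cnt (p ∷ ps) (d + 1ℤ) ℕ.+_) disjoint))
  where
  disjoint : ⟦ is (d + 1ℤ) (+ p) ⟧ ℕ.+ ⟦ bead ps (d + 1ℤ + 1ℤ) ⟧ ≡ ⟦ bead (p ∷ ps) (d + 1ℤ) ⟧
  disjoint with eq? (d + 1ℤ) (+ p)
  ... | no ne = trans (cong (λ b → ⟦ b ⟧ ℕ.+ ⟦ bead ps (d + 1ℤ + 1ℤ) ⟧) (is-≢ ne)) (sym (cong ⟦_⟧ (bead-there ps ne)))
  ... | yes e = trans (cong₂ (λ b c → ⟦ b ⟧ ℕ.+ ⟦ c ⟧) (trans (cong (λ z → is z (+ p)) e) (is-refl (+ p)))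
                        (bead-high P (subst (λ z → + hd ps + 1ℤ ℤ.≤ z + 1ℤ) (sym e) (ℤₚ.+-monoˡ-≤ 1ℤ (ℤ.+≤+ h)))))
                      (sym (cong ⟦_⟧ (trans (cong (bead (p ∷ ps)) e) (bead-here p ps))))

cnt-high : ∀ {la d} → Ptn la → + hd la ℤ.≤ d → cnt la d ≡ 0
cnt-high {d = + _} nil _ = refl
cnt-high {d = -[1+ _ ]} nil ()
cnt-high {p ∷ ps} {d} (cons _ h P) p≤d = cong₂ ℕ._+_ (lt-0 p≤d)
  (cnt-high P (ℤₚ.≤-trans (ℤ.+≤+ h) (ℤₚ.≤-trans p≤d (x≤x+1 d))))

private
  suc-shift : ∀ d n → d + 1ℤ + n ≡ d + (1ℤ + n)
  suc-shift = solve-∀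

-- Row `cnt la d` and column `d + cnt la d` give the first cell of diagonal d outside the diagram;
-- nonnegativity makes this an actual node.
cnt-nonneg : ∀ la d → 0ℤ ℤ.≤ d + + cnt la d
cnt-nonneg [] (+ n) = 0≤+ _
cnt-nonneg [] -[1+ n ] = subst (0ℤ ℤ.≤_) (sym (ℤₚ.+-inverseˡ (+ suc n))) (0≤+ 0)
cnt-nonneg (p ∷ ps) d with split (+ p) d
... | inj₂ d<p = subst (λ k → 0ℤ ℤ.≤ d + + (k ℕ.+ cnt ps (d + 1ℤ))) (sym (lt-1 d d<p))
                   (subst (0ℤ ℤ.≤_) (suc-shift d (+ cnt ps (d + 1ℤ))) (cnt-nonneg ps (d + 1ℤ)))
... | inj₁ p≤d = ℤₚ.+-mono-≤ (ℤₚ.≤-trans (0≤+ p) p≤d) (0≤+ _)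

cnt-low : ∀ {la} → Ptn la → ∀ d → d ℤ.≤ - (+ length la) → d + + cnt la d ≡ 0ℤ
cnt-low nil (+ zero) _ = refl
cnt-low nil -[1+ n ] _ = ℤₚ.+-inverseˡ (+ suc n)
cnt-low nil (+ suc _) (ℤ.+≤+ ())
cnt-low {p ∷ ps} (cons _ _ P) d d≤ = trans (cong (λ k → d + + (k ℕ.+ cnt ps (d + 1ℤ))) (lt-1 d d<p))
  (trans (sym (suc-shift d (+ cnt ps (d + 1ℤ)))) (cnt-low P (d + 1ℤ) d+1≤))
  where
  e : ∀ d l → - l ≡ d + 1ℤ + (- (1ℤ + l) - d)
  e = solve-∀
  d+1≤ : d + 1ℤ ℤ.≤ - (+ length ps)
  d+1≤ = ≤-by _ (gap d≤) (e d (+ length ps))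
  d<p : d + 1ℤ ℤ.≤ + p
  d<p = ℤₚ.≤-trans d+1≤ (ℤₚ.≤-trans ℤₚ.neg-≤-pos (0≤+ p))

part-≤hd : ∀ {la} → Ptn la → ∀ r → part la r ≤ hd la
part-≤hd nil _ = z≤n
part-≤hd (cons _ h P) zero = ℕₚ.≤-refl
part-≤hd (cons _ h P) (suc r) = ℕₚ.≤-trans (part-≤hd P r) h

InDiag⇒cnt : ∀ {la} → Ptn la → ∀ r c d → d + + r ≡ + c → c < part la r → r < cnt la d
InDiag⇒cnt (cons {p} {ps} _ h P) zero c d e c<p =
  subst (λ k → 0 < k ℕ.+ cnt ps (d + 1ℤ)) (sym (lt-1 d (subst (λ z → z + 1ℤ ℤ.≤ + p) (sym (trans (sym (ℤₚ.+-identityʳ d)) e))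
    (subst (ℤ._≤ + p) (ℤₚ.+-comm 1ℤ (+ c)) (ℤ.+≤+ c<p))))) (s≤s z≤n)
InDiag⇒cnt (cons {p} {ps} _ h P) (suc r) c d e c< =
  subst (λ k → suc r < k ℕ.+ cnt ps (d + 1ℤ)) (sym (lt-1 d d<p)) (s≤s (InDiag⇒cnt P r c (d + 1ℤ) (trans (suc-shift d (+ r)) e) c<))
  where
  c<p : suc c ≤ p
  c<p = ℕₚ.≤-trans c< (ℕₚ.≤-trans (part-≤hd P r) h)
  e′ : ∀ d r p → p ≡ d + 1ℤ + (p - (1ℤ + (d + (1ℤ + r))) + (1ℤ + r))
  e′ = solve-∀
  d<p : d + 1ℤ ℤ.≤ + p
  d<p = ≤-by _ (gap (subst (λ z → 1ℤ + z ℤ.≤ + p) (sym e) (ℤ.+≤+ c<p)) ⊕ 0≤+ (suc r)) (e′ d (+ r) (+ p))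

cnt⇒InDiag : ∀ {la} → Ptn la → ∀ r c d → d + + r ≡ + c → r < cnt la d → c < part la r
cnt⇒InDiag nil r c -[1+ n ] e (s≤s r≤n) = ⊥-elim (neg (subst (0ℤ ℤ.≤_) (sym e) (0≤+ c)))
  where
  neg : ¬ (0ℤ ℤ.≤ -[1+ n ] + + r)
  neg p = neg-impossible (p ⊕ gap (ℤ.+≤+ r≤n)) (eq (+ n) (+ r))
    where eq : ∀ n r → - (1ℤ + n) + r + (n - r) ≡ - 1ℤ
          eq = solve-∀
cnt⇒InDiag {p ∷ ps} (cons 0<p h P) r c d e r< with split (+ p) d
... | inj₁ p≤d = ⊥-elim (ℕₚ.n≮0 (subst (r <_) (cnt-high (cons 0<p h P) p≤d) r<))
cnt⇒InDiag {p ∷ ps} (cons _ h P) zero c d e r< | inj₂ d<p =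
  ℤₚ.drop‿+≤+ (subst (ℤ._≤ + p) (trans (cong (_+ 1ℤ) (trans (sym (ℤₚ.+-identityʳ d)) e)) (ℤₚ.+-comm (+ c) 1ℤ)) d<p)
cnt⇒InDiag {p ∷ ps} (cons _ h P) (suc r) c d e r< | inj₂ d<p =
  cnt⇒InDiag P r c (d + 1ℤ) (trans (suc-shift d (+ r)) e)
    (ℕ.s≤s⁻¹ (subst (λ k → suc r < k ℕ.+ cnt ps (d + 1ℤ)) (lt-1 d d<p) r<))

-- A bead move shifts the counts on an interval

-- A move as an additive identity, which can be summed over diagonals and over residue classes
-- without case distinctions.
Mv-pointwise : ∀ {x y a b} → Mv x y a b → ∀ z → ⟦ a z ⟧ ℕ.+ ⟦ is z y ⟧ ≡ ⟦ b z ⟧ ℕ.+ ⟦ is z x ⟧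
Mv-pointwise {x} {y} {a} {b} m z with eq? z x | eq? z y
... | yes refl | yes refl = ⊥-elim (Mv-≢ m refl)
... | yes refl | no q rewrite Mv.ax m | Mv.bx m | is-≢ q | is-refl z = refl
... | no p | yes refl rewrite Mv.ay m | Mv.by m | is-≢ p | is-refl z = refl
... | no p | no q rewrite Mv.rest m z p q | is-≢ p | is-≢ q = refl

pointwise-Mv : ∀ {x y} {a b : ℤ → Bool} → x ≢ y → (∀ z → ⟦ a z ⟧ ℕ.+ ⟦ is z y ⟧ ≡ ⟦ b z ⟧ ℕ.+ ⟦ is z x ⟧) → Mv x y a b
pointwise-Mv {x} {y} {a} {b} x≢y pt = mv (proj₁ atx) (proj₂ aty) (proj₂ atx) (proj₁ aty) rest
  where
  gain : ∀ u v → ⟦ u ⟧ ℕ.+ 0 ≡ ⟦ v ⟧ ℕ.+ 1 → u ≡ true × v ≡ false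
  gain true  false _ = refl , refl
  gain true  true  ()
  gain false true  ()
  gain false false ()
  same : ∀ u v → ⟦ u ⟧ ℕ.+ 0 ≡ ⟦ v ⟧ ℕ.+ 0 → u ≡ v
  same true  true  _ = refl
  same false false _ = refl
  same true  false ()
  same false true  ()
  at : ∀ z {i j} → is z y ≡ i → is z x ≡ j → ⟦ a z ⟧ ℕ.+ ⟦ i ⟧ ≡ ⟦ b z ⟧ ℕ.+ ⟦ j ⟧
  at z refl refl = pt z
  atx = gain (a x) (b x) (at x (is-≢ x≢y) (is-refl x))
  aty = gain (b y) (a y) (sym (at y (is-refl y) (is-≢ (λ e → x≢y (sym e)))))
  rest : ∀ z → z ≢ x → z ≢ y → a z ≡ b z
  rest z p q = same (a z) (b z) (at z (is-≢ q) (is-≢ p))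

-- Downward induction on d. Beyond the largest beads all four terms vanish, and each step down adds
-- one instance of `Mv-pointwise`.
Mv-cnt : ∀ {la mu x y} → Ptn la → Ptn mu → Mv x y (bead la) (bead mu) → ∀ d → cnt la d ℕ.+ lt d y ≡ cnt mu d ℕ.+ lt d x
Mv-cnt {la} {mu} {x} {y} P Q m d = go (proj₁ bound) d (proj₂ bound)
  where
  D = + hd la + + hd mu
  go : ∀ k d → D ℤ.≤ d + + k → cnt la d ℕ.+ lt d y ≡ cnt mu d ℕ.+ lt d x
  go zero d D≤ = trans (cong₂ ℕ._+_ (cnt-high P la≤) (lt-0 (ℤₚ.≤-trans (bead-≤hd Q (Mv.by m)) mu≤)))
                  (sym (cong₂ ℕ._+_ (cnt-high Q mu≤) (lt-0 (ℤₚ.≤-trans (bead-≤hd P (Mv.ax m)) la≤))))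
    where
    D≤d : D ℤ.≤ d
    D≤d = subst (D ℤ.≤_) (ℤₚ.+-identityʳ d) D≤
    la≤ : + hd la ℤ.≤ d
    la≤ = ℤₚ.≤-trans (≤-by _ (0≤+ (hd mu)) refl) D≤d
    mu≤ : + hd mu ℤ.≤ d
    mu≤ = ℤₚ.≤-trans (≤-by _ (0≤+ (hd la)) (ℤₚ.+-comm (+ hd la) (+ hd mu))) D≤d
  go (suc k) d D≤ = begin
    cnt la d ℕ.+ lt d y
      ≡⟨ cong₂ ℕ._+_ (cnt-step P d) (lt-step d y) ⟩
    (cnt la (d + 1ℤ) ℕ.+ ⟦ bead la (d + 1ℤ) ⟧) ℕ.+ (lt (d + 1ℤ) y ℕ.+ ⟦ is (d + 1ℤ) y ⟧)
      ≡⟨ swap-middle (cnt la (d + 1ℤ)) _ (lt (d + 1ℤ) y) _ ⟩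
    (cnt la (d + 1ℤ) ℕ.+ lt (d + 1ℤ) y) ℕ.+ (⟦ bead la (d + 1ℤ) ⟧ ℕ.+ ⟦ is (d + 1ℤ) y ⟧)
      ≡⟨ cong₂ ℕ._+_ (go k (d + 1ℤ) (subst (D ℤ.≤_) (sym (suc-shift d (+ k))) D≤)) (Mv-pointwise m (d + 1ℤ)) ⟩
    (cnt mu (d + 1ℤ) ℕ.+ lt (d + 1ℤ) x) ℕ.+ (⟦ bead mu (d + 1ℤ) ⟧ ℕ.+ ⟦ is (d + 1ℤ) x ⟧)
      ≡⟨ swap-middle (cnt mu (d + 1ℤ)) (lt (d + 1ℤ) x) _ _ ⟩
    (cnt mu (d + 1ℤ) ℕ.+ ⟦ bead mu (d + 1ℤ) ⟧) ℕ.+ (lt (d + 1ℤ) x ℕ.+ ⟦ is (d + 1ℤ) x ⟧)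
      ≡⟨ cong₂ ℕ._+_ (cnt-step Q d) (lt-step d x) ⟨
    cnt mu d ℕ.+ lt d x ∎
    where open ≡-Reasoning
  bound : Σ ℕ λ k → D ℤ.≤ d + + k
  bound with split D d
  ... | inj₁ p = 0 , subst (D ℤ.≤_) (sym (ℤₚ.+-identityʳ d)) p
  ... | inj₂ q with ≤⇒∃ q
  ...   | k , e = suc k , ℤₚ.≤-reflexive (trans e (suc-shift d (+ k)))

-- The difference of the hypothesis at d and at d + 1 is the pointwise identity at position d + 1.
cnt-Mv : ∀ {la mu x y} → Ptn la → Ptn mu → x ≢ y → (∀ d → cnt la d ℕ.+ lt d y ≡ cnt mu d ℕ.+ lt d x) → Mv x y (bead la) (bead mu)
cnt-Mv {la} {mu} {x} {y} P Q x≢y F = pointwise-Mv x≢y λ z →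
  subst (λ z → ⟦ bead la z ⟧ ℕ.+ ⟦ is z y ⟧ ≡ ⟦ bead mu z ⟧ ℕ.+ ⟦ is z x ⟧) (e z) (at (z - 1ℤ))
  where
  e : ∀ z → z - 1ℤ + 1ℤ ≡ z
  e = solve-∀
  at : ∀ d → ⟦ bead la (d + 1ℤ) ⟧ ℕ.+ ⟦ is (d + 1ℤ) y ⟧ ≡ ⟦ bead mu (d + 1ℤ) ⟧ ℕ.+ ⟦ is (d + 1ℤ) x ⟧
  at d = ℕₚ.+-cancelˡ-≡ (cnt la (d + 1ℤ) ℕ.+ lt (d + 1ℤ) y) _ _ (begin
    (cnt la (d + 1ℤ) ℕ.+ lt (d + 1ℤ) y) ℕ.+ (⟦ bead la (d + 1ℤ) ⟧ ℕ.+ ⟦ is (d + 1ℤ) y ⟧)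
      ≡⟨ swap-middle (cnt la (d + 1ℤ)) (lt (d + 1ℤ) y) _ _ ⟩
    (cnt la (d + 1ℤ) ℕ.+ ⟦ bead la (d + 1ℤ) ⟧) ℕ.+ (lt (d + 1ℤ) y ℕ.+ ⟦ is (d + 1ℤ) y ⟧)
      ≡⟨ cong₂ ℕ._+_ (cnt-step P d) (lt-step d y) ⟨
    cnt la d ℕ.+ lt d y
      ≡⟨ F d ⟩
    cnt mu d ℕ.+ lt d x
      ≡⟨ cong₂ ℕ._+_ (cnt-step Q d) (lt-step d x) ⟩
    (cnt mu (d + 1ℤ) ℕ.+ ⟦ bead mu (d + 1ℤ) ⟧) ℕ.+ (lt (d + 1ℤ) x ℕ.+ ⟦ is (d + 1ℤ) x ⟧)
      ≡⟨ swap-middle (cnt mu (d + 1ℤ)) _ (lt (d + 1ℤ) x) _ ⟩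
    (cnt mu (d + 1ℤ) ℕ.+ lt (d + 1ℤ) x) ℕ.+ (⟦ bead mu (d + 1ℤ) ⟧ ℕ.+ ⟦ is (d + 1ℤ) x ⟧)
      ≡⟨ cong (ℕ._+ (⟦ bead mu (d + 1ℤ) ⟧ ℕ.+ ⟦ is (d + 1ℤ) x ⟧)) (F (d + 1ℤ)) ⟨
    (cnt la (d + 1ℤ) ℕ.+ lt (d + 1ℤ) y) ℕ.+ (⟦ bead mu (d + 1ℤ) ⟧ ℕ.+ ⟦ is (d + 1ℤ) x ⟧) ∎)
    where open ≡-Reasoning

-- Rim hooks are single bead moves

ct : Node → ℤ
ct (r , c) = + c - + r

ct-eq : ∀ r c → ct (r , c) + + r ≡ + c
ct-eq r c = e (+ r) (+ c)
  where e : ∀ r c → c - r + r ≡ c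
        e = solve-∀

cell-at : ∀ la d → Σ ℕ λ c → d + + cnt la d ≡ + c
cell-at la d with ≤⇒∃ (cnt-nonneg la d)
... | c , e = c , trans e (ℤₚ.+-identityˡ (+ c))

ct-at : ∀ d r c → d + + r ≡ + c → ct (r , c) ≡ d
ct-at d r c e = trans (cong (_- + r) (sym e)) (e′ d (+ r))
  where e′ : ∀ d r → d + r - r ≡ d
        e′ = solve-∀

Adj-ct : ∀ {a b} → Adj a b → ct b ℤ.≤ ct a + 1ℤ
Adj-ct (right {r} {c}) = ≤-by _ (0≤+ 0) (e (+ r) (+ c))
  where e : ∀ r c → c - r + 1ℤ ≡ 1ℤ + c - r + 0ℤ
        e = solve-∀
Adj-ct (left {r} {c}) = ≤-by _ (0≤+ 2) (e (+ r) (+ c))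
  where e : ∀ r c → 1ℤ + c - r + 1ℤ ≡ c - r + + 2
        e = solve-∀
Adj-ct (down {r} {c}) = ≤-by _ (0≤+ 2) (e (+ r) (+ c))
  where e : ∀ r c → c - r + 1ℤ ≡ c - (1ℤ + r) + + 2
        e = solve-∀
Adj-ct (up {r} {c}) = ≤-by _ (0≤+ 0) (e (+ r) (+ c))
  where e : ∀ r c → c - (1ℤ + r) + 1ℤ ≡ c - r + 0ℤ
        e = solve-∀

-- A discrete intermediate value theorem: the content `ct` increases by at most 1 along each step of
-- the path.
Conn-between : ∀ {P a b} → Conn P a b → ∀ d → ct a ℤ.≤ d → d ℤ.≤ ct b → Σ Node λ x → P x × ct x ≡ d
Conn-between {a = a} (here p) d u v = a , p , ℤₚ.≤-antisym u v
Conn-between {a = a} (there p adj w) d u v with eq? (ct a) d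
... | yes e = a , p , e
... | no ne = Conn-between w d (ℤₚ.≤-trans (Adj-ct adj) (≢⇒< u ne)) v

first-fail : ∀ {P : ℕ → Set} → (∀ n → Dec (P n)) → ∀ n → ¬ P n → Σ ℕ λ u → ¬ P u × (∀ k → k < u → P k)
first-fail P? n ¬pn with P? 0
... | no ¬p0 = 0 , ¬p0 , λ _ ()
first-fail P? zero ¬pn | yes p0 = ⊥-elim (¬pn p0)
first-fail P? (suc n) ¬pn | yes p0 with first-fail (λ k → P? (suc k)) n ¬pn
... | u , ¬pu , below = suc u , ¬pu , λ { zero _ → p0 ; (suc k) (s≤s k<u) → below k k<u }

module _ {la mu} (R : RimHookRemoval la mu) where
  open RimHookRemoval R
  private
    P = toPtn {la} partλ
    Q = toPtn {mu} partμ

    Removed : ℤ → Set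
    Removed d = cnt mu d < cnt la d

    skew⇒removed : ∀ x → Skew la mu x → Removed (ct x)
    skew⇒removed (r , c) (inla , ¬inmu) =
      ℕₚ.≤-<-trans (ℕₚ.≮⇒≥ λ r< → ¬inmu (cnt⇒InDiag Q r c (ct (r , c)) (ct-eq r c) r<)) (InDiag⇒cnt P r c (ct (r , c)) (ct-eq r c) inla)

    cell : ∀ d → Removed d → Σ Node λ x → Skew la mu x × ct x ≡ d
    cell d rem with cell-at mu d
    ... | c , e = (cnt mu d , c) , (cnt⇒InDiag P (cnt mu d) c d e rem
                , λ inmu → ℕₚ.<-irrefl refl (InDiag⇒cnt Q (cnt mu d) c d e inmu)) , ct-at d (cnt mu d) c e

    cnt-mono : ∀ d → cnt mu d ≤ cnt la d
    cnt-mono d with cell-at la d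
    ... | c , e = ℕₚ.≮⇒≥ λ lt → ℕₚ.<-irrefl refl
                    (InDiag⇒cnt P (cnt la d) c d e (sub _ (cnt⇒InDiag Q (cnt la d) c d e lt)))

    -- Two removed cells on one diagonal would include a cell (r , c) with (r + 1 , c + 1) still in
    -- `la`, so (r , c) would not lie on the rim.
    cnt-≤suc : ∀ d → cnt la d ≤ suc (cnt mu d)
    cnt-≤suc d = ℕₚ.≮⇒≥ two
      where
      two : ¬ (suc (cnt mu d) < cnt la d)
      two lt with cell-at mu d
      ... | c , e = proj₂ (rim (cnt mu d , c) (cnt⇒InDiag P (cnt mu d) c d e (ℕₚ.<-trans (ℕₚ.n<1+n _) lt)
                          , λ inmu → ℕₚ.<-irrefl refl (InDiag⇒cnt Q (cnt mu d) c d e inmu)))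
                    (cnt⇒InDiag P (suc (cnt mu d)) (suc c) d (trans (e′ d (+ cnt mu d)) (cong (_+_ 1ℤ) e)) lt)
        where e′ : ∀ d m → d + (1ℤ + m) ≡ 1ℤ + (d + m)
              e′ = solve-∀

    convex : ∀ {d₁ d d₂} → Removed d₁ → Removed d₂ → d₁ ℤ.≤ d → d ℤ.≤ d₂ → Removed d
    convex {d₁} {d} {d₂} r₁ r₂ u v with cell d₁ r₁ | cell d₂ r₂
    ... | a , sa , refl | b , sb , refl with Conn-between (connected a b sa sb) d u v
    ... | x , sx , refl = skew⇒removed x sx

    Removed? : ∀ d → Dec (Removed d)
    Removed? d = cnt mu d ℕ.<? cnt la d

    d₀ : ℤ
    d₀ = ct (proj₁ nonempty)

    r₀ : Removed d₀
    r₀ = skew⇒removed _ (proj₂ nonempty)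

    upper : Σ ℕ λ n → ¬ Removed (d₀ + + n)
    upper with split (+ hd la) d₀
    ... | inj₁ p = ⊥-elim (ℕₚ.n≮0 (subst (cnt mu d₀ <_) (cnt-high P p) r₀))
    ... | inj₂ q with ≤⇒∃ q
    ...   | k , e = suc k , λ r → ℕₚ.n≮0 (subst (cnt mu (d₀ + + suc k) <_) (cnt-high P (ℤₚ.≤-reflexive (trans e (suc-shift d₀ (+ k))))) r)

    -- Far enough down, `cnt-low` gives both counts the value -d, so nothing is removed there.
    lower : Σ ℕ λ n → ¬ Removed (d₀ - + n)
    lower = n , λ r → ℕₚ.<-irrefl (sym (ℤₚ.+-injective (+-cancelˡ-≡ d (+ cnt la d) (+ cnt mu d)
                  (trans (cnt-low P d (≤-by _ (0≤+ (length mu) ⊕ gap (i≤∣i∣ d₀)) (e (+ length la) (+ length mu) d₀ (+ ℤ.∣ d₀ ∣))))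
                     (sym (cnt-low Q d (≤-by _ (0≤+ (length la) ⊕ gap (i≤∣i∣ d₀)) (e′ (+ length la) (+ length mu) d₀ (+ ℤ.∣ d₀ ∣)))))))))
                  r
      where
      n = ℤ.∣ d₀ ∣ ℕ.+ (length la ℕ.+ length mu)
      d = d₀ - + n
      e : ∀ l m x a → - l ≡ x - (a + (l + m)) + (m + (a - x))
      e = solve-∀
      e′ : ∀ l m x a → - m ≡ x - (a + (l + m)) + (l + (a - x))
      e′ = solve-∀

  -- The counts of `la` and `mu` differ by at most 1 because the hook lies on the rim, and the
  -- diagonals where they differ form an interval because the hook is connected. The ends of this
  -- interval are the two positions of the moved bead.
  hook-move : Σ ℤ λ x → Σ ℤ λ y → y + 1ℤ ℤ.≤ x × Mv x y (bead la) (bead mu)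
  hook-move with first-fail (λ k → Removed? (d₀ + + k)) (proj₁ upper) (proj₂ upper)
                 | first-fail (λ k → Removed? (d₀ - + k)) (proj₁ lower) (proj₂ lower)
  ... | u , ¬u , below-u | v , ¬v , below-v = x , y , y<x , cnt-Mv P Q (λ e → x≢y e) formula
    where
    e₀ : ∀ d → d ≡ d + 0ℤ
    e₀ = solve-∀
    -- The removed diagonals are y ≤ d < x, because `lt d` counts positions strictly beyond d. Hence
    -- `x` is the first unaffected diagonal above `d₀`, while `y` is one more than the first
    -- unaffected one below.
    x = d₀ + + u
    y = d₀ - + v + 1ℤ
    1≤u : 1 ≤ u
    1≤u = ℕₚ.n≢0⇒n>0 λ { refl → ¬u (subst Removed (e₀ d₀) r₀) }
    1≤v : 1 ≤ v
    1≤v = ℕₚ.n≢0⇒n>0 λ { refl → ¬v (subst Removed (e₀ d₀) r₀) }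
    e₁ : ∀ d u v → d + u ≡ d - v + 1ℤ + 1ℤ + (u - 1ℤ + (v - 1ℤ))
    e₁ = solve-∀
    y<x : y + 1ℤ ℤ.≤ x
    y<x = ≤-by _ (gap (ℤ.+≤+ 1≤u) ⊕ gap (ℤ.+≤+ 1≤v)) (e₁ d₀ (+ u) (+ v))
    x≢y : x ≢ y
    x≢y e = <-clash (ℤₚ.≤-reflexive e) y<x
    e₂ : ∀ d v → d ≡ d - v + v
    e₂ = solve-∀
    not-below : ∀ {d} → d + 1ℤ ℤ.≤ y → ¬ Removed d
    not-below {d} p r = ¬v (convex r r₀ (≤-by _ (gap p) (e d₀ (+ v) d)) (≤-by _ (0≤+ v) (e₂ d₀ (+ v))))
      where e : ∀ d₀ v d → d₀ - v ≡ d + (d₀ - v + 1ℤ - (d + 1ℤ))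
            e = solve-∀
    not-above : ∀ {d} → x ℤ.≤ d → ¬ Removed d
    not-above {d} p r = ¬u (convex r₀ r (≤-by _ (0≤+ u) refl) p)
    inside : ∀ {d} → y ℤ.≤ d → d + 1ℤ ℤ.≤ x → Removed d
    inside {d} p q with split d₀ d
    ... | inj₁ d₀≤d with ≤⇒∃ d₀≤d
    ...   | k , refl = below-u k (ℤₚ.drop‿+≤+ (≤-by _ (gap q) (e d₀ (+ k) (+ u))))
      where e : ∀ d k u → u ≡ 1ℤ + k + (d + u - (d + k + 1ℤ))
            e = solve-∀
    inside {d} p q | inj₂ d<d₀ with ≤⇒∃ d<d₀
    ...   | k , eq = subst Removed (trans (cong (_- + suc k) eq) (e d (+ k))) (below-v (suc k) (ℤₚ.drop‿+≤+
              (≤-by _ (gap (subst (λ z → z - + v + 1ℤ ℤ.≤ d) eq p)) (e′ d (+ k) (+ v)))))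
      where e : ∀ d k → d + 1ℤ + k - (1ℤ + k) ≡ d
            e = solve-∀
            e′ : ∀ d k v → v ≡ 1ℤ + (1ℤ + k) + (d - (d + 1ℤ + k - v + 1ℤ))
            e′ = solve-∀
    equal : ∀ {d} → ¬ Removed d → cnt la d ≡ cnt mu d
    equal {d} ¬r = ℕₚ.≤-antisym (ℕₚ.≮⇒≥ ¬r) (cnt-mono d)
    formula : ∀ d → cnt la d ℕ.+ lt d y ≡ cnt mu d ℕ.+ lt d x
    formula d with split y d | split x d
    ... | inj₁ p | inj₁ q = cong₂ ℕ._+_ (equal (not-above q)) (trans (lt-0 p) (sym (lt-0 q)))
    ... | inj₁ p | inj₂ q = trans (cong₂ ℕ._+_ (ℕₚ.≤-antisym (cnt-≤suc d) (inside p q)) (lt-0 p))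
                              (trans (ℕₚ.+-comm (suc (cnt mu d)) 0) (trans (ℕₚ.+-comm 1 (cnt mu d)) (cong (cnt mu d ℕ.+_) (sym (lt-1 d q)))))
    ... | inj₂ p | inj₁ q = ⊥-elim (<-clash (ℤₚ.≤-trans q (≤-by _ (0≤+ 1) refl)) (ℤₚ.≤-trans (ℤₚ.+-monoˡ-≤ 1ℤ p) y<x))
    ... | inj₂ p | inj₂ q = cong₂ ℕ._+_ (equal (not-below p)) (trans (lt-1 d p) (sym (lt-1 d q)))

abstract
  rim-hook⇒Mv : ∀ {la mu} → RimHookRemoval la mu → Σ ℤ λ x → Σ ℤ λ y → y + 1ℤ ℤ.≤ x × Mv x y (bead la) (bead mu)
  rim-hook⇒Mv = hook-move

-- From a bead move back to a rim hook

Conn-trans : ∀ {P a b c} → Conn P a b → Conn P b c → Conn P a c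
Conn-trans (here _) w = w
Conn-trans (there p adj v) w = there p adj (Conn-trans v w)

Adj-sym : ∀ {a b} → Adj a b → Adj b a
Adj-sym right = left
Adj-sym left  = right
Adj-sym down  = up
Adj-sym up    = down

Conn-start : ∀ {P a b} → Conn P a b → P a
Conn-start (here p) = p
Conn-start (there p _ _) = p

Conn-sym : ∀ {P a b} → Conn P a b → Conn P b a
Conn-sym (here p) = here p
Conn-sym (there p adj w) = Conn-trans (Conn-sym w) (there (Conn-start w) (Adj-sym adj) (here p))

module _ {la mu x y} (P : Ptn la) (Q : Ptn mu) (y<x : y + 1ℤ ℤ.≤ x) (m : Mv x y (bead la) (bead mu)) where
  private
    inside : ∀ {d} → y ℤ.≤ d → d + 1ℤ ℤ.≤ x → cnt la d ≡ suc (cnt mu d)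
    inside {d} p q = trans (sym (trans (cong (cnt la d ℕ.+_) (lt-0 p)) (ℕₚ.+-identityʳ _)))
      (trans (Mv-cnt P Q m d) (trans (cong (cnt mu d ℕ.+_) (lt-1 d q)) (ℕₚ.+-comm _ 1)))

    outside : ∀ {d} → d + 1ℤ ℤ.≤ y ⊎ x ℤ.≤ d → cnt la d ≡ cnt mu d
    outside {d} (inj₁ p) = ℕₚ.+-cancelʳ-≡ 1 (cnt la d) (cnt mu d) (trans (cong (cnt la d ℕ.+_) (sym (lt-1 d p)))
      (trans (Mv-cnt P Q m d) (cong (cnt mu d ℕ.+_) (lt-1 d (ℤₚ.≤-trans p (ℤₚ.≤-trans (x≤x+1 y) y<x))))))
    outside {d} (inj₂ p) = ℕₚ.+-cancelʳ-≡ 0 (cnt la d) (cnt mu d) (trans (cong (cnt la d ℕ.+_) (sym (lt-0 (ℤₚ.≤-trans (x≤x+1 y) (ℤₚ.≤-trans y<x p)))))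
      (trans (Mv-cnt P Q m d) (cong (cnt mu d ℕ.+_) (lt-0 p))))

    cnt-mono : ∀ d → cnt mu d ≤ cnt la d
    cnt-mono d with split y d | split x d
    ... | inj₁ p | inj₂ q = ℕₚ.≤-trans (ℕₚ.n≤1+n _) (ℕₚ.≤-reflexive (sym (inside p q)))
    ... | inj₂ p | _      = ℕₚ.≤-reflexive (sym (outside (inj₁ p)))
    ... | inj₁ _ | inj₁ q = ℕₚ.≤-reflexive (sym (outside (inj₂ q)))

    removed : ∀ {d r} → r < cnt la d → ¬ (r < cnt mu d) → y ℤ.≤ d × d + 1ℤ ℤ.≤ x × r ≡ cnt mu d
    removed {d} {r} r<la r≮mu with split y d | split x d
    ... | inj₁ p | inj₂ q = p , q , ℕₚ.≤-antisym (ℕ.s≤s⁻¹ (subst (r <_) (inside p q) r<la)) (ℕₚ.≮⇒≥ r≮mu)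
    ... | inj₂ p | _      = ⊥-elim (r≮mu (subst (r <_) (outside (inj₁ p)) r<la))
    ... | inj₁ _ | inj₁ q = ⊥-elim (r≮mu (subst (r <_) (outside (inj₂ q)) r<la))

    skew : ∀ r c → Skew la mu (r , c) → y ℤ.≤ ct (r , c) × ct (r , c) + 1ℤ ℤ.≤ x × r ≡ cnt mu (ct (r , c))
    skew r c (inla , ¬inmu) = removed (InDiag⇒cnt P r c (ct (r , c)) (ct-eq r c) inla)
                                      (λ r< → ¬inmu (cnt⇒InDiag Q r c (ct (r , c)) (ct-eq r c) r<))

    unskew : ∀ {d} c → y ℤ.≤ d → d + 1ℤ ℤ.≤ x → d + + cnt mu d ≡ + c → Skew la mu (cnt mu d , c)
    unskew {d} c p q e = cnt⇒InDiag P (cnt mu d) c d e (ℕₚ.≤-reflexive (sym (inside p q)))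
                   , λ i → ℕₚ.<-irrefl refl (InDiag⇒cnt Q (cnt mu d) c d e i)

    -- Consecutive diagonals of the hook carry adjacent cells: the step is
    -- horizontal or vertical according to the bead in between.
    next : ∀ d c c′ → y ℤ.≤ d → d + 1ℤ + 1ℤ ℤ.≤ x → d + + cnt mu d ≡ + c → d + 1ℤ + + cnt mu (d + 1ℤ) ≡ + c′ →
      Adj (cnt mu d , c) (cnt mu (d + 1ℤ) , c′)
    next d c c′ p q e e′ = go (bead mu (d + 1ℤ)) (cnt-step Q d)
      where
      go : ∀ b → cnt mu d ≡ cnt mu (d + 1ℤ) ℕ.+ ⟦ b ⟧ → Adj (cnt mu d , c) (cnt mu (d + 1ℤ) , c′)
      go false s with cnt mu d | trans s (ℕₚ.+-identityʳ _)
      ... | _ | refl with ℤₚ.+-injective {c′} {suc c} (trans (sym e′) (trans (f d (+ cnt mu (d + 1ℤ))) (cong (_+_ 1ℤ) e)))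
        where f : ∀ d m → d + 1ℤ + m ≡ 1ℤ + (d + m)
              f = solve-∀
      ... | refl = right
      go true s with cnt mu d | trans s (ℕₚ.+-comm _ 1)
      ... | _ | refl with ℤₚ.+-injective {c′} {c} (trans (sym e′) (trans (suc-shift d (+ cnt mu (d + 1ℤ))) e))
      ... | refl = up

    walk : ∀ k d c c′ → y ℤ.≤ d → d + + k + 1ℤ ℤ.≤ x → d + + cnt mu d ≡ + c → d + + k + + cnt mu (d + + k) ≡ + c′ →
      Conn (Skew la mu) (cnt mu d , c) (cnt mu (d + + k) , c′)
    walk zero d c c′ p q e e′ = finish (d + 0ℤ) (ℤₚ.+-identityʳ d) e′
      where
      finish : ∀ d′ → d′ ≡ d → d′ + + cnt mu d′ ≡ + c′ → Conn (Skew la mu) (cnt mu d , c) (cnt mu d′ , c′)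
      finish _ refl e″ with ℤₚ.+-injective {c} {c′} (trans (sym e) e″)
      ... | refl = here (unskew c p (subst (λ z → z + 1ℤ ℤ.≤ x) (ℤₚ.+-identityʳ d) q) e)
    walk (suc k) d c c′ p q e e′ with cell-at mu (d + 1ℤ)
    ... | c″ , e″ = there (unskew c p (ℤₚ.≤-trans (x≤x+1 (d + 1ℤ)) q″) e) (next d c c″ p q″ e e″)
            (finish (d + + suc k) (suc-shift d (+ k)) e′)
      where
      f : ∀ d k → d + (1ℤ + k) + 1ℤ ≡ d + 1ℤ + 1ℤ + k
      f = solve-∀
      q″ : d + 1ℤ + 1ℤ ℤ.≤ x
      q″ = ℤₚ.≤-trans (≤-by _ (0≤+ k) (f d (+ k))) q
      finish : ∀ d′ → d + 1ℤ + + k ≡ d′ → d′ + + cnt mu d′ ≡ + c′ → Conn (Skew la mu) (cnt mu (d + 1ℤ) , c″) (cnt mu d′ , c′)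
      finish _ refl e‴ = walk k (d + 1ℤ) c″ c′ (ℤₚ.≤-trans p (x≤x+1 d))
        (subst (λ z → z + 1ℤ ℤ.≤ x) (sym (suc-shift d (+ k))) q) e″ e‴

    ordered : ∀ r c r′ c′ → Skew la mu (r , c) → Skew la mu (r′ , c′) → ct (r , c) ℤ.≤ ct (r′ , c′) → Conn (Skew la mu) (r , c) (r′ , c′)
    ordered r c r′ c′ S S′ le with ≤⇒∃ le
    ... | k , e with skew r c S | skew r′ c′ S′
    ... | p , q , s | p′ , q′ , s′ =
      subst (λ z → Conn (Skew la mu) (z , c) (r′ , c′)) (sym s)
       (subst (λ z → Conn (Skew la mu) (cnt mu (ct (r , c)) , c) (z , c′)) (trans (cong (cnt mu) (sym e)) (sym s′))
         (walk k (ct (r , c)) c c′ p (subst (λ z → z + 1ℤ ℤ.≤ x) e q′)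
           (trans (cong (λ z → ct (r , c) + + z) (sym s)) (ct-eq r c))
           (trans (cong₂ (λ u v → u + + v) (sym e) (trans (cong (cnt mu) (sym e)) (sym s′))) (ct-eq r′ c′))))

  -- The counts differ by exactly 1 on the diagonals y ≤ d < x, so each of these loses one cell. A
  -- single cell per diagonal gives the rim condition, and `walk` through neighbouring diagonals
  -- gives connectedness.
  Mv⇒rim-hook : RimHookRemoval la mu
  Mv⇒rim-hook = record
    { partλ = fromPtn P
    ; partμ = fromPtn Q
    ; sub = λ { (r , c) i → cnt⇒InDiag P r c (ct (r , c)) (ct-eq r c) (ℕₚ.≤-trans (InDiag⇒cnt Q r c (ct (r , c)) (ct-eq r c) i) (cnt-mono _)) }
    ; rim = λ { (r , c) S → proj₁ S , λ i → ℕₚ.<-irrefl (cong suc (proj₂ (proj₂ (skew r c S))))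
                  (subst (suc r <_) (inside (proj₁ (skew r c S)) (proj₁ (proj₂ (skew r c S))))
                     (InDiag⇒cnt P (suc r) (suc c) (ct (r , c)) (e (+ r) (+ c)) i)) }
    ; nonempty = (cnt mu y , proj₁ (cell-at mu y)) , unskew _ ℤₚ.≤-refl y<x (proj₂ (cell-at mu y))
    ; connected = conn
    }
    where
    e : ∀ r c → c - r + (1ℤ + r) ≡ 1ℤ + c
    e = solve-∀
    conn : ∀ a b → Skew la mu a → Skew la mu b → Conn (Skew la mu) a b
    conn (r , c) (r′ , c′) S S′ with ℤₚ.≤-total (ct (r , c)) (ct (r′ , c′))
    ... | inj₁ le = ordered r c r′ c′ S S′ le
    ... | inj₂ ge = Conn-sym (ordered r′ c′ r c S′ S ge)

-- Configurations up to moves within residue classes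

record Cong (d x y : ℤ) : Set where
  constructor cgr
  field
    quot : ℤ
    eqn  : x ≡ y + quot * d

Cong-refl : ∀ {d x} → Cong d x x
Cong-refl {d} {x} = cgr 0ℤ (e d x)
  where e : ∀ d x → x ≡ x + 0ℤ * d
        e = solve-∀

Cong-sym : ∀ {d x y} → Cong d x y → Cong d y x
Cong-sym {d} {_} {y} (cgr k refl) = cgr (- k) (e d y k)
  where e : ∀ d y k → y ≡ y + k * d + - k * d
        e = solve-∀

Cong-trans : ∀ {d x y z} → Cong d x y → Cong d y z → Cong d x z
Cong-trans {d} {_} {_} {z} (cgr k refl) (cgr l refl) = cgr (l + k) (e d z k l)
  where e : ∀ d z k l → z + l * d + k * d ≡ z + (l + k) * d
        e = solve-∀

Cong? : ∀ d x y → Dec (Cong d x y)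
Cong? d x y with d ∣? (x - y)
... | yes (dividesᶻ q eq) = yes (cgr q (trans (e x y) (cong (_+_ y) eq)))
  where e : ∀ x y → x ≡ y + (x - y)
        e = solve-∀
... | no ¬p = no λ { (cgr k refl) → ¬p (dividesᶻ k (e y (k * d))) }
  where e : ∀ y z → y + z - y ≡ z
        e = solve-∀

-- Having the same d-core, phrased without hooks. Since moves may go up or down by any multiple of
-- d, the relation is symmetric and is easily carried through conjugation and column exchanges.
data Eqv (d : ℤ) : List ℕ → List ℕ → Set where
  stop : ∀ {la} → Eqv d la la
  go   : ∀ {la mu nu x y} → Ptn mu → Cong d x y → Mv x y (bead la) (bead mu) → Eqv d mu nu → Eqv d la nu

Eqv-one : ∀ {d la mu x y} → Ptn mu → Cong d x y → Mv x y (bead la) (bead mu) → Eqv d la mu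
Eqv-one P c m = go P c m stop

Eqv-trans : ∀ {d la mu nu} → Eqv d la mu → Eqv d mu nu → Eqv d la nu
Eqv-trans stop w = w
Eqv-trans (go P c m v) w = go P c m (Eqv-trans v w)

Eqv-sym : ∀ {d la mu} → Ptn la → Eqv d la mu → Eqv d mu la
Eqv-sym P stop = stop
Eqv-sym P (go Q c m w) = Eqv-trans (Eqv-sym Q w) (Eqv-one P (Cong-sym c) (Mv-sym m))

Eqv-size : ∀ {d la mu} → Ptn la → Eqv d la mu → Cong d (+ size la) (+ size mu)
Eqv-size P stop = Cong-refl
Eqv-size {d} {la} P (go {mu = mu} {y = y} Q (cgr k refl) m w) = Cong-trans (cgr k eq) (Eqv-size Q w)
  where
  e : ∀ m y z → m + (y + z) ≡ m + z + y
  e = solve-∀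
  eq : + size la ≡ + size mu + k * d
  eq = +-cancelʳ-≡ y (+ size la) (+ size mu + k * d) (trans (Mv-size P Q m) (e (+ size mu) y (k * d)))

-- Bead counts along residue classes

sumTo : (ℕ → ℕ) → ℕ → ℕ
sumTo f zero    = 0
sumTo f (suc n) = sumTo f n ℕ.+ f n

sumTo-cong : ∀ {f g} → f ≗ g → ∀ n → sumTo f n ≡ sumTo g n
sumTo-cong e zero = refl
sumTo-cong e (suc n) = cong₂ ℕ._+_ (sumTo-cong e n) (e n)

sumTo-mono : ∀ {f g} → (∀ k → f k ≤ g k) → ∀ n → sumTo f n ≤ sumTo g n
sumTo-mono e zero = z≤n
sumTo-mono e (suc n) = ℕₚ.+-mono-≤ (sumTo-mono e n) (e n)

sumTo-+ : ∀ f g n → sumTo (λ k → f k ℕ.+ g k) n ≡ sumTo f n ℕ.+ sumTo g n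
sumTo-+ f g zero = refl
sumTo-+ f g (suc n) = trans (cong (ℕ._+ (f n ℕ.+ g n)) (sumTo-+ f g n)) (swap-middle (sumTo f n) (sumTo g n) (f n) (g n))

sumTo-zero : ∀ f n → (∀ k → k < n → f k ≡ 0) → sumTo f n ≡ 0
sumTo-zero f zero z = refl
sumTo-zero f (suc n) z = cong₂ ℕ._+_ (sumTo-zero f n (λ k k<n → z k (ℕₚ.m≤n⇒m≤1+n k<n))) (z n ℕₚ.≤-refl)

sumTo-single : ∀ f n j → j < n → f j ≡ 1 → (∀ k → k ≢ j → f k ≡ 0) → sumTo f n ≡ 1
sumTo-single f (suc n) j (s≤s j≤n) one z with ℕₚ.m≤n⇒m<n∨m≡n j≤n
... | inj₁ j<n = cong₂ ℕ._+_ (sumTo-single f n j j<n one z) (z n λ e → ℕₚ.<⇒≢ j<n (sym e))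
... | inj₂ refl = cong₂ ℕ._+_ (sumTo-zero f n (λ k k<n → z k (ℕₚ.<⇒≢ k<n))) one

sumTo-≤-< : ∀ {f g} n j → j < n → (∀ k → k < n → g k ≤ f k) → g j < f j → sumTo g n < sumTo f n
sumTo-≤-< (suc n) j (s≤s j≤n) le strict with ℕₚ.m≤n⇒m<n∨m≡n j≤n
... | inj₁ j<n = ℕₚ.+-mono-<-≤ (sumTo-≤-< n j j<n (λ k k<n → le k (ℕₚ.m≤n⇒m≤1+n k<n)) strict) (le n ℕₚ.≤-refl)
... | inj₂ refl = ℕₚ.+-mono-≤-< (below n λ k k<n → le k (ℕₚ.m≤n⇒m≤1+n k<n)) strict
  where
  below : ∀ {f g} n → (∀ k → k < n → g k ≤ f k) → sumTo g n ≤ sumTo f n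
  below zero _ = z≤n
  below (suc n) le = ℕₚ.+-mono-≤ (below n (λ k k<n → le k (ℕₚ.m≤n⇒m≤1+n k<n))) (le n ℕₚ.≤-refl)

sumTo-compensate : ∀ {f g} n j → j < n → sumTo f n ≤ sumTo g n → g j < f j → Σ ℕ λ k → f k < g k
sumTo-compensate {f} {g} n j j<n le strict with ℕₚ.anyUpTo? (λ k → f k ℕ.<? g k) n
... | yes (k , _ , p) = k , p
... | no none = ⊥-elim (ℕₚ.<⇒≱ (sumTo-≤-< n j j<n (λ k k<n → ℕₚ.≮⇒≥ λ p → none (k , k<n , p)) strict) le)

window : (ℤ → ℕ) → ℕ → ℕ
window f M = sumTo (λ k → f (+ k - + M)) (M ℕ.+ M)

window-compensate : ∀ {f g} M → 1 ≤ M → window f M ≤ window g M → g 0ℤ < f 0ℤ → Σ ℤ λ i → f i < g i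
window-compensate {f} {g} M 1≤M le strict
  -- The index 0 is the term k = M of the sum, which is present because 1 ≤ M.
  with sumTo-compensate (M ℕ.+ M) M (ℕₚ.+-mono-≤ 1≤M ℕₚ.≤-refl) le
         (subst (λ z → g z < f z) (sym (ℤₚ.+-inverseʳ (+ M))) strict)
... | k , p = + k - + M , p

along : (ℤ → Bool) → ℤ → ℤ → ℤ → ℕ
along b x₀ d i = ⟦ b (x₀ + i * d) ⟧

-- Every residue class contains infinitely many beads, so equality of bead numbers means equality in
-- all windows -M ≤ i < M with M large enough for the class.
Balanced : ℤ → (ℤ → Bool) → (ℤ → Bool) → Set
Balanced d a b = ∀ x₀ → Σ ℕ λ M₀ → ∀ M → M₀ ≤ M → window (along a x₀ d) M ≡ window (along b x₀ d) M

window-single : ∀ d x₀ i .{{_ : ℤ.NonZero d}} M → suc ℤ.∣ i ∣ ≤ M → window (along (λ z → is z (x₀ + i * d)) x₀ d) M ≡ 1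
window-single d x₀ i M i<M with ≤⇒∃ { - (+ M)} {i} (ℤₚ.≤-trans (ℤₚ.neg-mono-≤ (ℤ.+≤+ (ℕₚ.≤-trans (ℕₚ.n≤1+n _) i<M))) (-∣i∣≤i i))
... | j , refl = sumTo-single _ (M ℕ.+ M) j j<2M
    (cong ⟦_⟧ (trans (cong (λ w → is (x₀ + w * d) (x₀ + (- (+ M) + + j) * d)) (ℤₚ.+-comm (+ j) (- (+ M)))) (is-refl (x₀ + (- (+ M) + + j) * d))))
    λ k k≢j → cong ⟦_⟧ (is-≢ λ eq → k≢j (ℤₚ.+-injective (+-cancelʳ-≡ (- (+ M)) (+ k) (+ j)
      (trans (ℤₚ.*-cancelʳ-≡ (+ k - + M) (- (+ M) + + j) d (+-cancelˡ-≡ x₀ _ _ eq)) (ℤₚ.+-comm (- (+ M)) (+ j))))))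
  where
  e : ∀ M j i → M + M ≡ 1ℤ + j + (M - (1ℤ + i) + (i - (- M + j)))
  e = solve-∀
  j<2M : j < M ℕ.+ M
  j<2M = ℤₚ.drop‿+≤+ (≤-by _ (gap (ℤ.+≤+ i<M) ⊕ gap (i≤∣i∣ (- (+ M) + + j))) (e (+ M) (+ j) (+ ℤ.∣ - (+ M) + + j ∣)))

window-none : ∀ d x₀ x M → ¬ Cong d x x₀ → window (along (λ z → is z x) x₀ d) M ≡ 0
window-none d x₀ x M ¬c = sumTo-zero _ (M ℕ.+ M) λ k _ → cong ⟦_⟧ (is-≢ λ eq → ¬c (cgr (+ k - + M) (sym eq)))

-- A class contains both `x` and `y` or neither. In the first case both lie in the window once M
-- exceeds the absolute values of their indices, and the move leaves the number of beads in it
-- unchanged.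
Mv-balanced : ∀ {d x y a b} .{{_ : ℤ.NonZero d}} → Cong d x y → Mv x y a b → Balanced d a b
Mv-balanced {d} {x} {y} {a} {b} c m x₀ = proj₁ positions , λ M M₀≤M →
  ℕₚ.+-cancelʳ-≡ (window (δ y) M) _ _ (begin
    window (along a x₀ d) M ℕ.+ window (δ y) M ≡⟨ sumTo-+ (at M (along a x₀ d)) (at M (δ y)) (M ℕ.+ M) ⟨
    window (λ i → along a x₀ d i ℕ.+ δ y i) M  ≡⟨ sumTo-cong (λ k → Mv-pointwise m (x₀ + (+ k - + M) * d)) (M ℕ.+ M) ⟩
    window (λ i → along b x₀ d i ℕ.+ δ x i) M  ≡⟨ sumTo-+ (at M (along b x₀ d)) (at M (δ x)) (M ℕ.+ M) ⟩
    window (along b x₀ d) M ℕ.+ window (δ x) M ≡⟨ cong (window (along b x₀ d) M ℕ.+_) (proj₂ positions M M₀≤M) ⟩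
    window (along b x₀ d) M ℕ.+ window (δ y) M ∎)
  where
  open ≡-Reasoning
  at : ℕ → (ℤ → ℕ) → ℕ → ℕ
  at M f k = f (+ k - + M)
  δ : ℤ → ℤ → ℕ
  δ z = along (λ w → is w z) x₀ d
  positions : Σ ℕ λ M₀ → ∀ M → M₀ ≤ M → window (δ x) M ≡ window (δ y) M
  positions with Cong? d x x₀
  ... | no ¬c = 0 , λ M _ → trans (window-none d x₀ x M ¬c) (sym (window-none d x₀ y M λ c′ → ¬c (Cong-trans c c′)))
  ... | yes (cgr i refl) with Cong-trans {z = x₀} (Cong-sym c) (cgr i refl)
  ...   | cgr j refl = suc ℤ.∣ i ∣ ℕ.+ suc ℤ.∣ j ∣ , λ M M₀≤M →
            trans (window-single d x₀ i M (ℕₚ.≤-trans (ℕₚ.m≤m+n _ _) M₀≤M))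
                  (sym (window-single d x₀ j M (ℕₚ.≤-trans (ℕₚ.m≤n+m _ (suc ℤ.∣ i ∣)) M₀≤M)))

Eqv-balanced : ∀ {d la mu} .{{_ : ℤ.NonZero d}} → Eqv d la mu → Balanced d (bead la) (bead mu)
Eqv-balanced stop x₀ = 0 , λ _ _ → refl
Eqv-balanced (go _ c m w) x₀ with Mv-balanced c m x₀ | Eqv-balanced w x₀
... | M₁ , e₁ | M₂ , e₂ = M₁ ℕ.+ M₂ , λ M le → trans (e₁ M (ℕₚ.≤-trans (ℕₚ.m≤m+n M₁ M₂) le)) (e₂ M (ℕₚ.≤-trans (ℕₚ.m≤n+m M₂ M₁) le))

⟦⟧-< : ∀ {u v} → ⟦ u ⟧ < ⟦ v ⟧ → u ≡ false × v ≡ true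
⟦⟧-< {false} {true}  _ = refl , refl
⟦⟧-< {true}  {true}  (s≤s ())
⟦⟧-< {true}  {false} ()
⟦⟧-< {false} {false} ()

⟦⟧-<′ : ∀ {u v} → u ≡ false → v ≡ true → ⟦ u ⟧ < ⟦ v ⟧
⟦⟧-<′ refl refl = s≤s z≤n

⟦⟧-≤ : ∀ {u v} → (u ≡ true → v ≡ true) → ⟦ u ⟧ ≤ ⟦ v ⟧
⟦⟧-≤ {false} f = z≤n
⟦⟧-≤ {true}  f = ℕₚ.≤-reflexive (cong ⟦_⟧ (sym (f refl)))

-- Closed bead sets

Closed : ℤ → (ℤ → Bool) → Set
Closed d b = ∀ x → b x ≡ true → b (x - d) ≡ true

Closed-multiple : ∀ {d b} → Closed d b → ∀ k x → b x ≡ true → b (x - + k * d) ≡ true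
Closed-multiple {d} {b} C zero x p = trans (cong b (e d x)) p
  where e : ∀ d x → x - 0ℤ * d ≡ x
        e = solve-∀
Closed-multiple {d} {b} C (suc k) x p = trans (cong b (e d x (+ k))) (C _ (Closed-multiple C k x p))
  where e : ∀ d x k → x - (1ℤ + k) * d ≡ x - k * d - d
        e = solve-∀

-- If `b` lacked x, the equal window counts would force a position of the class with a bead of `b`
-- but none of `a`. Above x this contradicts closedness of `b`, which would bring a bead to x; below
-- x it contradicts closedness of `a`.
closed-agree : ∀ {d a b} → Balanced d a b → Closed d a → Closed d b → ∀ x → a x ≡ true → b x ≡ true
closed-agree {d} {a} {b} bal A B x ax with b x in bx
... | true = refl
... | false with bal x
...   | M₀ , e with window-compensate {along a x d} {along b x d} (suc M₀) (s≤s z≤n) (ℕₚ.≤-reflexive (e (suc M₀) (ℕₚ.n≤1+n M₀)))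
                      (⟦⟧-<′ (trans (cong b (eq d x)) bx) (trans (cong a (eq d x)) ax))
  where eq : ∀ d x → x + 0ℤ * d ≡ x
        eq = solve-∀
...     | i , lt with ⟦⟧-< lt
...       | af , bt = ⊥-elim (clash i af bt)
  where
  clash : ∀ i → a (x + i * d) ≡ false → b (x + i * d) ≡ true → ⊥
  clash (+ k) af bt = bool-clash (trans (cong b (eq d x (+ k))) (Closed-multiple B k _ bt)) bx
    where eq : ∀ d x k → x ≡ x + k * d - k * d
          eq = solve-∀
  clash -[1+ k ] af bt = bool-clash (trans (cong a (eq d x (+ suc k))) (Closed-multiple A (suc k) x ax)) af
    where eq : ∀ d x k → x + - k * d ≡ x - k * d
          eq = solve-∀

bool-ext : ∀ {u v} → (u ≡ true → v ≡ true) → (v ≡ true → u ≡ true) → u ≡ v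
bool-ext {true}  {true}  _ _ = refl
bool-ext {false} {false} _ _ = refl
bool-ext {true}  {false} f _ = sym (f refl)
bool-ext {false} {true}  _ g = g refl

closed-unique : ∀ {d la mu} .{{_ : ℤ.NonZero d}} → Ptn la → Ptn mu → Closed d (bead la) → Closed d (bead mu) → Eqv d la mu → la ≡ mu
closed-unique P Q A B w = bead-injective P Q λ x →
  bool-ext (closed-agree (Eqv-balanced w) A B x) (closed-agree (Eqv-balanced (Eqv-sym P w)) B A x)

-- If ρ is closed under -δ then no column of ρ outnumbers its translate by δ;
-- t-equivalent configurations inherit this comparison of column counts.
complementary-bead : ∀ {t δ ρ la x} .{{_ : ℤ.NonZero t}} → Eqv t la ρ → Closed δ (bead ρ) →
  bead la x ≡ true → bead la (x - δ) ≡ false →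
  Σ ℤ λ y → Cong t y x × bead la y ≡ false × bead la (y - δ) ≡ true
complementary-bead {t} {δ} {ρ} {la} {x} w C bx bδ with Eqv-balanced w x | Eqv-balanced w (x - δ)
... | M₁ , e₁ | M₂ , e₂ with window-compensate {along (bead la) x t} {along (bead la) (x - δ) t} M (s≤s z≤n) le
      (⟦⟧-<′ (trans (cong (bead la) (e t (x - δ))) bδ) (trans (cong (bead la) (e t x)) bx))
  where
  e : ∀ d x → x + 0ℤ * d ≡ x
  e = solve-∀
  shift : ∀ x δ z → x + z - δ ≡ x - δ + z
  shift = solve-∀
  M = suc (M₁ ℕ.+ M₂)
  le : window (along (bead la) x t) M ≤ window (along (bead la) (x - δ) t) M
  le = begin
    window (along (bead la) x t) M       ≡⟨ e₁ M (ℕₚ.m≤n⇒m≤1+n (ℕₚ.m≤m+n M₁ M₂)) ⟩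
    window (along (bead ρ) x t) M        ≤⟨ sumTo-mono (λ k → ⟦⟧-≤ λ p → trans (cong (bead ρ) (sym (shift x δ ((+ k - + M) * t)))) (C _ p)) (M ℕ.+ M) ⟩
    window (along (bead ρ) (x - δ) t) M  ≡⟨ e₂ M (ℕₚ.m≤n⇒m≤1+n (ℕₚ.m≤n+m M₂ M₁)) ⟨
    window (along (bead la) (x - δ) t) M ∎
    where open ℕₚ.≤-Reasoning
... | i , lt with ⟦⟧-< lt
...   | f , g = x + i * t , cgr i refl , f , trans (cong (bead la) (shift x δ (i * t))) g
  where shift : ∀ x δ z → x + z - δ ≡ x - δ + z
        shift = solve-∀

-- Cores are the closed bead sets

hook⇒Mv : ∀ {s la mu} → RimSHook s la mu → Σ ℤ λ y → Mv (y + + s) y (bead la) (bead mu)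
hook⇒Mv {s} {la} {mu} (R , sz) with rim-hook⇒Mv R
... | x , y , _ , m = y , subst (λ z → Mv z y (bead la) (bead mu))
  (+-cancelˡ-≡ (+ size mu) x (y + + s) (trans (sym (Mv-size {la} {mu} (toPtn {la} (RimHookRemoval.partλ R)) (toPtn {mu} (RimHookRemoval.partμ R)) m))
    (trans (cong (λ k → + k + y) sz) (e (+ size mu) (+ s) y)))) m
  where e : ∀ a s y → a + s + y ≡ a + (y + s)
        e = solve-∀

Mv⇒hook : ∀ {s la mu y} → 0 < s → Ptn la → Ptn mu → Mv (y + + s) y (bead la) (bead mu) → RimSHook s la mu
Mv⇒hook {s} {la} {mu} {y} 0<s P Q m = Mv⇒rim-hook P Q (ℤₚ.+-monoʳ-≤ y (ℤ.+≤+ 0<s)) m ,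
  ℤₚ.+-injective (+-cancelʳ-≡ y (+ size la) (+ size mu + + s) (trans (Mv-size P Q m) (e (+ size mu) (+ s) y)))
  where e : ∀ a s y → a + (y + s) ≡ a + s + y
        e = solve-∀

x-s+s : ∀ x s → x - s + s ≡ x
x-s+s = solve-∀

removal : ∀ {s la x} → 0 < s → Ptn la → bead la x ≡ true → bead la (x - + s) ≡ false → Σ (List ℕ) (RimSHook s la)
removal {s} {la} {x} 0<s P bt bf with move P bt bf
... | mu , Q , _ , m = mu , Mv⇒hook {y = x - + s} 0<s P Q (subst (λ z → Mv z (x - + s) (bead la) (bead mu)) (sym (x-s+s x (+ s))) m)

core⇒closed : ∀ {s la} → 0 < s → IsCore s la → Closed (+ s) (bead la)
core⇒closed {s} {la} 0<s (part , none) x bt with bead la (x - + s) in bf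
... | true = refl
... | false = ⊥-elim (none _ (proj₂ (removal {x = x} 0<s (toPtn {la} part) bt bf)))

closed⇒core : ∀ {s la} → Ptn la → Closed (+ s) (bead la) → IsCore s la
closed⇒core {s} {la} P C = fromPtn P , λ mu H → bad {mu} (hook⇒Mv H)
  where
  e : ∀ y s → y + s - s ≡ y
  e = solve-∀
  bad : ∀ {mu} → Σ ℤ (λ y → Mv (y + + s) y (bead la) (bead mu)) → ⊥
  bad (y , m) = bool-clash (trans (cong (bead la) (sym (e y (+ s)))) (C _ (Mv.ax m))) (Mv.ay m)

Reach-size : ∀ {s w la ka} → Reach s w la ka → size la ≡ size ka ℕ.+ w ℕ.* s
Reach-size done = sym (ℕₚ.+-identityʳ _)
Reach-size {s} {suc w} {ka = ka} (step (_ , sz) r) = trans sz (trans (cong (ℕ._+ s) (Reach-size r))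
  (trans (ℕₚ.+-assoc (size ka) (w ℕ.* s) s) (cong (size ka ℕ.+_) (ℕₚ.+-comm (w ℕ.* s) s))))

Reach⇒Eqv : ∀ {s w la ka} → Reach s w la ka → Eqv (+ s) la ka
Reach⇒Eqv done = stop
Reach⇒Eqv {s} (step {mu = mu} H r) with hook⇒Mv H
... | y , m = go (toPtn {mu} (RimHookRemoval.partμ (proj₁ H))) (cgr 1ℤ (e y (+ s))) m (Reach⇒Eqv r)
  where e : ∀ y s → y + s ≡ y + 1ℤ * s
        e = solve-∀

-- A finite search suffices: there are no beads above `hd la`, and every position from `- length la`
-- downwards is occupied.
closed-or-not : ∀ {la} s → Ptn la → Closed (+ s) (bead la) ⊎ Σ ℤ λ x → bead la x ≡ true × bead la (x - + s) ≡ false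
closed-or-not {la} s P with ℕₚ.anyUpTo? (λ k → (bead la (+ hd la - + k) ≟ᵇ true) ×-dec (bead la (+ hd la - + k - + s) ≟ᵇ false)) (hd la ℕ.+ length la)
... | yes (k , _ , bt , bf) = inj₂ (+ hd la - + k , bt , bf)
... | no none = inj₁ closed
  where
  closed : Closed (+ s) (bead la)
  closed x bt with ≤⇒∃ (bead-≤hd P bt)
  ... | k , e with bead la (x - + s) in bf
  ...   | true = refl
  ...   | false with k ℕ.<? hd la ℕ.+ length la
  ...     | yes k< = ⊥-elim (none (k , k< , trans (cong (bead la) x≡) bt , trans (cong (λ z → bead la (z - + s)) x≡) bf))
    where e′ : ∀ x k → x + k - k ≡ x
          e′ = solve-∀
          x≡ : + hd la - + k ≡ x
          x≡ = trans (cong (_- + k) e) (e′ x (+ k))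
  ...     | no k≮ = ⊥-elim (bool-clash (bead-low la (≤-by _ (gap (ℤ.+≤+ (ℕₚ.≮⇒≥ k≮)) ⊕ 0≤+ s)
                (trans (e′ x (+ k) (+ s) (+ length la)) (cong (λ h → x - + s + (+ k - (h + + length la) + + s)) (sym e))))) bf)
    where e′ : ∀ x k s l → - l ≡ x - s + (k - (x + k + l) + s)
          e′ = solve-∀

abstract
  core-exists : ∀ {s la} → 0 < s → Ptn la → Σ (List ℕ) λ ka → HasCore s la ka
  core-exists {s} {la} 0<s P = search la P (<-wellFounded (size la))
    where
    search : ∀ la → Ptn la → Acc _<_ (size la) → Σ (List ℕ) λ ka → HasCore s la ka
    search la P (acc rec) with closed-or-not s P
    ... | inj₁ C = la , 0 , done , closed⇒core P C
    ... | inj₂ (x , bt , bf) with removal {x = x} 0<s P bt bf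
    ...   | mu , H with search mu (toPtn {mu} (RimHookRemoval.partμ (proj₁ H)))
                        (rec (ℕₚ.≤-trans (ℕₚ.m<m+n (size mu) 0<s) (ℕₚ.≤-reflexive (sym (proj₂ H)))))
    ...     | ka , w , r , c = ka , suc w , step H r , c

core-unique : ∀ {s la mu} → 0 < s → IsCore s la → IsCore s mu → Eqv (+ s) la mu → la ≡ mu
core-unique {s} {la} {mu} 0<s C D w = closed-unique {{ℕ.>-nonZero 0<s}} (toPtn {la} (proj₁ C)) (toPtn {mu} (proj₁ D)) (core⇒closed 0<s C) (core⇒closed 0<s D) w

HasCore⇒Eqv : ∀ {s la ka} → HasCore s la ka → Eqv (+ s) la ka
HasCore⇒Eqv (_ , r , _) = Reach⇒Eqv r

-- Removing hooks in some order reaches some core; it is equivalent to `ka`, and `core-unique`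
-- identifies the two.
Eqv⇒HasCore : ∀ {s la ka} → 0 < s → Ptn la → IsCore s ka → Eqv (+ s) la ka → HasCore s la ka
Eqv⇒HasCore {s} {la} {ka} 0<s P C w with core-exists 0<s P
... | ka′ , H with core-unique 0<s (proj₂ (proj₂ H)) C (Eqv-trans (Eqv-sym P (HasCore⇒Eqv H)) w)
... | refl = H

HasCore-unique : ∀ {s la ka ka′} → 0 < s → Ptn la → HasCore s la ka → HasCore s la ka′ → ka ≡ ka′
HasCore-unique 0<s P H K = core-unique 0<s (proj₂ (proj₂ H)) (proj₂ (proj₂ K)) (Eqv-trans (Eqv-sym P (HasCore⇒Eqv H)) (HasCore⇒Eqv K))

-- Conjugation

column : List ℕ → ℕ → ℕ
column la j = length (filter (j ℕ.<?_) la)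

column⇒part : ∀ {la} → Ptn la → ∀ c r → c < column la r → r < part la c
part⇒column : ∀ {la} → Ptn la → ∀ c r → r < part la c → c < column la r
column⇒part {p ∷ ps} (cons 0<p h P) c r c< with r ℕ.<? p
column⇒part {p ∷ ps} (cons 0<p h P) zero r c< | yes r<p = r<p
column⇒part {p ∷ ps} (cons 0<p h P) (suc c) r c< | yes r<p =
  column⇒part P c r (ℕ.s≤s⁻¹ (subst (suc c <_) (cong length (filter-accept (r ℕ.<?_) r<p)) c<))
... | no r≮p = ⊥-elim (r≮p (ℕₚ.≤-trans (column⇒part P c r (subst (c <_) (cong length (filter-reject (r ℕ.<?_) r≮p)) c<))
                     (ℕₚ.≤-trans (part-≤hd P c) h)))
part⇒column {p ∷ ps} (cons 0<p h P) c r r< = subst (c <_) (cong length (sym (filter-accept (r ℕ.<?_)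
    (ℕₚ.≤-trans r< (part-≤hd (cons 0<p h P) c))))) (inner c r<)
  where
  inner : ∀ c → r < part (p ∷ ps) c → c < suc (column ps r)
  inner zero _ = s≤s z≤n
  inner (suc c) r< = s≤s (part⇒column P c r r<)

part-applyUpTo : ∀ (f : ℕ → ℕ) g n j → j < n → part (map f (applyUpTo g n)) j ≡ f (g j)
part-applyUpTo f g (suc n) zero _ = refl
part-applyUpTo f g (suc n) (suc j) (s≤s j<n) = part-applyUpTo f (λ k → g (suc k)) n j j<n

part-applyUpTo-beyond : ∀ (f : ℕ → ℕ) g n j → n ≤ j → part (map f (applyUpTo g n)) j ≡ 0
part-applyUpTo-beyond f g zero j _ = refl
part-applyUpTo-beyond f g (suc n) (suc j) (s≤s n≤j) = part-applyUpTo-beyond f (λ k → g (suc k)) n j n≤j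

part-conj : ∀ {la} → Ptn la → ∀ j → part (conj la) j ≡ column la j
part-conj {la} P j with j ℕ.<? hd la
... | yes j< = part-applyUpTo (column la) (λ k → k) (hd la) j j<
... | no j≮ = trans (part-applyUpTo-beyond (column la) (λ k → k) (hd la) j (ℕₚ.≮⇒≥ j≮))
                (sym (ℕₚ.n≤0⇒n≡0 (ℕₚ.≮⇒≥ λ 0< → j≮ (ℕₚ.≤-trans (column⇒part P 0 j 0<) (part-≤hd P 0)))))

InDiag-conj : ∀ {la} → Ptn la → ∀ r c → InDiag la (c , r) → InDiag (conj la) (r , c)
InDiag-conj P r c i = subst (c <_) (sym (part-conj P r)) (part⇒column P c r i)

conj-InDiag : ∀ {la} → Ptn la → ∀ r c → InDiag (conj la) (r , c) → InDiag la (c , r)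
conj-InDiag P r c i = column⇒part P c r (subst (c <_) (part-conj P r) i)

conj-Ptn : ∀ {la} → Ptn la → Ptn (conj la)
conj-Ptn {la} P = toPtn {conj la} ((λ i → ℕₚ.≮⇒≥ λ lt → ℕₚ.<-irrefl refl (InDiag-conj P i (part (conj la) i)
      (ℕₚ.<-trans (ℕₚ.n<1+n i) (conj-InDiag P (suc i) (part (conj la) i) lt))))
  , λ i i< → InDiag-conj P i 0 (subst (i <_) (sym (part₀ la)) (subst (i <_) (trans (length-map (column la) (upTo (hd la))) (length-upTo (hd la))) i<)))

-- Both sides are the column of the first cell of diagonal d outside `la`: transposition takes that
-- cell to the first missing cell of diagonal -d of the conjugate.
cnt-conj : ∀ {la} → Ptn la → ∀ d → + cnt (conj la) (- d) ≡ d + + cnt la d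
cnt-conj {la} P d with cell-at la d | cell-at (conj la) (- d)
... | c , e | b , e′ = trans (cong +_ (ℕₚ.≤-antisym (ℕₚ.≮⇒≥ above) (ℕₚ.≮⇒≥ below))) (sym e)
  where
  f₁ : ∀ d a → - d + (d + a) ≡ a
  f₁ = solve-∀
  f₂ : ∀ d a → d + (- d + a) ≡ a
  f₂ = solve-∀
  f₃ : ∀ d a b → d + a - (1ℤ + (d + b)) ≡ a - (1ℤ + b)
  f₃ = solve-∀
  above : ¬ (c < cnt (conj la) (- d))
  above lt = ℕₚ.<-irrefl refl (InDiag⇒cnt P (cnt la d) c d e (conj-InDiag P c (cnt la d)
    (cnt⇒InDiag (conj-Ptn P) c (cnt la d) (- d) (trans (cong (_+_ (- d)) (sym e)) (f₁ d (+ cnt la d))) lt)))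
  B≡ : d + + b ≡ + cnt (conj la) (- d)
  B≡ = trans (cong (_+_ d) (sym e′)) (f₂ d (+ cnt (conj la) (- d)))
  below : ¬ (cnt (conj la) (- d) < c)
  below lt = ℕₚ.<-irrefl refl (InDiag⇒cnt (conj-Ptn P) (cnt (conj la) (- d)) b (- d) e′
    (InDiag-conj P (cnt (conj la) (- d)) b (cnt⇒InDiag P b (cnt (conj la) (- d)) d B≡
      (ℤₚ.drop‿+≤+ (ℤₚ.0≤i-j⇒j≤i (subst (0ℤ ℤ.≤_) (trans (cong₂ (λ u v → u - (1ℤ + v)) (sym e) (sym B≡)) (f₃ d (+ cnt la d) (+ b)))
        (gap (ℤ.+≤+ lt))))))))

-- Taking the difference of `cnt-conj` at the diagonals -x and 1 - x shows that exactly one of the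
-- two positions carries a bead.
bead-conj : ∀ {la} → Ptn la → ∀ x → bead (conj la) x ≡ not (bead la (1ℤ - x))
bead-conj {la} P x = complement (bead (conj la) x) (bead la (1ℤ - x)) (ℤₚ.+-injective sum)
  where
  complement : ∀ u v → ⟦ u ⟧ ℕ.+ ⟦ v ⟧ ≡ 1 → u ≡ not v
  complement true false _ = refl
  complement false true _ = refl
  complement true true ()
  complement false false ()
  d = - x
  s₁ : cnt la d ≡ cnt la (1ℤ - x) ℕ.+ ⟦ bead la (1ℤ - x) ⟧
  s₁ = subst (λ z → cnt la d ≡ cnt la z ℕ.+ ⟦ bead la z ⟧) (ℤₚ.+-comm d 1ℤ) (cnt-step P d)
  s₂ : cnt (conj la) (- (1ℤ - x)) ≡ cnt (conj la) (- d) ℕ.+ ⟦ bead (conj la) x ⟧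
  s₂ = trans (cnt-step (conj-Ptn P) (- (1ℤ - x)))
         (cong₂ ℕ._+_ (cong (cnt (conj la)) (g₁ x)) (cong (λ z → ⟦ bead (conj la) z ⟧) (g₂ x)))
    where g₁ : ∀ x → - (1ℤ - x) + 1ℤ ≡ - (- x)
          g₁ = solve-∀
          g₂ : ∀ x → - (1ℤ - x) + 1ℤ ≡ x
          g₂ = solve-∀
  sum : + ⟦ bead (conj la) x ⟧ + + ⟦ bead la (1ℤ - x) ⟧ ≡ 1ℤ
  sum = +-cancelˡ-≡ (- x + + cnt la (1ℤ - x)) _ _ (begin
    - x + + cnt la (1ℤ - x) + (+ ⟦ bead (conj la) x ⟧ + + ⟦ bead la (1ℤ - x) ⟧)
      ≡⟨ g₁ (- x) (+ cnt la (1ℤ - x)) (+ ⟦ bead (conj la) x ⟧) (+ ⟦ bead la (1ℤ - x) ⟧) ⟩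
    - x + (+ cnt la (1ℤ - x) + + ⟦ bead la (1ℤ - x) ⟧) + + ⟦ bead (conj la) x ⟧
      ≡⟨ cong (λ k → - x + + k + + ⟦ bead (conj la) x ⟧) s₁ ⟨
    d + + cnt la d + + ⟦ bead (conj la) x ⟧
      ≡⟨ cong (_+ + ⟦ bead (conj la) x ⟧) (cnt-conj P d) ⟨
    + cnt (conj la) (- d) + + ⟦ bead (conj la) x ⟧
      ≡⟨ cong +_ s₂ ⟨
    + cnt (conj la) (- (1ℤ - x))
      ≡⟨ cnt-conj P (1ℤ - x) ⟩
    1ℤ - x + + cnt la (1ℤ - x)
      ≡⟨ g₂ x (+ cnt la (1ℤ - x)) ⟩
    - x + + cnt la (1ℤ - x) + 1ℤ ∎)
    where
    open ≡-Reasoning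
    g₁ : ∀ m c u v → m + c + (u + v) ≡ m + (c + v) + u
    g₁ = solve-∀
    g₂ : ∀ x c → 1ℤ - x + c ≡ - x + c + 1ℤ
    g₂ = solve-∀

1-[1-x] : ∀ x → 1ℤ - (1ℤ - x) ≡ x
1-[1-x] = solve-∀

conj-involutive : ∀ {la} → Ptn la → conj (conj la) ≡ la
conj-involutive {la} P = bead-injective (conj-Ptn (conj-Ptn P)) P λ x →
  trans (bead-conj (conj-Ptn P) x) (trans (cong not (bead-conj P (1ℤ - x)))
    (trans (not-involutive _) (cong (bead la) (1-[1-x] x))))

Mv-conj : ∀ {x y la mu} → Ptn la → Ptn mu → Mv x y (bead la) (bead mu) → Mv (1ℤ - y) (1ℤ - x) (bead (conj la)) (bead (conj mu))
Mv-conj {x} {y} {la} {mu} P Q m = mv (at P y (Mv.ay m)) (at P x (Mv.ax m)) (at Q y (Mv.by m)) (at Q x (Mv.bx m))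
  λ z p q → trans (bead-conj P z) (trans (cong not (Mv.rest m (1ℤ - z) (λ e → q (flip z e)) (λ e → p (flip z e)))) (sym (bead-conj Q z)))
  where
  at : ∀ {nu} → Ptn nu → ∀ w {b} → bead nu w ≡ b → bead (conj nu) (1ℤ - w) ≡ not b
  at {nu} R w e = trans (bead-conj R (1ℤ - w)) (cong not (trans (cong (bead nu) (1-[1-x] w)) e))
  flip : ∀ z {w} → 1ℤ - z ≡ w → z ≡ 1ℤ - w
  flip z refl = sym (1-[1-x] z)

Eqv-conj : ∀ {d la mu} → Ptn la → Eqv d la mu → Eqv d (conj la) (conj mu)
Eqv-conj P stop = stop
Eqv-conj {d} P (go {y = y} Q (cgr k refl) m w) = go (conj-Ptn Q) (cgr k (e y (k * d))) (Mv-conj P Q m) (Eqv-conj Q w)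
  where e : ∀ y z → 1ℤ - y ≡ 1ℤ - (y + z) + z
        e = solve-∀

-- The reflection turns a move from x to y into one from 1 - y to 1 - x with the same displacement,
-- so |conj la| - |la| is constant along the path.
Eqv-conj-size : ∀ {d la mu} → Ptn la → Eqv d la mu → + size (conj la) + + size mu ≡ + size la + + size (conj mu)
Eqv-conj-size {la = la} P stop = ℤₚ.+-comm (+ size (conj la)) (+ size la)
Eqv-conj-size {d} {la} {nu} P (go {mu = mu} {x = x} {y = y} Q _ m w) = combine (+ size la) (+ size (conj la)) (+ size mu) (+ size (conj mu)) (+ size nu) (+ size (conj nu)) x y
    (Mv-size P Q m) (Mv-size (conj-Ptn P) (conj-Ptn Q) (Mv-conj P Q m)) (Eqv-conj-size Q w)
  where
  combine : ∀ a a′ b b′ c c′ x y → a + y ≡ b + x → a′ + (1ℤ - x) ≡ b′ + (1ℤ - y) → b′ + c ≡ b + c′ → a′ + c ≡ a + c′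
  combine a a′ b b′ c c′ x y p q r = +-cancelʳ-≡ (1ℤ - x + (b′ + (b + x))) _ _
    (trans (e₁ a′ b b′ c x) (trans (cong₂ _+_ (cong₂ _+_ q r) (sym p)) (e₂ a b b′ c′ x y)))
    where
    e₁ : ∀ a′ b b′ c x → a′ + c + (1ℤ - x + (b′ + (b + x))) ≡ a′ + (1ℤ - x) + (b′ + c) + (b + x)
    e₁ = solve-∀
    e₂ : ∀ a b b′ c′ x y → b′ + (1ℤ - y) + (b + c′) + (a + y) ≡ a + c′ + (1ℤ - x + (b′ + (b + x)))
    e₂ = solve-∀

corner : ∀ {p ps} → Ptn (p ∷ ps) → Σ ℤ λ x → bead (p ∷ ps) x ≡ true × bead (p ∷ ps) (x - 1ℤ) ≡ false
corner {p} (cons {ps = []} 0<p h P) = + p , bead-here p [] , trans (bead-there [] {+ p - 1ℤ} ne)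
    (nonpos-false (subst (1ℤ ℤ.≤_) (sym (x-s+s (+ p) 1ℤ)) (ℤ.+≤+ 0<p)))
  where ne : + p - 1ℤ ≢ + p
        ne e = x+1+k≢x (+ p - 1ℤ) 0 (trans e (sym (x-s+s (+ p) 1ℤ)))
corner {p} (cons {ps = q ∷ qs} 0<p h P) with corner P
... | x , bt , bf = x - 1ℤ , bead-tail p (q ∷ qs) {x - 1ℤ} (trans (cong (bead (q ∷ qs)) (x-s+s x 1ℤ)) bt)
    , trans (bead-there (q ∷ qs) {x - 1ℤ - 1ℤ} ne) (trans (cong (bead (q ∷ qs)) (x-s+s (x - 1ℤ) 1ℤ)) bf)
  where
  f : ∀ p x → p - x + 1ℤ + (x - 1ℤ - 1ℤ - p) ≡ - 1ℤ
  f = solve-∀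
  ne : x - 1ℤ - 1ℤ ≢ + p
  ne e = neg-impossible (gap (ℤₚ.≤-trans (bead-≤hd {x = x} P bt) (ℤ.+≤+ h)) ⊕ 0≤+ 1 ⊕ gap (ℤₚ.≤-reflexive (sym e))) (f (+ p) x)

-- The path to the 1-core is followed. By `corner` this core is empty, and for the empty partition
-- the difference of the two sizes is 0.
size-conj : ∀ {la} → Ptn la → size (conj la) ≡ size la
size-conj {la} P with core-exists {1} (s≤s z≤n) P
... | [] , H = ℤₚ.+-injective (trans (sym (ℤₚ.+-identityʳ _)) (trans (Eqv-conj-size P (HasCore⇒Eqv H)) (ℤₚ.+-identityʳ _)))
... | p ∷ ps , H@(_ , _ , C) with corner (toPtn {p ∷ ps} (proj₁ C))
...   | x , bt , bf = ⊥-elim (bool-clash (core⇒closed (s≤s z≤n) C x bt) bf)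

conj-core : ∀ {s la} → 0 < s → IsCore s la → IsCore s (conj la)
conj-core {s} {la} 0<s C = closed⇒core (conj-Ptn P) closed
  where
  P = toPtn {la} (proj₁ C)
  e : ∀ x s → 1ℤ - (x - s) - s ≡ 1ℤ - x
  e = solve-∀
  closed : Closed (+ s) (bead (conj la))
  closed x bt with bead la (1ℤ - (x - + s)) in b
  ... | false = trans (bead-conj P (x - + s)) (cong not b)
  ... | true = ⊥-elim (bool-clash bt (trans (bead-conj P x) (cong not
                 (trans (cong (bead la) (sym (e x (+ s)))) (core⇒closed 0<s C _ b)))))

-- Exchanging two columns of the abacus

Exchanged : (ℤ → Bool) → ℤ → ℤ → (ℤ → Bool) → Set
Exchanged a u v b = b u ≡ a v × b v ≡ a u × (∀ z → z ≢ u → z ≢ v → b z ≡ a z)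

exchange : ∀ {d la u v} → Ptn la → Cong d u v → v + 1ℤ ℤ.≤ u →
  Σ (List ℕ) λ mu → Ptn mu × Exchanged (bead la) u v (bead mu) × Eqv d la mu
    × (¬ (bead la u ≡ false × bead la v ≡ true) → size mu ≤ size la)
    × (bead la u ≡ true × bead la v ≡ false → size mu < size la)
exchange {d} {la} {u} {v} P c v<u with bead la u in bu | bead la v in bv
... | true  | true  = la , P , (bu , bv , λ _ _ _ → refl) , stop , (λ _ → ℕₚ.≤-refl) , λ { (_ , ()) }
... | false | false = la , P , (bu , bv , λ _ _ _ → refl) , stop , (λ _ → ℕₚ.≤-refl) , λ { (() , _) }
... | true  | false with move P bu bv
...   | mu , Q , sz , m = mu , Q , (Mv.bx m , Mv.by m , λ z p q → sym (Mv.rest m z p q)) , Eqv-one Q c m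
                        , (λ _ → ℕₚ.<⇒≤ smaller) , λ _ → smaller
  where
  e : ∀ a b u v → a + v ≡ b + u → a ≡ 1ℤ + b + (u - (v + 1ℤ))
  e a b u v h = trans (e₁ a v) (trans (cong (_- v) h) (e₂ b u v))
    where
    e₁ : ∀ a v → a ≡ a + v - v
    e₁ = solve-∀
    e₂ : ∀ b u v → b + u - v ≡ 1ℤ + b + (u - (v + 1ℤ))
    e₂ = solve-∀
  smaller : size mu < size la
  smaller = ℤₚ.drop‿+≤+ (≤-by _ (gap v<u) (e (+ size la) (+ size mu) u v sz))
exchange {d} {la} {u} {v} P c v<u | false | true with move P bv bu
...   | mu , Q , sz , m = mu , Q , (Mv.by m , Mv.bx m , λ z p q → sym (Mv.rest m z q p)) , Eqv-one Q (Cong-sym c) m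
                        , (λ h → ⊥-elim (h (refl , refl))) , λ { (() , _) }

far : ∀ {la} t z₀ → Ptn la → Σ ℕ λ M → ∀ k → M ≤ k → bead la (z₀ + + k * + suc t) ≡ false × bead la (z₀ + - (+ k) * + suc t) ≡ true
far {la} t z₀ P = M , λ k M≤k →
    bead-high P (≤-by _ (gap (ℤ.+≤+ M≤k) ⊕ 0≤kt k ⊕ gap (-∣i∣≤i z₀) ⊕ 0≤+ (length la)) (e₁ z₀ (+ k) (+ t) (+ ℤ.∣ z₀ ∣) (+ hd la) (+ length la)))
  , bead-low la (≤-by _ (gap (ℤ.+≤+ M≤k) ⊕ 0≤kt k ⊕ gap (i≤∣i∣ z₀) ⊕ 0≤+ (suc (hd la))) (e₂ z₀ (+ k) (+ t) (+ ℤ.∣ z₀ ∣) (+ hd la) (+ length la)))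
  where
  M = ℤ.∣ z₀ ∣ ℕ.+ suc (hd la) ℕ.+ length la
  0≤kt : ∀ k → 0ℤ ℤ.≤ + k * + t
  0≤kt k = subst (0ℤ ℤ.≤_) (ℤₚ.pos-* k t) (0≤+ (k ℕ.* t))
  e₁ : ∀ z k t a h l → z + k * (1ℤ + t) ≡ h + 1ℤ + (k - (a + (1ℤ + h) + l) + k * t + (z - - a) + l)
  e₁ = solve-∀
  e₂ : ∀ z k t a h l → - l ≡ z + - k * (1ℤ + t) + (k - (a + (1ℤ + h) + l) + k * t + (a - z) + (1ℤ + h))
  e₂ = solve-∀

-- The complement of the window -M ≤ i < M, hence a weak inequality above and a strict one below.
Beyond : ℕ → ℤ → Set
Beyond M i = Σ ℕ λ j → (M ≤ j × i ≡ + j) ⊎ (M < j × i ≡ - (+ j))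

locate : ∀ M i → (Σ ℕ λ k → k < M ℕ.+ M × i ≡ + k - + M) ⊎ Beyond M i
locate M i with split (+ M) i
... | inj₁ M≤i with ≤⇒∃ M≤i
...   | k , e = inj₂ (M ℕ.+ k , inj₁ (ℕₚ.m≤m+n M k , e))
locate M i | inj₂ i<M with split (- (+ M)) i
... | inj₁ -M≤i with ≤⇒∃ -M≤i
...   | k , refl = inj₁ (k , ℤₚ.drop‿+≤+ (≤-by _ (gap i<M) (e (+ M) (+ k))) , ℤₚ.+-comm (- (+ M)) (+ k))
  where e : ∀ M k → M + M ≡ 1ℤ + k + (M - (- M + k + 1ℤ))
        e = solve-∀
locate M i | inj₂ i<M | inj₂ i<-M with ≤⇒∃ i<-M
...   | k , eq = inj₂ (M ℕ.+ suc k , inj₂ (ℕₚ.m<m+n M (s≤s z≤n) , trans (e₁ i (+ k)) (trans (cong (_- (1ℤ + + k)) (sym eq)) (e₂ (+ M) (+ k)))))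
  where e₁ : ∀ i k → i ≡ i + 1ℤ + k - (1ℤ + k)
        e₁ = solve-∀
        e₂ : ∀ M k → - M - (1ℤ + k) ≡ - (M + (1ℤ + k))
        e₂ = solve-∀

module Columns (s′ t′ : ℕ) (t∤s : ¬ Cong (+ suc t′) (+ suc s′) 0ℤ) (x₀ : ℤ) where
  private
    s = + suc s′
    t = + suc t′

  -- Here t not dividing s enters: the two columns to be exchanged are different classes modulo t.
  disjoint : ∀ {z} → Cong t z x₀ → ¬ Cong t z (x₀ - s)
  disjoint {z} (cgr k p) (cgr l q) = t∤s (cgr (l - k) (+-cancelˡ-≡ (x₀ - s + k * t) s _ (trans (e₁ x₀ s (k * t)) (trans (trans (sym p) q) (e₂ x₀ s k l t)))))
    where
    e₁ : ∀ x s z → x - s + z + s ≡ x + z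
    e₁ = solve-∀
    e₂ : ∀ x s k l t → x - s + l * t ≡ x - s + k * t + (0ℤ + (l - k) * t)
    e₂ = solve-∀

  θ : ℤ → ℤ
  θ y with Cong? t y x₀
  ... | yes _ = y - s
  ... | no _ with Cong? t y (x₀ - s)
  ...   | yes _ = y + s
  ...   | no _  = y

  data View (y : ℤ) : Set where
    top    : Cong t y x₀ → θ y ≡ y - s → View y
    bottom : Cong t y (x₀ - s) → θ y ≡ y + s → View y
    other  : ¬ Cong t y x₀ → ¬ Cong t y (x₀ - s) → θ y ≡ y → View y

  view : ∀ y → View y
  view y with Cong? t y x₀ in e₁
  ... | yes c = top c eq
    where eq : θ y ≡ y - s
          eq rewrite e₁ = refl
  ... | no ¬c with Cong? t y (x₀ - s) in e₂
  ...   | yes c = bottom c eq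
    where eq : θ y ≡ y + s
          eq rewrite e₁ | e₂ = refl
  ...   | no ¬c′ = other ¬c ¬c′ eq
    where eq : θ y ≡ y
          eq rewrite e₁ | e₂ = refl

  θ-top : ∀ {y} → Cong t y x₀ → θ y ≡ y - s
  θ-top {y} c with view y
  ... | top _ e       = e
  ... | bottom c′ _   = ⊥-elim (disjoint c c′)
  ... | other ¬c _ _  = ⊥-elim (¬c c)

  θ-bottom : ∀ {y} → Cong t y (x₀ - s) → θ y ≡ y + s
  θ-bottom {y} c with view y
  ... | top c′ _      = ⊥-elim (disjoint c′ c)
  ... | bottom _ e    = e
  ... | other _ ¬c _  = ⊥-elim (¬c c)

  θ-other : ∀ {y} → ¬ Cong t y x₀ → ¬ Cong t y (x₀ - s) → θ y ≡ y
  θ-other {y} p q with view y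
  ... | top c _       = ⊥-elim (p c)
  ... | bottom c _    = ⊥-elim (q c)
  ... | other _ _ e   = e

  lower-Cong : ∀ {y} → Cong t y x₀ → Cong t (y - s) (x₀ - s)
  lower-Cong {y} (cgr k refl) = cgr k (e x₀ s (k * t))
    where e : ∀ x s z → x + z - s ≡ x - s + z
          e = solve-∀

  raise-Cong : ∀ {y} → Cong t y (x₀ - s) → Cong t (y + s) x₀
  raise-Cong {y} (cgr k refl) = cgr k (e x₀ s (k * t))
    where e : ∀ x s z → x - s + z + s ≡ x + z
          e = solve-∀

  θ-involutive : ∀ y → θ (θ y) ≡ y
  θ-involutive y with view y
  ... | top c e = trans (cong θ e) (trans (θ-bottom (lower-Cong c)) (x-s+s y s))
  ... | bottom c e = trans (cong θ e) (trans (θ-top (raise-Cong c)) (e′ y s))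
    where e′ : ∀ y s → y + s - s ≡ y
          e′ = solve-∀
  ... | other _ _ e = trans (cong θ e) e

  θ-shift : ∀ y k → θ (y + k * t) ≡ θ y + k * t
  θ-shift y k with view y
  ... | top c e = trans (θ-top (Cong-trans (cgr k refl) c)) (trans (e′ y s (k * t)) (cong (_+ k * t) (sym e)))
    where e′ : ∀ y s z → y + z - s ≡ y - s + z
          e′ = solve-∀
  ... | bottom c e = trans (θ-bottom (Cong-trans (cgr k refl) c)) (trans (e′ y s (k * t)) (cong (_+ k * t) (sym e)))
    where e′ : ∀ y s z → y + z + s ≡ y + s + z
          e′ = solve-∀
  ... | other ¬c ¬c′ e = trans (θ-other (λ c → ¬c (Cong-trans back c)) (λ c → ¬c′ (Cong-trans back c))) (cong (_+ k * t) (sym e))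
    where back : Cong t y (y + k * t)
          back = Cong-sym (cgr k refl)

  Mv-θ : ∀ {x y a b} → Mv x y a b → Mv (θ x) (θ y) (λ z → a (θ z)) (λ z → b (θ z))
  Mv-θ {x} {y} {a} {b} (mv ax ay bx by rest) = mv
    (trans (cong a (θ-involutive x)) ax) (trans (cong a (θ-involutive y)) ay)
    (trans (cong b (θ-involutive x)) bx) (trans (cong b (θ-involutive y)) by)
    λ z p q → rest (θ z) (λ e → p (trans (sym (θ-involutive z)) (cong θ e))) (λ e → q (trans (sym (θ-involutive z)) (cong θ e)))

  module _ {la} (P : Ptn la) where
    private
      M₁ = far t′ x₀ P
      M₂ = far t′ (x₀ - s) P
      M  = proj₁ M₁ ℕ.+ proj₁ M₂

      pos : ℕ → ℤ
      pos k = x₀ + (+ k - + M) * t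

      pos-Cong : ∀ k → Cong t (pos k) x₀
      pos-Cong k = cgr (+ k - + M) refl

      pos-injective : ∀ k l → pos k ≡ pos l → k ≡ l
      pos-injective k l e = ℤₚ.+-injective (+-cancelʳ-≡ (- (+ M)) (+ k) (+ l)
        (ℤₚ.*-cancelʳ-≡ (+ k - + M) (+ l - + M) t (+-cancelˡ-≡ x₀ _ _ e)))

      Descending : Set
      Descending = ∀ k → ¬ (bead la (pos k) ≡ false × bead la (pos k - s) ≡ true)

      Drop : ℕ → Set
      Drop k = bead la (pos k) ≡ true × bead la (pos k - s) ≡ false

      -- The state after exchanging n of the 2M pairs in the window. Outside the window both columns
      -- are empty (above) or full (below), so nothing remains to be exchanged there. Each exchange
      -- shifts a bead by s, which keeps the class modulo s.
      record Partial (n : ℕ) : Set where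
        field
          mu      : List ℕ
          ptn     : Ptn mu
          path    : Eqv s la mu
          swapped : ∀ k → k < n → bead mu (pos k) ≡ bead la (pos k - s) × bead mu (pos k - s) ≡ bead la (pos k)
          kept    : ∀ z → (∀ k → k < n → z ≢ pos k × z ≢ pos k - s) → bead mu z ≡ bead la z
          smaller : Descending → size mu ≤ size la × (∀ k → k < n → Drop k → size mu < size la)

      pos≢low : ∀ k l → pos k ≢ pos l - s
      pos≢low k l e = disjoint (pos-Cong k) (subst (λ z → Cong t z (x₀ - s)) (sym e) (lower-Cong (pos-Cong l)))

      low-injective : ∀ k l → pos k - s ≡ pos l - s → k ≡ l
      low-injective k l e = pos-injective k l (+-cancelʳ-≡ (- s) (pos k) (pos l) e)

      partial : ∀ n → Partial n
      partial zero = record { mu = la ; ptn = P ; path = stop ; swapped = λ _ () ; kept = λ _ _ → refl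
                            ; smaller = λ _ → ℕₚ.≤-refl , λ _ () }
      partial (suc n) = extend (partial n)
        where
        extend : Partial n → Partial (suc n)
        extend R = combine (exchange {s} {Partial.mu R} {pos n} {pos n - s} (Partial.ptn R) (cgr 1ℤ (e₁ (pos n) s)) (≤-by _ (0≤+ s′) (e₂ (pos n) (+ s′))))
          where
          open Partial R
          e₁ : ∀ x s → x ≡ x - s + 1ℤ * s
          e₁ = solve-∀
          e₂ : ∀ x s → x ≡ x - (1ℤ + s) + 1ℤ + s
          e₂ = solve-∀
          same-top : bead mu (pos n) ≡ bead la (pos n)
          same-top = kept (pos n) λ k k<n → (λ e → ℕₚ.<⇒≢ k<n (sym (pos-injective n k e))) , pos≢low n k
          same-low : bead mu (pos n - s) ≡ bead la (pos n - s)
          same-low = kept (pos n - s) λ k k<n → (λ e → pos≢low k n (sym e)) , λ e → ℕₚ.<⇒≢ k<n (sym (low-injective n k e))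
          combine : (Σ (List ℕ) λ nu → Ptn nu × Exchanged (bead mu) (pos n) (pos n - s) (bead nu) × Eqv s mu nu
            × (¬ (bead mu (pos n) ≡ false × bead mu (pos n - s) ≡ true) → size nu ≤ size mu)
            × (bead mu (pos n) ≡ true × bead mu (pos n - s) ≡ false → size nu < size mu)) → Partial (suc n)
          combine (nu , Q , (eu , ev , er) , w , le , lt) = record
            { mu = nu ; ptn = Q ; path = Eqv-trans path w
            ; swapped = swp
            ; kept = λ z h → trans (er z (proj₁ (h n ℕₚ.≤-refl)) (proj₂ (h n ℕₚ.≤-refl)))
                       (kept z λ k k<n → h k (ℕₚ.m≤n⇒m≤1+n k<n))
            ; smaller = λ D → ℕₚ.≤-trans (le′ D) (proj₁ (smaller D)) , sml D }
            where
            swp : ∀ k → k < suc n → bead nu (pos k) ≡ bead la (pos k - s) × bead nu (pos k - s) ≡ bead la (pos k)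
            swp k (s≤s k≤n) with ℕₚ.m≤n⇒m<n∨m≡n k≤n
            ... | inj₂ refl = trans eu same-low , trans ev same-top
            ... | inj₁ k<n = trans (er (pos k) (λ e → ℕₚ.<⇒≢ k<n (pos-injective k n e)) (pos≢low k n)) (proj₁ (swapped k k<n))
                           , trans (er (pos k - s) (λ e → pos≢low n k (sym e)) (λ e → ℕₚ.<⇒≢ k<n (low-injective k n e))) (proj₂ (swapped k k<n))
            le′ : Descending → size nu ≤ size mu
            le′ D = le λ { (p , q) → D n (trans (sym same-top) p , trans (sym same-low) q) }
            sml : Descending → ∀ k → k < suc n → Drop k → size nu < size la
            sml D k (s≤s k≤n) dr with ℕₚ.m≤n⇒m<n∨m≡n k≤n
            ... | inj₂ refl = ℕₚ.<-≤-trans (lt (trans same-top (proj₁ dr) , trans same-low (proj₂ dr))) (proj₁ (smaller D))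
            ... | inj₁ k<n = ℕₚ.≤-<-trans (le′ D) (proj₂ (smaller D) k k<n dr)

      final : Partial (M ℕ.+ M)
      final = partial (M ℕ.+ M)
      open Partial final

      outside : ∀ i → Beyond M i → bead la (x₀ + i * t) ≡ bead la (x₀ - s + i * t)
      outside _ (j , inj₁ (M≤j , refl)) = trans (proj₁ (proj₂ M₁ j (ℕₚ.≤-trans (ℕₚ.m≤m+n _ _) M≤j)))
                                         (sym (proj₁ (proj₂ M₂ j (ℕₚ.≤-trans (ℕₚ.m≤n+m _ (proj₁ M₁)) M≤j))))
      outside _ (j , inj₂ (M<j , refl)) = trans (proj₂ (proj₂ M₁ j (ℕₚ.≤-trans (ℕₚ.m≤m+n _ _) (ℕₚ.<⇒≤ M<j))))
                                         (sym (proj₂ (proj₂ M₂ j (ℕₚ.≤-trans (ℕₚ.m≤n+m _ (proj₁ M₁)) (ℕₚ.<⇒≤ M<j)))))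

      beyond-≢ : ∀ i k → Beyond M i → k < M ℕ.+ M → i ≢ + k - + M
      beyond-≢ i k (j , inj₁ (M≤j , refl)) k<n e = ℕₚ.<⇒≱ k<n (subst (M ℕ.+ M ≤_) (ℤₚ.+-injective (trans (cong (_+ + M) e) (x-s+s (+ k) (+ M)))) (ℕₚ.+-monoˡ-≤ M M≤j))
      beyond-≢ i k (j , inj₂ (M<j , refl)) k<n e = ℕₚ.<⇒≱ M<j (subst (j ≤_) (ℤₚ.+-injective (trans (e₁ (+ k) (+ j)) (trans (cong (λ z → + k - z) e) (e₂ (+ k) (+ M))))) (ℕₚ.m≤n+m j k))
        where
        e₁ : ∀ k j → k + j ≡ k - - j
        e₁ = solve-∀
        e₂ : ∀ k M → k - (k - M) ≡ M
        e₂ = solve-∀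

      lowered : ∀ x z s → x - s + z ≡ x + z - s
      lowered = solve-∀

      raised : ∀ x z s → x - s + z + s ≡ x + z
      raised = solve-∀

      agree : ∀ z → bead mu z ≡ bead la (θ z)
      agree z with view z
      ... | other ¬c ¬c′ e = trans (kept z λ k _ → (λ { refl → ¬c (pos-Cong k) }) , λ { refl → ¬c′ (lower-Cong (pos-Cong k)) })
                               (cong (bead la) (sym e))
      ... | top (cgr i refl) e with locate M i
      ...   | inj₁ (k , k<n , refl) = trans (proj₁ (swapped k k<n)) (cong (bead la) (sym e))
      ...   | inj₂ o = trans (kept _ λ k k<n → (λ eq → beyond-≢ i k o k<n (ℤₚ.*-cancelʳ-≡ i (+ k - + M) t (+-cancelˡ-≡ x₀ _ _ eq)))
                                 , λ eq → disjoint (cgr i refl) (subst (λ z → Cong t z (x₀ - s)) (sym eq) (lower-Cong (pos-Cong k))))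
                         (trans (outside i o) (cong (bead la) (trans (lowered x₀ (i * t) s) (sym e))))
      agree z | bottom (cgr i refl) e with locate M i
      ...   | inj₁ (k , k<n , refl) = trans (cong (bead mu) (lowered x₀ (i * t) s)) (trans (proj₂ (swapped k k<n))
                                         (cong (bead la) (trans (sym (raised x₀ (i * t) s)) (sym e))))
      ...   | inj₂ o = trans (kept _ λ k k<n → (λ eq → disjoint (pos-Cong k) (subst (λ z → Cong t z (x₀ - s)) eq (cgr i refl)))
                                 , λ eq → beyond-≢ i k o k<n (ℤₚ.*-cancelʳ-≡ i (+ k - + M) t
                                     (+-cancelˡ-≡ (x₀ - s) _ _ (trans eq (sym (lowered x₀ ((+ k - + M) * t) s))))))
                         (trans (sym (outside i o)) (cong (bead la) (trans (sym (raised x₀ (i * t) s)) (sym e))))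

      -- In a t-closed set a column is filled downwards from each of its beads. Thus the column of
      -- `x₀` is full at all indices up to 0 and that of `x₀ - s` is empty from 0 on: no exchange
      -- raises a bead, and the one at index 0 lowers one.
      shrinks : Closed t (bead la) → bead la x₀ ≡ true → bead la (x₀ - s) ≡ false → size mu < size la
      shrinks C bt bf with locate M 0ℤ
      ... | inj₁ (k , k<n , e) = proj₂ (smaller descending) k k<n (trans (cong (bead la) (sym x₀≡)) bt , trans (cong (λ z → bead la (z - s)) (sym x₀≡)) bf)
        where
        e₀ : ∀ x t → x ≡ x + 0ℤ * t
        e₀ = solve-∀
        x₀≡ : x₀ ≡ pos k
        x₀≡ = trans (e₀ x₀ t) (cong (λ i → x₀ + i * t) e)
        descending : Descending
        descending k (f , g) = clash (+ k - + M) f g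
          where
          clash : ∀ i → bead la (x₀ + i * t) ≡ false → bead la (x₀ + i * t - s) ≡ true → ⊥
          clash (+ j) f g = bool-clash (trans (cong (bead la) (e₁ x₀ s (+ j * t))) (Closed-multiple C j _ g)) bf
            where e₁ : ∀ x s z → x - s ≡ x + z - s - z
                  e₁ = solve-∀
          clash -[1+ j ] f g = bool-clash (trans (cong (bead la) (e₁ x₀ (+ suc j) t)) (Closed-multiple C (suc j) x₀ bt)) f
            where e₁ : ∀ x j t → x + - j * t ≡ x - j * t
                  e₁ = solve-∀
      ... | inj₂ o = ⊥-elim (bool-clash bt (trans (trans (cong (bead la) (e₀ x₀ t)) (outside 0ℤ o)) (trans (cong (bead la) (sym (e₀ (x₀ - s) t))) bf)))
        where
        e₀ : ∀ x t → x ≡ x + 0ℤ * t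
        e₀ = solve-∀

    abstract
      image : Σ (List ℕ) λ mu → Ptn mu × (bead mu ≗ λ z → bead la (θ z)) × Eqv s la mu
        × (Closed t (bead la) → bead la x₀ ≡ true → bead la (x₀ - s) ≡ false → size mu < size la)
      image = mu , ptn , agree , path , shrinks

  -- As `θ` commutes with shifts by t, it takes each t-move to a t-move of the same displacement.
  -- The size difference between a partition and its image is therefore constant along the path.
  image-path : ∀ {la la′ mu mu′} → Ptn la → Ptn la′ → Ptn mu′ → (bead la′ ≗ λ z → bead la (θ z)) → (bead mu′ ≗ λ z → bead mu (θ z)) →
    Eqv t la mu → Eqv t la′ mu′ × (+ size la + + size mu′ ≡ + size la′ + + size mu)
  image-path {la} {la′} {mu′ = mu′} P P′ Q′ f g stop with bead-injective P′ Q′ (λ z → trans (f z) (sym (g z)))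
  ... | refl = stop , ℤₚ.+-comm (+ size la) (+ size la′)
  image-path {la} {la′} {mu} {mu′} P P′ Q′ f g (go {mu = nu} {x = x} {y = y} R (cgr k refl) m w) with image R
  ... | nu′ , R′ , h , _ with image-path R R′ Q′ h g w
  ... | w′ , sz = go R′ (cgr k (θ-shift y k)) m′ w′
      , combine (+ size la) (+ size la′) (+ size nu) (+ size nu′) (+ size mu) (+ size mu′) (k * t) y (θ y) (Mv-size P R m)
          (trans (Mv-size P′ R′ m′) (cong (_+_ (+ size nu′)) (θ-shift y k))) sz
    where
    m′ : Mv (θ (y + k * t)) (θ y) (bead la′) (bead nu′)
    m′ = Mv-resp (λ z → sym (f z)) (λ z → sym (h z)) (Mv-θ m)
    combine : ∀ a a′ n n′ b b′ k y y′ → a + y ≡ n + (y + k) → a′ + y′ ≡ n′ + (y′ + k) → n + b′ ≡ n′ + b → a + b′ ≡ a′ + b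
    combine a a′ n n′ b b′ k y y′ p q r = +-cancelʳ-≡ (n + y + (n′ + (y′ + k))) _ _
      (trans (e₁ a b′ n n′ k y y′) (trans (cong₂ _+_ (cong₂ _+_ p r) (sym q)) (e₂ a′ b n n′ k y y′)))
      where
      e₁ : ∀ a b′ n n′ k y y′ → a + b′ + (n + y + (n′ + (y′ + k))) ≡ a + y + (n + b′) + (n′ + (y′ + k))
      e₁ = solve-∀
      e₂ : ∀ a′ b n n′ k y y′ → n + (y + k) + (n′ + b) + (a′ + y′) ≡ a′ + b + (n + y + (n′ + (y′ + k)))
      e₂ = solve-∀

-- Transfer between families of partitions with prescribed cores

Common : ℤ → ℤ → List ℕ → List ℕ → List ℕ → Set
Common s t σ τ ν = Ptn ν × Eqv s ν σ × Eqv t ν τ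

-- The bijection of positions is kept besides the maps of partitions, so that a difference in beads
-- can be pulled back along it (`Diff₂-pull`). Both cores enter `sizes` symmetrically, so that one
-- formula serves for changes of σ and of τ.
record Transfer (s t : ℤ) (σ τ σ′ τ′ : List ℕ) : Set where
  field
    f g   : ℤ → ℤ
    f∘g   : ∀ z → f (g z) ≡ z
    g∘f   : ∀ z → g (f z) ≡ z
    fwd   : ∀ {ν} → Common s t σ τ ν → Σ (List ℕ) λ ν′ → Common s t σ′ τ′ ν′ × (bead ν′ ≗ λ z → bead ν (f z))
    bwd   : ∀ {ν′} → Common s t σ′ τ′ ν′ → Σ (List ℕ) λ ν → Common s t σ τ ν × (bead ν ≗ λ z → bead ν′ (g z))
    sizes : ∀ {ν ν′} → Common s t σ τ ν → Ptn ν′ → (bead ν′ ≗ λ z → bead ν (f z)) →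
            + size ν + (+ size σ′ + + size τ′) ≡ + size ν′ + (+ size σ + + size τ)

Transfer-id : ∀ {s t σ τ} → Transfer s t σ τ σ τ
Transfer-id {σ = σ} {τ} = record
  { f = λ z → z ; g = λ z → z ; f∘g = λ _ → refl ; g∘f = λ _ → refl
  ; fwd = λ {ν} c → ν , c , λ _ → refl ; bwd = λ {ν} c → ν , c , λ _ → refl
  ; sizes = λ c Q e → cong (λ l → + size l + (+ size σ + + size τ)) (sym (bead-injective Q (proj₁ c) e)) }

Transfer-trans : ∀ {s t σ τ σ₁ τ₁ σ₂ τ₂} → Transfer s t σ τ σ₁ τ₁ → Transfer s t σ₁ τ₁ σ₂ τ₂ → Transfer s t σ τ σ₂ τ₂
Transfer-trans {s} {t} {σ} {τ} {σ₁} {τ₁} {σ₂} {τ₂} T₁ T₂ = record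
  { f = λ z → T₁.f (T₂.f z) ; g = λ z → T₂.g (T₁.g z)
  ; f∘g = λ z → trans (cong T₁.f (T₂.f∘g (T₁.g z))) (T₁.f∘g z)
  ; g∘f = λ z → trans (cong T₂.g (T₁.g∘f (T₂.f z))) (T₂.g∘f z)
  ; fwd = fwd ; bwd = bwd ; sizes = sizes }
  where
  module T₁ = Transfer T₁
  module T₂ = Transfer T₂
  fwd : ∀ {ν} → Common s t σ τ ν → Σ (List ℕ) λ ν″ → Common s t σ₂ τ₂ ν″ × (bead ν″ ≗ λ z → bead ν (T₁.f (T₂.f z)))
  fwd c with T₁.fwd c
  ... | ν′ , c′ , e with T₂.fwd c′
  ... | ν″ , c″ , e′ = ν″ , c″ , λ z → trans (e′ z) (e (T₂.f z))
  bwd : ∀ {ν″} → Common s t σ₂ τ₂ ν″ → Σ (List ℕ) λ ν → Common s t σ τ ν × (bead ν ≗ λ z → bead ν″ (T₂.g (T₁.g z)))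
  bwd c″ with T₂.bwd c″
  ... | ν′ , c′ , e with T₁.bwd c′
  ... | ν , c , e′ = ν , c , λ z → trans (e′ z) (e (T₁.g z))
  telescope : ∀ a b c x y z → a + y ≡ b + x → b + z ≡ c + y → a + z ≡ c + x
  telescope a b c x y z p q = +-cancelʳ-≡ (b + y) _ _ (trans (e₁ a b y z) (trans (cong₂ _+_ p q) (e₂ b c x y)))
    where
    e₁ : ∀ a b y z → a + z + (b + y) ≡ a + y + (b + z)
    e₁ = solve-∀
    e₂ : ∀ b c x y → b + x + (c + y) ≡ c + x + (b + y)
    e₂ = solve-∀
  sizes : ∀ {ν ν″} → Common s t σ τ ν → Ptn ν″ → (bead ν″ ≗ λ z → bead ν (T₁.f (T₂.f z))) →
            + size ν + (+ size σ₂ + + size τ₂) ≡ + size ν″ + (+ size σ + + size τ)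
  sizes {ν} {ν″} c Q e with T₁.fwd c
  ... | ν′ , c′ , e′ = telescope (+ size ν) (+ size ν′) (+ size ν″) (+ size σ + + size τ) (+ size σ₁ + + size τ₁) (+ size σ₂ + + size τ₂)
                         (T₁.sizes c (proj₁ c′) e′) (T₂.sizes c′ Q (λ z → trans (e z) (sym (e′ (T₂.f z)))))

Transfer-swap : ∀ {s t σ τ σ′ τ′} → Transfer s t σ τ σ′ τ′ → Transfer t s τ σ τ′ σ′
Transfer-swap {s} {t} {σ} {τ} {σ′} {τ′} T₁ = record
  { f = T₁.f ; g = T₁.g ; f∘g = T₁.f∘g ; g∘f = T₁.g∘f
  ; fwd = λ { (P , u , v) → flip (T₁.fwd (P , v , u)) }
  ; bwd = λ { (P , u , v) → flip (T₁.bwd (P , v , u)) }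
  ; sizes = λ { {ν} {ν′} (P , u , v) Q e → trans (cong (_+_ (+ size ν)) (ℤₚ.+-comm (+ size τ′) (+ size σ′)))
              (trans (T₁.sizes (P , v , u) Q e) (cong (_+_ (+ size ν′)) (ℤₚ.+-comm (+ size σ) (+ size τ)))) } }
  where
  module T₁ = Transfer T₁
  flip : ∀ {s t σ τ} {R : List ℕ → Set} → (Σ (List ℕ) λ ν → Common s t σ τ ν × R ν) → Σ (List ℕ) λ ν → Common t s τ σ ν × R ν
  flip (ν , (P , u , v) , r) = ν , (P , v , u) , r

module _ (s′ t′ : ℕ) (t∤s : ¬ Cong (+ suc t′) (+ suc s′) 0ℤ) where
  private
    s = + suc s′
    t = + suc t′

  column-transfer : ∀ {σ τ} x₀ → Ptn τ → Closed t (bead τ) → bead τ x₀ ≡ true → bead τ (x₀ - s) ≡ false →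
    Σ (List ℕ) λ τ′ → Ptn τ′ × Closed t (bead τ′) × Eqv s τ τ′ × size τ′ < size τ × Transfer s t σ τ σ τ′
  column-transfer {σ} {τ} x₀ P C bt bf with Columns.image s′ t′ t∤s x₀ P
  ... | τ′ , P′ , h , w , small = τ′ , P′ , closed′ , w , small C bt bf , record
      { f = θ ; g = θ ; f∘g = θ-involutive ; g∘f = θ-involutive
      ; fwd = fwd ; bwd = bwd ; sizes = sizes }
    where
    open Columns s′ t′ t∤s x₀
    closed′ : Closed t (bead τ′)
    closed′ x b = trans (h (x - t)) (trans (cong (bead τ) (trans (cong θ (e x t)) (trans (θ-shift x (- 1ℤ)) (sym (e (θ x) t)))))
                    (C (θ x) (trans (sym (h x)) b)))
      where e : ∀ x t → x - t ≡ x + - 1ℤ * t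
            e = solve-∀
    h⁻ : bead τ ≗ λ z → bead τ′ (θ z)
    h⁻ z = trans (cong (bead τ) (sym (θ-involutive z))) (sym (h (θ z)))
    fwd : ∀ {ν} → Common s t σ τ ν → Σ (List ℕ) λ ν′ → Common s t σ τ′ ν′ × (bead ν′ ≗ λ z → bead ν (θ z))
    fwd (Q , u , v) with image Q
    ... | ν′ , Q′ , k , w′ , _ = ν′ , (Q′ , Eqv-trans (Eqv-sym Q w′) u , proj₁ (image-path Q Q′ P′ k h v)) , k
    bwd : ∀ {ν} → Common s t σ τ′ ν → Σ (List ℕ) λ ν′ → Common s t σ τ ν′ × (bead ν′ ≗ λ z → bead ν (θ z))
    bwd (Q , u , v) with image Q
    ... | ν′ , Q′ , k , w′ , _ = ν′ , (Q′ , Eqv-trans (Eqv-sym Q w′) u , proj₁ (image-path Q Q′ P k h⁻ v)) , k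
    sizes : ∀ {ν ν′} → Common s t σ τ ν → Ptn ν′ → (bead ν′ ≗ λ z → bead ν (θ z)) →
            + size ν + (+ size σ + + size τ′) ≡ + size ν′ + (+ size σ + + size τ)
    sizes {ν} {ν′} (Q , u , v) Q′ k = trans (e₁ (+ size ν) (+ size σ) (+ size τ′))
      (trans (cong (_+_ (+ size σ)) (proj₂ (image-path Q Q′ P′ k h v))) (sym (e₁ (+ size ν′) (+ size σ) (+ size τ))))
      where e₁ : ∀ a b c → a + (b + c) ≡ b + (a + c)
            e₁ = solve-∀

  abstract
    -- Each exchange keeps the class of τ under `Eqv s` and decreases its size. The final `ρ` is
    -- s-closed and still equivalent to τ, hence it is the s-core of τ.
    reduce : ∀ {σ τ} → Ptn τ → Closed t (bead τ) →
      Σ (List ℕ) λ ρ → Ptn ρ × Closed t (bead ρ) × Closed s (bead ρ) × Eqv s τ ρ × Transfer s t σ τ σ ρ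
    reduce {σ} {τ} P C = loop τ P C (<-wellFounded (size τ))
      where
      loop : ∀ τ → Ptn τ → Closed t (bead τ) → Acc _<_ (size τ) →
        Σ (List ℕ) λ ρ → Ptn ρ × Closed t (bead ρ) × Closed s (bead ρ) × Eqv s τ ρ × Transfer s t σ τ σ ρ
      loop τ P C (acc rec) with closed-or-not (suc s′) P
      ... | inj₁ D = τ , P , C , D , stop , Transfer-id
      ... | inj₂ (x , bt , bf) with column-transfer {σ} x P C bt bf
      ... | τ′ , P′ , C′ , w , small , T with loop τ′ P′ C′ (rec small)
      ... | ρ , Q , D , D′ , w′ , T′ = ρ , Q , D , D′ , Eqv-trans w w′ , Transfer-trans T T′

-- Configurations differing in two beads

-- No pairing of a, b with c, d is prescribed: the same difference is read as a → c, b → d modulo s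
-- and as a → d, b → c modulo t.
record Diff₂ (a b c d : ℤ) (L M : ℤ → Bool) : Set where
  field
    La   : L a ≡ true
    Lb   : L b ≡ true
    Lc   : L c ≡ false
    Ld   : L d ≡ false
    Ma   : M a ≡ false
    Mb   : M b ≡ false
    Mc   : M c ≡ true
    Md   : M d ≡ true
    a≢b  : a ≢ b
    c≢d  : c ≢ d
    rest : ∀ z → z ≢ a → z ≢ b → z ≢ c → z ≢ d → L z ≡ M z

Diff₂-swap : ∀ {a b c d L M} → Diff₂ a b c d L M → Diff₂ a b d c L M
Diff₂-swap D = record { La = La ; Lb = Lb ; Lc = Ld ; Ld = Lc ; Ma = Ma ; Mb = Mb ; Mc = Md ; Md = Mc
  ; a≢b = a≢b ; c≢d = λ e → c≢d (sym e) ; rest = λ z p q r s → rest z p q s r }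
  where open Diff₂ D

Diff₂-source : ∀ {a b c d L M z} → Diff₂ a b c d L M → L z ≡ true → M z ≡ false → z ≡ a ⊎ z ≡ b
Diff₂-source {a} {b} {c} {d} {z = z} D Lz Mz with eq? z a | eq? z b
... | yes e | _ = inj₁ e
... | no _ | yes e = inj₂ e
... | no p | no q = ⊥-elim (bool-clash (trans (sym (rest z p q (λ { refl → bool-clash Mc Mz }) (λ { refl → bool-clash Md Mz }))) Lz) Mz)
  where open Diff₂ D

Diff₂-target : ∀ {a b c d L M z} → Diff₂ a b c d L M → L z ≡ false → M z ≡ true → z ≡ c ⊎ z ≡ d
Diff₂-target {a} {b} {c} {d} {z = z} D Lz Mz with eq? z c | eq? z d
... | yes e | _ = inj₁ e
... | no _ | yes e = inj₂ e
... | no p | no q = ⊥-elim (bool-clash Mz (trans (sym (rest z (λ { refl → bool-clash La Lz }) (λ { refl → bool-clash Lb Lz }) p q)) Lz))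
  where open Diff₂ D

Diff₂-mid : ∀ {a b c d la mu} → Ptn la → Diff₂ a b c d (bead la) (bead mu) →
  Σ (List ℕ) λ nu → Ptn nu × Mv a c (bead la) (bead nu) × Mv b d (bead nu) (bead mu)
Diff₂-mid {a} {b} {c} {d} {la} {mu} P D with move P (Diff₂.La D) (Diff₂.Lc D)
... | nu , Q , _ , m = nu , Q , m , record
    { ax = trans (sym (Mv.rest m b (λ e → a≢b (sym e)) (bead-≢ {bead la} Lb Lc))) Lb
    ; ay = trans (sym (Mv.rest m d (λ e → bead-≢ {bead la} La Ld (sym e)) (λ e → c≢d (sym e)))) Ld
    ; bx = Mb ; by = Md ; rest = r }
  where
  open Diff₂ D
  r : ∀ z → z ≢ b → z ≢ d → bead nu z ≡ bead mu z
  r z p q with eq? z a | eq? z c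
  ... | yes refl | _ = trans (Mv.bx m) (sym Ma)
  ... | no _ | yes refl = trans (Mv.by m) (sym Mc)
  ... | no u | no v = trans (sym (Mv.rest m z u v)) (rest z u p v q)

Diff₂-Eqv : ∀ {k a b c d la mu} → Ptn la → Ptn mu → Diff₂ a b c d (bead la) (bead mu) → Cong k a c → Cong k b d → Eqv k la mu
Diff₂-Eqv {mu = mu} P R D u v with Diff₂-mid {mu = mu} P D
... | nu , Q , m , n = go Q u m (go R v n stop)

Diff₂-size : ∀ {a b c d la mu} → Ptn la → Ptn mu → Diff₂ a b c d (bead la) (bead mu) → + size la + (c + d) ≡ + size mu + (a + b)
Diff₂-size {a} {b} {c} {d} {la} {mu} P R D with Diff₂-mid {mu = mu} P D
... | nu , Q , m , n = +-cancelʳ-≡ (+ size nu) _ _ (trans (e₁ (+ size la) (+ size nu) c d) (trans (cong₂ _+_ (Mv-size P Q m) (Mv-size Q R n))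
                          (e₂ (+ size mu) (+ size nu) a b)))
  where
  e₁ : ∀ l n c d → l + (c + d) + n ≡ l + c + (n + d)
  e₁ = solve-∀
  e₂ : ∀ m n a b → n + a + (m + b) ≡ m + (a + b) + n
  e₂ = solve-∀

move₂ : ∀ {a b c d la} → Ptn la → bead la a ≡ true → bead la b ≡ true → bead la c ≡ false → bead la d ≡ false → a ≢ b → c ≢ d →
  Σ (List ℕ) λ mu → Ptn mu × Diff₂ a b c d (bead la) (bead mu)
move₂ {a} {b} {c} {d} {la} P La Lb Lc Ld a≢b c≢d with move P La Lc
... | nu , Q , _ , m with move {nu} {b} {d} Q (trans (sym (Mv.rest m b (λ e → a≢b (sym e)) (bead-≢ {bead la} Lb Lc))) Lb)
                               (trans (sym (Mv.rest m d (λ e → bead-≢ {bead la} La Ld (sym e)) (λ e → c≢d (sym e)))) Ld)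
... | mu , R , _ , n = mu , R , record
    { La = La ; Lb = Lb ; Lc = Lc ; Ld = Ld
    ; Ma = trans (sym (Mv.rest n a a≢b (bead-≢ {bead la} La Ld))) (Mv.bx m)
    ; Mb = Mv.bx n
    ; Mc = trans (sym (Mv.rest n c (λ e → bead-≢ {bead la} Lb Lc (sym e)) c≢d)) (Mv.by m)
    ; Md = Mv.by n ; a≢b = a≢b ; c≢d = c≢d
    ; rest = λ z p q r s → trans (Mv.rest m z p r) (Mv.rest n z q s) }

-- The reflection x ↦ 1 - x would exchange {a, b} with {c, d}; as a + b = c + d
-- by equality of sizes, a + b = 1 and then 1 - a = b, a contradiction.
not-both-self-conjugate : ∀ {a b c d la mu} → Ptn la → Ptn mu → Diff₂ a b c d (bead la) (bead mu) → size la ≡ size mu →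
  conj la ≡ la → conj mu ≡ mu → ⊥
not-both-self-conjugate {a} {b} {c} {d} {la} {mu} P Q D sz cl cm = cases (image-of La Ma) (image-of Lb Mb)
  where
  open Diff₂ D
  reflect : ∀ {nu} → Ptn nu → conj nu ≡ nu → ∀ x {β} → bead nu x ≡ β → bead nu (1ℤ - x) ≡ not β
  reflect {nu} R e x h = trans (cong (λ l → bead l (1ℤ - x)) (sym e)) (trans (bead-conj R (1ℤ - x)) (cong not (trans (cong (bead nu) (1-[1-x] x)) h)))
  image-of : ∀ {x} → bead la x ≡ true → bead mu x ≡ false → 1ℤ - x ≡ c ⊎ 1ℤ - x ≡ d
  image-of {x} p q = Diff₂-target D (reflect P cl x p) (reflect Q cm x q)
  sums : c + d ≡ a + b
  sums = +-cancelˡ-≡ (+ size la) _ _ (trans (Diff₂-size P Q D) (cong (λ k → + k + (a + b)) (sym sz)))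
  half : ∀ {u v} → 1ℤ - a ≡ u → 1ℤ - b ≡ v → u + v ≡ a + b → b ≡ u
  half refl refl e = trans (e₁ a b) (trans (cong (_- a) (ℤₚ.*-cancelˡ-≡ (+ 2) (a + b) 1ℤ (trans (e₂ a b) (trans (cong (_+_ (a + b)) (sym e)) (e₃ a b))))) refl)
    where
    e₁ : ∀ a b → b ≡ a + b - a
    e₁ = solve-∀
    e₂ : ∀ a b → + 2 * (a + b) ≡ a + b + (a + b)
    e₂ = solve-∀
    e₃ : ∀ a b → a + b + (1ℤ - a + (1ℤ - b)) ≡ + 2 * 1ℤ
    e₃ = solve-∀
  cancel : ∀ {u} → 1ℤ - a ≡ u → 1ℤ - b ≡ u → a ≡ b
  cancel p q = trans (sym (1-[1-x] a)) (trans (cong (λ z → 1ℤ - z) (trans p (sym q))) (1-[1-x] b))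
  cases : 1ℤ - a ≡ c ⊎ 1ℤ - a ≡ d → 1ℤ - b ≡ c ⊎ 1ℤ - b ≡ d → ⊥
  cases (inj₁ p) (inj₁ q) = a≢b (cancel p q)
  cases (inj₂ p) (inj₂ q) = a≢b (cancel p q)
  cases (inj₁ p) (inj₂ q) = bool-clash Lb (trans (cong (bead la) (half p q sums)) Lc)
  cases (inj₂ p) (inj₁ q) = bool-clash Lb (trans (cong (bead la) (half p q (trans (ℤₚ.+-comm d c) sums))) Ld)

-- Exactly two partitions

record Two (s t : ℤ) (σ τ : List ℕ) (n : ℕ) (la mu : List ℕ) : Set where
  field
    cla  : Common s t σ τ la
    cmu  : Common s t σ τ mu
    sla  : size la ≡ n
    smu  : size mu ≡ n
    la≢mu : la ≢ mu
    only : ∀ {ν} → Common s t σ τ ν → size ν ≡ n → ν ≡ la ⊎ ν ≡ mu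

Two-flip : ∀ {s t σ τ n la mu} → Two s t σ τ n la mu → Two s t σ τ n mu la
Two-flip W = record { cla = cmu ; cmu = cla ; sla = smu ; smu = sla ; la≢mu = λ e → la≢mu (sym e) ; only = λ c e → swap⊎ (only c e) }
  where
  open Two W
  swap⊎ : ∀ {A B : Set} → A ⊎ B → B ⊎ A
  swap⊎ (inj₁ x) = inj₂ x
  swap⊎ (inj₂ x) = inj₁ x

Two-swap : ∀ {s t σ τ n la mu} → Two s t σ τ n la mu → Two t s τ σ n la mu
Two-swap W = record { cla = sw cla ; cmu = sw cmu ; sla = sla ; smu = smu ; la≢mu = la≢mu ; only = λ c e → only (sw c) e }
  where
  open Two W
  sw : ∀ {s t σ τ ν} → Common s t σ τ ν → Common t s τ σ ν
  sw (P , u , v) = P , v , u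

Transfer-sym : ∀ {s t σ τ σ′ τ′} → Transfer s t σ τ σ′ τ′ → Transfer s t σ′ τ′ σ τ
Transfer-sym {s} {t} {σ} {τ} {σ′} {τ′} T = record
  { f = g ; g = f ; f∘g = g∘f ; g∘f = f∘g ; fwd = bwd ; bwd = fwd ; sizes = sz }
  where
  open Transfer T
  sz : ∀ {ν ν′} → Common s t σ′ τ′ ν → Ptn ν′ → (bead ν′ ≗ λ z → bead ν (g z)) →
            + size ν + (+ size σ + + size τ) ≡ + size ν′ + (+ size σ′ + + size τ′)
  sz {ν} {ν′} c Q e with bwd c
  ... | ν″ , c″ , e″ with bead-injective Q (proj₁ c″) (λ z → trans (e z) (sym (e″ z)))
  ... | refl = sym (sizes c″ (proj₁ c) (λ z → trans (cong (bead ν) (sym (g∘f z))) (sym (e (f z)))))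

Two-transfer : ∀ {s t σ τ σ′ τ′ n la mu} (T : Transfer s t σ τ σ′ τ′) → Two s t σ τ n la mu →
  Σ (List ℕ) λ la′ → Σ (List ℕ) λ mu′ → Σ ℕ λ n′ → Two s t σ′ τ′ n′ la′ mu′
    × (+ n + (+ size σ′ + + size τ′) ≡ + n′ + (+ size σ + + size τ))
    × (bead la′ ≗ λ z → bead la (Transfer.f T z)) × (bead mu′ ≗ λ z → bead mu (Transfer.f T z))
Two-transfer {s} {t} {σ} {τ} {σ′} {τ′} {n} {la} {mu} T W with Transfer.fwd T (Two.cla W) | Transfer.fwd T (Two.cmu W)
... | la′ , cl , el | mu′ , cm , em = la′ , mu′ , size la′ , record
    { cla = cl ; cmu = cm ; sla = refl
    ; smu = ℤₚ.+-injective (+-cancelʳ-≡ S (+ size mu′) (+ size la′) (trans (sym eqm) eql))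
    ; la≢mu = λ { refl → la≢mu (bead-injective (proj₁ cla) (proj₁ cmu) λ z →
        trans (cong (bead la) (sym (f∘g z))) (trans (sym (el (g z))) (trans (em (g z)) (cong (bead mu) (f∘g z))))) }
    ; only = only′ } , eql , el , em
  where
  open Transfer T
  open Two W
  S = + size σ + + size τ
  eql : + n + (+ size σ′ + + size τ′) ≡ + size la′ + S
  eql = trans (cong (λ k → + k + (+ size σ′ + + size τ′)) (sym sla)) (sizes cla (proj₁ cl) el)
  eqm : + n + (+ size σ′ + + size τ′) ≡ + size mu′ + S
  eqm = trans (cong (λ k → + k + (+ size σ′ + + size τ′)) (sym smu)) (sizes cmu (proj₁ cm) em)
  only′ : ∀ {ν} → Common s t σ′ τ′ ν → size ν ≡ size la′ → ν ≡ la′ ⊎ ν ≡ mu′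
  only′ {ν} c e with bwd c
  ... | ν₀ , c₀ , e₀ = pick (only c₀ size₀)
    where
    back : bead ν ≗ λ z → bead ν₀ (f z)
    back z = trans (cong (bead ν) (sym (g∘f z))) (sym (e₀ (f z)))
    size₀ : size ν₀ ≡ n
    size₀ = ℤₚ.+-injective (+-cancelʳ-≡ (+ size σ′ + + size τ′) (+ size ν₀) (+ n)
      (trans (sizes c₀ (proj₁ c) back) (trans (cong (λ k → + k + S) e) (sym eql))))
    pick : ν₀ ≡ la ⊎ ν₀ ≡ mu → ν ≡ la′ ⊎ ν ≡ mu′
    pick (inj₁ refl) = inj₁ (bead-injective (proj₁ c) (proj₁ cl) λ z → trans (back z) (sym (el z)))
    pick (inj₂ refl) = inj₂ (bead-injective (proj₁ c) (proj₁ cm) λ z → trans (back z) (sym (em z)))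

Diff₂-pull : ∀ {a b c d L M L′ M′} (f g : ℤ → ℤ) → (∀ z → f (g z) ≡ z) → (∀ z → g (f z) ≡ z) →
  (L′ ≗ λ z → L (f z)) → (M′ ≗ λ z → M (f z)) → Diff₂ a b c d L M → Diff₂ (g a) (g b) (g c) (g d) L′ M′
Diff₂-pull {L = L} {M} f g fg gf el em D = record
  { La = at L el La ; Lb = at L el Lb ; Lc = at L el Lc ; Ld = at L el Ld
  ; Ma = at M em Ma ; Mb = at M em Mb ; Mc = at M em Mc ; Md = at M em Md
  ; a≢b = λ e → a≢b (inj e) ; c≢d = λ e → c≢d (inj e)
  ; rest = λ z p q r s → trans (el z) (trans (rest (f z) (λ e → p (un z e)) (λ e → q (un z e)) (λ e → r (un z e)) (λ e → s (un z e))) (sym (em z))) }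
  where
  open Diff₂ D
  at : ∀ N {N′ : ℤ → Bool} {x β} → (N′ ≗ λ z → N (f z)) → N x ≡ β → N′ (g x) ≡ β
  at N {x = x} e h = trans (e (g x)) (trans (cong N (fg x)) h)
  inj : ∀ {x y} → g x ≡ g y → x ≡ y
  inj {x} {y} e = trans (sym (fg x)) (trans (cong f e) (fg y))
  un : ∀ z {x} → f z ≡ x → z ≡ g x
  un z e = trans (sym (gf z)) (cong g e)

-- Minimality

top-bead : ∀ {la} D z₀ → Ptn la → Σ ℤ λ i → bead la (z₀ + i * + suc D) ≡ true × bead la (z₀ + i * + suc D + + suc D) ≡ false
top-bead {la} D z₀ P with far D z₀ P
... | M , h with first-fail (λ k → bead la (z₀ + (+ k - + M) * + suc D) ≟ᵇ true) (M ℕ.+ M)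
                 (λ e → bool-clash e (trans (cong (λ w → bead la (z₀ + w * + suc D)) (e₁ (+ M))) (proj₁ (h M ℕₚ.≤-refl))))
  where e₁ : ∀ M → M + M - M ≡ M
        e₁ = solve-∀
... | zero , ¬u , _ = ⊥-elim (¬u (trans (cong (λ w → bead la (z₀ + w * + suc D)) (ℤₚ.+-identityˡ (- (+ M)))) (proj₂ (h M ℕₚ.≤-refl))))
... | suc u , ¬u , below = + u - + M , below u ℕₚ.≤-refl , trans (cong (bead la) (e₁ z₀ (+ u) (+ M) (+ suc D))) (¬true ¬u)
  where
  e₁ : ∀ z u M D → z + (u - M) * D + D ≡ z + (1ℤ + u - M) * D
  e₁ = solve-∀
  ¬true : ∀ {b} → b ≢ true → b ≡ false
  ¬true {true} h = ⊥-elim (h refl)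
  ¬true {false} _ = refl

Cong-small : ∀ {D c} → 0 < c → Cong (+ D) (+ c) 0ℤ → D ≤ c
Cong-small {D} {c} 0<c (cgr k e) = ∣⇒≤ {{ℕ.>-nonZero 0<c}} (divides ℤ.∣ k ∣
  (trans (cong ℤ.∣_∣ (trans e (ℤₚ.+-identityˡ (k * + D)))) (ℤₚ.abs-* k (+ D))))

Cong-difference : ∀ {d x y} → Cong d x y → Cong d (x - y) 0ℤ
Cong-difference {d} {y = y} (cgr k refl) = cgr k (e y (k * d))
  where e : ∀ y z → y + z - y ≡ 0ℤ + z
        e = solve-∀

module Minimal (s t : ℕ) (1<s : 1 < s) (1<t : 1 < t) (s≢t : s ≢ t) where

  -- D is a common multiple of s and t; moving up by D the topmost beads of
  -- three residue classes modulo D would give three distinct partitions.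
  minimal : ∀ {σ τ n la mu ν} → Two (+ s) (+ t) σ τ n la mu → Common (+ s) (+ t) σ τ ν → ¬ (size ν < n)
  minimal {σ} {τ} {n} {la} {mu} {ν} W cν ν<n with ℕₚ.m≤n⇒∃[o]m+o≡n ν<n
  ... | D′ , eqn = pigeonhole (raise 0) (raise 1) (raise 2)
    where
    open Two W
    P = proj₁ cν
    D = suc D′
    n≡ : + n ≡ + size ν + + D
    n≡ = cong +_ (trans (sym eqn) (sym (ℕₚ.+-suc (size ν) D′)))
    multiple : ∀ {d} → Cong d (+ size la) (+ size ν) → Cong d (+ D) 0ℤ
    multiple {d} c = subst (λ z → Cong d z 0ℤ) (trans (cong (λ z → z - + size ν) (trans (cong +_ sla) n≡)) (e (+ size ν) (+ D)))
                       (Cong-difference c)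
      where e : ∀ v D → v + D - v ≡ D
            e = solve-∀
    s∣D : Cong (+ s) (+ D) 0ℤ
    s∣D = multiple (Cong-trans (Eqv-size (proj₁ cla) (proj₁ (proj₂ cla))) (Cong-sym (Eqv-size P (proj₁ (proj₂ cν)))))
    t∣D : Cong (+ t) (+ D) 0ℤ
    t∣D = multiple (Cong-trans (Eqv-size (proj₁ cla) (proj₂ (proj₂ cla))) (Cong-sym (Eqv-size P (proj₂ (proj₂ cν)))))
    -- Of two distinct numbers greater than 1 one is at least 3, and both divide `D`.
    3≤D : 3 ≤ D
    3≤D with ℕₚ.m≤n⇒m<n∨m≡n 1<s
    ... | inj₁ 2<s = ℕₚ.≤-trans 2<s (Cong-small (s≤s z≤n) s∣D)
    ... | inj₂ refl with ℕₚ.m≤n⇒m<n∨m≡n 1<t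
    ...   | inj₁ 2<t = ℕₚ.≤-trans 2<t (Cong-small (s≤s z≤n) t∣D)
    ...   | inj₂ refl = ⊥-elim (s≢t refl)
    back : ∀ {d} x → Cong d (+ D) 0ℤ → Cong d (x + + D) x
    back {d} x (cgr k e) = cgr k (trans (cong (_+_ x) e) (cong (_+_ x) (ℤₚ.+-identityˡ (k * d))))
    record Raised (a : ℕ) : Set where
      field
        i    : ℤ
        ν′   : List ℕ
        mv′  : Mv (+ a + i * + D) (+ a + i * + D + + D) (bead ν) (bead ν′)
        pick : ν′ ≡ la ⊎ ν′ ≡ mu
    raise : ∀ a → Raised a
    raise a = build (top-bead D′ (+ a) P)
      where
      build : (Σ ℤ λ i → bead ν (+ a + i * + D) ≡ true × bead ν (+ a + i * + D + + D) ≡ false) → Raised a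
      build (i , bt , bf) = finish (move P bt bf)
        where
        x = + a + i * + D
        e : ∀ v x D → v + (x + D) ≡ v + D + x
        e = solve-∀
        finish : Moved ν x (x + + D) → Raised a
        finish (ν′ , Q , sz , m) = record { i = i ; ν′ = ν′ ; mv′ = m ; pick =
          only (Q , Eqv-trans (Eqv-one P (back x s∣D) (Mv-sym m)) (proj₁ (proj₂ cν))
                  , Eqv-trans (Eqv-one P (back x t∣D) (Mv-sym m)) (proj₂ (proj₂ cν)))
               (ℤₚ.+-injective (+-cancelʳ-≡ x (+ size ν′) (+ n) (trans (sym sz) (trans (e (+ size ν) x (+ D)) (cong (_+ x) (sym n≡)))))) }
    -- The bead of `ν` missing from the result tells which bead was raised. Equal results would make
    -- a and a + c congruent modulo `D`, although 0 < c < 3 ≤ D.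
    distinct : ∀ a c → 0 < c → c < 3 → (R : Raised a) (R′ : Raised (a ℕ.+ c)) → Raised.ν′ R ≢ Raised.ν′ R′
    distinct a c 0<c c<3 R R′ eq = ℕₚ.<⇒≱ (ℕₚ.<-≤-trans c<3 3≤D) (Cong-small 0<c (cgr (j - i) c≡))
      where
      open Raised R renaming (mv′ to m₁; i to j)
      open Raised R′ using (i) renaming (mv′ to m₂)
      same : + a + j * + D ≡ + (a ℕ.+ c) + i * + D
      same with eq? (+ a + j * + D) (+ (a ℕ.+ c) + i * + D)
      ... | yes e = e
      ... | no ne = ⊥-elim (bool-clash (trans (sym (Mv.rest m₂ (+ a + j * + D) ne (bead-≢ {bead ν} (Mv.ax m₁) (Mv.ay m₂)))) (Mv.ax m₁))
                       (trans (cong (λ l → bead l (+ a + j * + D)) (sym eq)) (Mv.bx m₁)))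
      e₁ : ∀ a c j D → c ≡ a + c + j * D - (a + j * D)
      e₁ = solve-∀
      e₂ : ∀ a i j D → a + i * D - (a + j * D) ≡ 0ℤ + (i - j) * D
      e₂ = solve-∀
      c≡ : + c ≡ 0ℤ + (j - i) * + D
      c≡ = trans (e₁ (+ a) (+ c) i (+ D)) (trans (cong (λ z → z - (+ a + i * + D)) (sym same)) (e₂ (+ a) j i (+ D)))
    pigeonhole : Raised 0 → Raised 1 → Raised 2 → ⊥
    pigeonhole R₀ R₁ R₂ = cases (Raised.pick R₀) (Raised.pick R₁) (Raised.pick R₂)
      where
      d₀₁ = distinct 0 1 (s≤s z≤n) (s≤s (s≤s z≤n)) R₀ R₁
      d₁₂ = distinct 1 1 (s≤s z≤n) (s≤s (s≤s z≤n)) R₁ R₂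
      d₀₂ = distinct 0 2 (s≤s z≤n) (s≤s (s≤s (s≤s z≤n))) R₀ R₂
      cases : Raised.ν′ R₀ ≡ la ⊎ Raised.ν′ R₀ ≡ mu → Raised.ν′ R₁ ≡ la ⊎ Raised.ν′ R₁ ≡ mu → Raised.ν′ R₂ ≡ la ⊎ Raised.ν′ R₂ ≡ mu → ⊥
      cases (inj₁ p) (inj₁ q) _ = d₀₁ (trans p (sym q))
      cases (inj₂ p) (inj₂ q) _ = d₀₁ (trans p (sym q))
      cases (inj₁ p) (inj₂ q) (inj₁ r) = d₀₂ (trans p (sym r))
      cases (inj₁ p) (inj₂ q) (inj₂ r) = d₁₂ (trans q (sym r))
      cases (inj₂ p) (inj₁ q) (inj₁ r) = d₁₂ (trans q (sym r))
      cases (inj₂ p) (inj₁ q) (inj₂ r) = d₀₂ (trans p (sym r))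

-- The size fixes the weight: an excess of s over the core means that exactly one hook is removed.
hook-over : ∀ {s κ ν} → 0 < s → Ptn ν → Ptn κ → Closed (+ s) (bead κ) → Eqv (+ s) ν κ → size ν ≡ size κ ℕ.+ s →
  Σ ℤ λ x → Mv x (x + + s) (bead κ) (bead ν)
hook-over {s} {κ} {ν} 0<s P Q C w sz = unique-step (Eqv⇒HasCore 0<s P (closed⇒core Q C) w)
  where
  unique-step : HasCore s ν κ → Σ ℤ λ x → Mv x (x + + s) (bead κ) (bead ν)
  unique-step (0 , done , _) = ⊥-elim (ℕₚ.<⇒≢ (ℕₚ.m<m+n (size κ) 0<s) sz)
  unique-step (1 , step H done , _) = proj₁ (hook⇒Mv H) , Mv-sym (proj₂ (hook⇒Mv H))
  unique-step (suc (suc k) , r , _) = ⊥-elim (ℕₚ.<⇒≢ (ℕₚ.m<m+n s (ℕₚ.≤-trans 0<s (ℕₚ.m≤m+n s (k ℕ.* s))))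
    (ℕₚ.+-cancelˡ-≡ (size κ) _ _ (trans (sym sz) (Reach-size r))))

Mv-source : ∀ {x y a b z} → Mv x y a b → a z ≡ true → b z ≡ false → z ≡ x
Mv-source {x} {y} {z = z} m az bz with eq? z x | eq? z y
... | yes e | _ = e
... | no _ | yes refl = ⊥-elim (bool-clash az (Mv.ay m))
... | no p | no q = ⊥-elim (bool-clash az (trans (Mv.rest m z p q) bz))

-- The case of two simultaneous cores

module Reduced (s t : ℕ) (1<s : 1 < s) (1<t : 1 < t) (s≢t : s ≢ t) {κ ρ : List ℕ}
  (Pκ : Ptn κ) (Pρ : Ptn ρ) (κs : Closed (+ s) (bead κ)) (κt : Closed (+ t) (bead κ))
  (ρs : Closed (+ s) (bead ρ)) (ρt : Closed (+ t) (bead ρ)) where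

  open Minimal s t 1<s 1<t s≢t

  private
    0<s : 0 < s
    0<s = ℕₚ.<-trans (s≤s z≤n) 1<s
    0<t : 0 < t
    0<t = ℕₚ.<-trans (s≤s z≤n) 1<t

  -- Every s-inversion (x, δ) of la yields a parallelogram x, y-δ ∈ la, x-δ, y ∉ la
  -- whose flip is the other partition mu, so there is only one inversion and
  -- undoing it leaves an s-closed bead set.
  module _ {n la mu} (W : Two (+ s) (+ t) κ ρ n la mu) where
    open Two W
    private
      P = proj₁ cla

      -- Moving this bead down would keep both cores and decrease the size, against minimality.
      no-descent : ∀ {x y} → bead la x ≡ true → bead la y ≡ false → y + 1ℤ ℤ.≤ x → Cong (+ s) x y → Cong (+ t) x y → ⊥
      no-descent {x} {y} bx by y<x cs ct = finish (move P bx by)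
        where
        finish : Moved la x y → ⊥
        finish (nu , Q , sz , m) = minimal W (Q , Eqv-trans (Eqv-one P (Cong-sym cs) (Mv-sym m)) (proj₁ (proj₂ cla))
                                                 , Eqv-trans (Eqv-one P (Cong-sym ct) (Mv-sym m)) (proj₂ (proj₂ cla)))
          (subst (size nu <_) sla (ℤₚ.drop‿+≤+ (≤-by _ (gap y<x) (e (+ size la) (+ size nu) x y sz))))
          where
          e : ∀ a b u v → a + v ≡ b + u → a ≡ 1ℤ + b + (u - (v + 1ℤ))
          e a b u v h = trans (e₁ a v) (trans (cong (_- v) h) (e₂ b u v))
            where
            e₁ : ∀ a v → a ≡ a + v - v
            e₁ = solve-∀
            e₂ : ∀ b u v → b + u - v ≡ 1ℤ + b + (u - (v + 1ℤ))
            e₂ = solve-∀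

      -- The inversion (x, δ) with δ = (1 + j) s.
      Inversion : ℤ → ℕ → Set
      Inversion x j = bead la x ≡ true × bead la (x - + suc j * + s) ≡ false

      δ-Cong : ∀ x j → Cong (+ s) x (x - + suc j * + s)
      δ-Cong x j = cgr (+ suc j) (e x (+ suc j * + s))
        where e : ∀ x z → x ≡ x - z + z
              e = solve-∀

      1≤δ : ∀ j → 1ℤ ℤ.≤ + suc j * + s
      1≤δ j = subst (1ℤ ℤ.≤_) (ℤₚ.pos-* (suc j) s) (ℤ.+≤+ (ℕₚ.≤-trans 0<s (ℕₚ.m≤m+n s (j ℕ.* s))))

      x-δ<x : ∀ x j → x - + suc j * + s + 1ℤ ℤ.≤ x
      x-δ<x x j = ≤-by _ (gap (1≤δ j)) (e x (+ suc j * + s))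
        where e : ∀ x δ → x ≡ x - δ + 1ℤ + (δ - 1ℤ)
              e = solve-∀

      Flip : ℤ → ℕ → Set
      Flip x j = Σ ℤ λ y → Cong (+ t) y x × Diff₂ x (y - + suc j * + s) (x - + suc j * + s) y (bead la) (bead mu)

      flip : ∀ {x j} → Inversion x j → Flip x j
      flip {x} {j} (bx , bδ) = build (complementary-bead {{ℕ.>-nonZero 0<t}} (proj₂ (proj₂ cla)) (Closed-multiple ρs (suc j)) bx bδ)
        where
        δ = + suc j * + s
        build : (Σ ℤ λ y → Cong (+ t) y x × bead la y ≡ false × bead la (y - δ) ≡ true) → Flip x j
        build (y , c , by , byδ) = finish (move₂ P bx byδ bδ by x≢y-δ x-δ≢y)
          where
          -- A degenerate parallelogram would make x and x - δ congruent modulo t as well as modulo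
          -- s, so the bead at x could descend to x - δ.
          x≢y-δ : x ≢ y - δ
          x≢y-δ eq = no-descent bx bδ (x-δ<x x j) (δ-Cong x j) (degenerate c)
            where
            degenerate : Cong (+ t) y x → Cong (+ t) x (x - δ)
            degenerate (cgr k e) = cgr k (trans (trans eq (cong (_- δ) e)) (e₂ x (k * + t) δ))
              where e₂ : ∀ x z δ → x + z - δ ≡ x - δ + z
                    e₂ = solve-∀
          x-δ≢y : x - δ ≢ y
          x-δ≢y eq = no-descent bx bδ (x-δ<x x j) (δ-Cong x j) (Cong-sym (subst (λ z → Cong (+ t) z x) (sym eq) c))
          finish : (Σ (List ℕ) λ nu → Ptn nu × Diff₂ x (y - δ) (x - δ) y (bead la) (bead nu)) → Flip x j
          finish (nu , Q , D) = y , c , subst (λ l → Diff₂ x (y - δ) (x - δ) y (bead la) (bead l)) nu≡mu D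
            where
            -- Modulo s the flip moves x to x - δ and y - δ to y; modulo t it moves x to y and y - δ
            -- to x - δ. The displacements cancel, so the size is kept.
            cs : Eqv (+ s) la nu
            cs = Diff₂-Eqv P Q D (δ-Cong x j) (Cong-sym (δ-Cong y j))
            low : Cong (+ t) (y - δ) (x - δ)
            low = shift c
              where
              e₂ : ∀ x z δ → x + z - δ ≡ x - δ + z
              e₂ = solve-∀
              shift : Cong (+ t) y x → Cong (+ t) (y - δ) (x - δ)
              shift (cgr k e) = cgr k (trans (cong (_- δ) e) (e₂ x (k * + t) δ))
            cᵗ : Eqv (+ t) la nu
            cᵗ = Diff₂-Eqv P Q (Diff₂-swap D) (Cong-sym c) low
            sz : size nu ≡ n
            sz = trans (ℤₚ.+-injective (+-cancelʳ-≡ (x + (y - δ)) (+ size nu) (+ size la)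
                   (trans (sym (Diff₂-size P Q D)) (cong (_+_ (+ size la)) (e₃ x y δ))))) sla
              where e₃ : ∀ x y δ → x - δ + y ≡ x + (y - δ)
                    e₃ = solve-∀
            nu≡mu : nu ≡ mu
            nu≡mu = choose (only (Q , Eqv-trans (Eqv-sym P cs) (proj₁ (proj₂ cla)) , Eqv-trans (Eqv-sym P cᵗ) (proj₂ (proj₂ cla))) sz)
              where
              choose : nu ≡ la ⊎ nu ≡ mu → nu ≡ mu
              choose (inj₂ e) = e
              choose (inj₁ e) = ⊥-elim (bool-clash (Diff₂.La D) (trans (cong (λ l → bead l x) (sym e)) (Diff₂.Ma D)))

      -- Both flips lead to the same `mu`, so x′ is one of the lost beads x, y - δ and x′ - δ′ one
      -- of the gained beads x - δ, y. Matching x′ with x and x′ - δ′ with x - δ is the claim; two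
      -- other matchings allow a descent, and the last gives δ + δ′ = 0.
      inversion-unique : ∀ {x j x′ j′} → Flip x j → Flip x′ j′ → x′ ≡ x × + suc j′ * + s ≡ + suc j * + s
      inversion-unique {x} {j} {x′} {j′} (y , c , D) (y′ , c′ , D′)
        = cases (Diff₂-source D (Diff₂.La D′) (Diff₂.Ma D′)) (Diff₂-target D (Diff₂.Lc D′) (Diff₂.Mc D′))
        where
        open Diff₂ D
        δ = + suc j * + s
        δ′ = + suc j′ * + s
        cases : x′ ≡ x ⊎ x′ ≡ y - δ → x′ - δ′ ≡ x - δ ⊎ x′ - δ′ ≡ y → x′ ≡ x × δ′ ≡ δ
        cases (inj₁ refl) (inj₁ q) = refl , trans (e x δ′) (trans (cong (λ z → x - z) q) (sym (e x δ)))
          where e : ∀ x δ → δ ≡ x - (x - δ)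
                e = solve-∀
        cases (inj₁ refl) (inj₂ q) = ⊥-elim (no-descent La Ld (subst (λ z → z + 1ℤ ℤ.≤ x) q (x-δ<x x j′))
                                        (subst (Cong (+ s) x) q (δ-Cong x j′)) (Cong-sym c))
        cases (inj₂ p) (inj₁ q) = ⊥-elim (no-descent Lb Lc
              (subst₂ (λ u v → u + 1ℤ ℤ.≤ v) q p (x-δ<x x′ j′))
              (subst₂ (λ u v → Cong (+ s) v u) q p (δ-Cong x′ j′)) (shift c))
          where
          e₂ : ∀ x z δ → x + z - δ ≡ x - δ + z
          e₂ = solve-∀
          shift : Cong (+ t) y x → Cong (+ t) (y - δ) (x - δ)
          shift (cgr k e) = cgr k (trans (cong (_- δ) e) (e₂ x (k * + t) δ))
        cases (inj₂ p) (inj₂ q) = ⊥-elim (neg-impossible (gap (1≤δ j) ⊕ gap (1≤δ j′) ⊕ 0≤+ 1)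
              (trans (e₁ y δ δ′) (trans (cong (λ z → y - (z - δ′) - 1ℤ) (sym p)) (trans (cong (λ z → y - z - 1ℤ) q) (e₂ y)))))
          where
          e₁ : ∀ y δ δ′ → δ - 1ℤ + (δ′ - 1ℤ) + 1ℤ ≡ y - (y - δ - δ′) - 1ℤ
          e₁ = solve-∀
          e₂ : ∀ y → y - y - 1ℤ ≡ - 1ℤ
          e₂ = solve-∀

    single-hook : ∀ {x} → bead la x ≡ true → bead la (x - + s) ≡ false → size la ≡ size κ ℕ.+ s
    single-hook {x} bx bs = finish (move P bx bs)
      where
      1δ : ∀ x s → x - s ≡ x - 1ℤ * s
      1δ = solve-∀
      2δ : ∀ x s → x - s - s ≡ x - + 2 * s
      2δ = solve-∀
      inv : Inversion x 0
      inv = bx , trans (cong (bead la) (sym (1δ x (+ s)))) bs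
      2s≢s : + 2 * + s ≢ 1ℤ * + s
      2s≢s e with ℤₚ.*-cancelʳ-≡ (+ 2) 1ℤ (+ s) {{ℕ.>-nonZero 0<s}} e
      ... | ()
      finish : Moved la x (x - + s) → size la ≡ size κ ℕ.+ s
      finish (nu , Q , sz , m) = ℤₚ.+-injective (+-cancelʳ-≡ (x - + s) (+ size la) (+ size κ + + s)
          (trans sz (trans (cong (λ l → + size l + x) nu≡κ) (e (+ size κ) x (+ s)))))
        where
        e : ∀ k x s → k + x ≡ k + s + (x - s)
        e = solve-∀
        closed : Closed (+ s) (bead nu)
        closed u bu with bead nu (u - + s) in bu-s
        ... | true = refl
        -- If `nu` were not s-closed at u, `la` would have a second inversion: (x , 2s) if u = x -
        -- s, (u , 2s) if u - s = x, and (u , s) otherwise. This is why inversions are considered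
        -- for multiples of s.
        ... | false with eq? u (x - + s)
        ...   | yes refl = ⊥-elim (2s≢s (proj₂ (inversion-unique {j = 0} {j′ = 1} (flip {x} {0} inv)
                  (flip {x} {1} (bx , trans (cong (bead la) (sym (2δ x (+ s)))) (trans (Mv.rest m (x - + s - + s)
                     (λ e → x-2s≢x e) (λ e → x-2s≢x-s e)) bu-s))))))
          where
          x-2s≢x : x - + s - + s ≢ x
          x-2s≢x e = neg-impossible (gap (ℤ.+≤+ 0<s) ⊕ gap (ℤ.+≤+ 0<s) ⊕ 0≤+ 1) (trans (e₁ x (+ s)) (trans (cong (λ z → x - z - 1ℤ) e) (e₂ x)))
            where e₁ : ∀ x s → s - 1ℤ + (s - 1ℤ) + 1ℤ ≡ x - (x - s - s) - 1ℤ
                  e₁ = solve-∀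
                  e₂ : ∀ x → x - x - 1ℤ ≡ - 1ℤ
                  e₂ = solve-∀
          x-2s≢x-s : x - + s - + s ≢ x - + s
          x-2s≢x-s e = neg-impossible (gap (ℤ.+≤+ 0<s)) (trans (e₁ (x - + s) (+ s)) (trans (cong (λ z → (x - + s) - z - 1ℤ) e) (e₂ (x - + s))))
            where e₁ : ∀ x s → s - 1ℤ ≡ x - (x - s) - 1ℤ
                  e₁ = solve-∀
                  e₂ : ∀ x → x - x - 1ℤ ≡ - 1ℤ
                  e₂ = solve-∀
        closed u bu | false | no u≢x-s with eq? (u - + s) x
        ...     | yes e = ⊥-elim (2s≢s (proj₂ (inversion-unique {j = 0} {j′ = 1} (flip {x} {0} inv)
                    (flip {u} {1} (bu′ , trans (cong (bead la) (trans (sym (2δ u (+ s))) (cong (_- + s) e))) bs)))))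
          where bu′ : bead la u ≡ true
                bu′ = trans (Mv.rest m u (bead-≢ {bead nu} bu (Mv.bx m)) u≢x-s) bu
        ...     | no u-s≢x = ⊥-elim (u≢x (proj₁ (inversion-unique {j = 0} {j′ = 0} (flip {x} {0} inv)
                    (flip {u} {0} (bu′ , trans (cong (bead la) (sym (1δ u (+ s))))
                       (trans (Mv.rest m (u - + s) u-s≢x (λ e → u≢x (+-cancelʳ-≡ (- (+ s)) u x e))) bu-s))))))
          where u≢x : u ≢ x
                u≢x = bead-≢ {bead nu} bu (Mv.bx m)
                bu′ : bead la u ≡ true
                bu′ = trans (Mv.rest m u u≢x u≢x-s) bu
        nu≡κ : nu ≡ κ
        nu≡κ = closed-unique {{ℕ.>-nonZero 0<s}} Q Pκ closed κs
          (Eqv-trans (Eqv-one P (cgr (- 1ℤ) (e₃ x (+ s))) (Mv-sym m)) (proj₁ (proj₂ cla)))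
          where e₃ : ∀ x s → x - s ≡ x + - 1ℤ * s
                e₃ = solve-∀

  -- An s-closed partition with these cores equals κ, so at least one of two distinct ones has an
  -- inversion by s.
  two-size : ∀ {n la mu} → Two (+ s) (+ t) κ ρ n la mu → n ≡ size κ ℕ.+ s
  two-size {n} {la} {mu} W with closed-or-not s (proj₁ (Two.cla W)) | closed-or-not s (proj₁ (Two.cmu W))
  ... | inj₂ (x , bx , bs) | _ = trans (sym (Two.sla W)) (single-hook W {x} bx bs)
  ... | inj₁ _ | inj₂ (x , bx , bs) = trans (sym (Two.smu W)) (single-hook (Two-flip W) {x} bx bs)
  ... | inj₁ C | inj₁ D = ⊥-elim (Two.la≢mu W (trans (to-κ (Two.cla W) C) (sym (to-κ (Two.cmu W) D))))
    where
    to-κ : ∀ {ν} → Common (+ s) (+ t) κ ρ ν → Closed (+ s) (bead ν) → ν ≡ κ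
    to-κ (Q , u , _) C = closed-unique {{ℕ.>-nonZero 0<s}} Q Pκ C κs u

  -- If the two moves shared neither source nor target, κ would agree with ρ at y and with ν at y +
  -- t in such a way that it contains y + t but not y.
  compare-moves : ∀ {x y ν} → Mv x (x + + s) (bead κ) (bead ν) → Mv y (y + + t) (bead ρ) (bead ν) →
    (x ≡ y × Mv (x + + t) (x + + s) (bead κ) (bead ρ)) ⊎ (x + + s ≡ y + + t × Mv x y (bead κ) (bead ρ))
  compare-moves {x} {y} {ν} m n with eq? x y | eq? (x + + s) (y + + t)
  ... | yes refl | _ = inj₁ (refl , Mv-refill (λ e → s≢t (sym (ℤₚ.+-injective (+-cancelˡ-≡ x (+ t) (+ s) e)))) m (Mv-sym n))
  ... | no x≢y | yes e = inj₂ (e , Mv-onward x≢y m (subst (λ z → Mv z y (bead ν) (bead ρ)) (sym e) (Mv-sym n)))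
  ... | no x≢y | no ne = ⊥-elim (bool-clash (trans (cong (bead κ) (sym (e₁ y (+ t)))) (κt (y + + t) κ∋y+t)) κ∌y)
    where
    e₁ : ∀ y t → y + t - t ≡ y
    e₁ = solve-∀
    κ∋y+t : bead κ (y + + t) ≡ true
    κ∋y+t with eq? (y + + t) x
    ... | yes refl = Mv.ax m
    ... | no u = trans (Mv.rest m (y + + t) u (λ e → ne (sym e))) (Mv.by n)
    κ∌y : bead κ y ≡ false
    κ∌y with eq? y (x + + s)
    ... | yes refl = Mv.ay m
    ... | no u = trans (Mv.rest m y (λ e → x≢y (sym e)) u) (Mv.bx n)

  -- The two ways in which a partition can lie one s-hook above κ and one t-hook above ρ.
  data Link (ν : List ℕ) : Set where
    link₁ : ∀ x → Mv x (x + + s) (bead κ) (bead ν) → Mv (x + + t) (x + + s) (bead κ) (bead ρ) → Link ν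
    link₂ : ∀ x y → x + + s ≡ y + + t → Mv x (x + + s) (bead κ) (bead ν) → Mv x y (bead κ) (bead ρ) → Link ν

  link : ∀ {ν} → Common (+ s) (+ t) κ ρ ν → size ν ≡ size κ ℕ.+ s → size ν ≡ size ρ ℕ.+ t → Link ν
  link {ν} (P , u , v) es et = build (hook-over 0<s P Pκ κs u es) (hook-over 0<t P Pρ ρt v et)
    where
    build : (Σ ℤ λ x → Mv x (x + + s) (bead κ) (bead ν)) → (Σ ℤ λ y → Mv y (y + + t) (bead ρ) (bead ν)) → Link ν
    build (x , m) (y , n) = sort (compare-moves {ν = ν} m n)
      where
      sort : (x ≡ y × Mv (x + + t) (x + + s) (bead κ) (bead ρ)) ⊎ (x + + s ≡ y + + t × Mv x y (bead κ) (bead ρ)) → Link ν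
      sort (inj₁ (_ , k)) = link₁ x m k
      sort (inj₂ (e , k)) = link₂ x y e m k

  link⇒Mv : ∀ {ν} → Link ν → Σ ℤ λ z → Σ ℤ λ z′ → Mv z z′ (bead κ) (bead ρ)
  link⇒Mv (link₁ x _ k) = x + + t , x + + s , k
  link⇒Mv (link₂ x y _ _ k) = x , y , k

  module _ {z z′} (k : Mv z z′ (bead κ) (bead ρ)) (sizes : size κ ℕ.+ s ≡ size ρ ℕ.+ t) where
    private
      -- The displacement z′ - z equals |ρ| - |κ|, which `sizes` makes equal to s - t.
      z′+t : z′ + + t ≡ z + + s
      z′+t = +-cancelˡ-≡ (+ size κ + + size ρ) _ _ (trans (e₁ (+ size κ) (+ size ρ) z′ (+ t))
          (trans (cong₂ _+_ (Mv-size Pκ Pρ k) (cong +_ (sym sizes))) (e₂ (+ size κ) (+ size ρ) z (+ s))))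
        where
        e₁ : ∀ κ ρ z t → κ + ρ + (z + t) ≡ κ + z + (ρ + t)
        e₁ = solve-∀
        e₂ : ∀ κ ρ z s → ρ + z + (κ + s) ≡ κ + ρ + (z + s)
        e₂ = solve-∀
      z′≡ : z - + t + + s ≡ z′
      z′≡ = trans (e₁ z (+ t) (+ s)) (trans (cong (_- + t) (sym z′+t)) (e₂ z′ (+ t)))
        where
        e₁ : ∀ z t s → z - t + s ≡ z + s - t
        e₁ = solve-∀
        e₂ : ∀ z t → z + t - t ≡ z
        e₂ = solve-∀
      x+k≢x : ∀ x {k} → 0 < k → x ≢ x + + k
      x+k≢x x {suc k} _ = x+1+k≢x x k
      -- A bead at z + s would force one at z + s - t = z′ by closedness under -t, but κ has none
      -- there.
      κ∌z+s : bead κ (z + + s) ≡ false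
      κ∌z+s with bead κ (z + + s) in b
      ... | false = refl
      ... | true = ⊥-elim (bool-clash (trans (cong (bead κ) (trans (sym (e z′ (+ t))) (cong (_- + t) z′+t))) (κt _ b)) (Mv.ay k))
        where e : ∀ z t → z + t - t ≡ z
              e = solve-∀
      κ∋z-t : bead κ (z - + t) ≡ true
      κ∋z-t = κt z (Mv.ax k)
      z≢z-t : z ≢ z - + t
      z≢z-t e = x+k≢x (z - + t) 0<t (trans (sym e) (sym (x-s+s z (+ t))))

      L₁ : Moved κ z (z + + s)
      L₁ = move Pκ (Mv.ax k) κ∌z+s
      L₂ : Moved κ (z - + t) z′
      L₂ = move Pκ κ∋z-t (Mv.ay k)
      l₁ = proj₁ L₁
      l₂ = proj₁ L₂
      P₁ : Ptn l₁
      P₁ = proj₁ (proj₂ L₁)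
      P₂ : Ptn l₂
      P₂ = proj₁ (proj₂ L₂)
      m₁ : Mv z (z + + s) (bead κ) (bead l₁)
      m₁ = proj₂ (proj₂ (proj₂ L₁))
      m₂ : Mv (z - + t) z′ (bead κ) (bead l₂)
      m₂ = proj₂ (proj₂ (proj₂ L₂))

      step-up : ∀ x d → Cong d (x + d) x
      step-up x d = cgr 1ℤ (e x d)
        where e : ∀ x d → x + d ≡ x + 1ℤ * d
              e = solve-∀

      c₁ : Common (+ s) (+ t) κ ρ l₁
      c₁ = P₁ , Eqv-one Pκ (step-up z (+ s)) (Mv-sym m₁)
         -- `l₁` is also ρ with the bead z′ raised to z′ + t = z + s.
         , Eqv-one Pρ (subst (λ w → Cong (+ t) w z′) z′+t (step-up z′ (+ t)))
             (Mv-sym (Mv-onward (λ e → x+k≢x z′ 0<t (trans e (sym z′+t))) (Mv-sym k) m₁))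

      c₂ : Common (+ s) (+ t) κ ρ l₂
      c₂ = P₂ , Eqv-one Pκ (subst (λ w → Cong (+ s) w (z - + t)) z′≡ (step-up (z - + t) (+ s))) (Mv-sym m₂)
         -- `l₂` is also ρ with the bead z - t raised to z, the position that ρ lacks.
         , Eqv-one Pρ (subst (λ w → Cong (+ t) w (z - + t)) (x-s+s z (+ t)) (step-up (z - + t) (+ t)))
             (Mv-sym (Mv-refill (λ e → z≢z-t (sym e)) (Mv-sym k) m₂))

      s₁ : size l₁ ≡ size κ ℕ.+ s
      s₁ = ℤₚ.+-injective (+-cancelʳ-≡ z (+ size l₁) (+ size κ + + s) (trans (sym (Mv-size Pκ P₁ m₁)) (e (+ size κ) z (+ s))))
        where e : ∀ k z s → k + (z + s) ≡ k + s + z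
              e = solve-∀
      s₂ : size l₂ ≡ size κ ℕ.+ s
      s₂ = ℤₚ.+-injective (+-cancelʳ-≡ (z - + t) (+ size l₂) (+ size κ + + s) (trans (sym (Mv-size Pκ P₂ m₂))
             (trans (cong (_+_ (+ size κ)) (sym z′≡)) (e (+ size κ) (z - + t) (+ s)))))
        where e : ∀ k z s → k + (z + s) ≡ k + s + z
              e = solve-∀

      diff : Diff₂ (z + + s) (z - + t) z z′ (bead l₁) (bead l₂)
      diff = record
        { La = Mv.by m₁
        ; Lb = trans (sym (Mv.rest m₁ (z - + t) (λ e → z≢z-t (sym e)) (bead-≢ {bead κ} κ∋z-t κ∌z+s))) κ∋z-t
        ; Lc = Mv.bx m₁
        ; Ld = trans (sym (Mv.rest m₁ z′ (λ e → Mv-≢ k (sym e)) (λ e → x+k≢x z′ 0<t (trans e (sym z′+t))))) (Mv.ay k)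
        ; Ma = trans (sym (Mv.rest m₂ (z + + s) (λ e → bead-≢ {bead κ} κ∋z-t κ∌z+s (sym e)) (λ e → x+k≢x z′ 0<t (trans (sym e) (sym z′+t))))) κ∌z+s
        ; Mb = Mv.bx m₂
        ; Mc = trans (sym (Mv.rest m₂ z z≢z-t (Mv-≢ k))) (Mv.ax k)
        ; Md = Mv.by m₂
        ; a≢b = λ e → bead-≢ {bead κ} κ∋z-t κ∌z+s (sym e)
        ; c≢d = Mv-≢ k
        ; rest = λ w p q r u → trans (sym (Mv.rest m₁ w r p)) (Mv.rest m₂ w q u) }

      only : ∀ {ν} → Common (+ s) (+ t) κ ρ ν → size ν ≡ size κ ℕ.+ s → ν ≡ l₁ ⊎ ν ≡ l₂
      only {ν} c e = pick (link c e (trans e sizes))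
        where
        pick : Link ν → ν ≡ l₁ ⊎ ν ≡ l₂
        pick (link₁ x m n) = inj₂ (bead-injective (proj₁ c) P₂ (Mv-unique (subst₂ (λ u v → Mv u v (bead κ) (bead ν)) x≡ (trans (cong (_+ + s) x≡) z′≡) m) m₂))
          where
          e₁ : ∀ x t → x ≡ x + t - t
          e₁ = solve-∀
          x≡ : x ≡ z - + t
          x≡ = trans (e₁ x (+ t)) (cong (_- + t) (sym (Mv-source n (Mv.ax k) (Mv.bx k))))
        pick (link₂ x y _ m n) = inj₁ (bead-injective (proj₁ c) P₁ (Mv-unique (subst (λ u → Mv u (u + + s) (bead κ) (bead ν)) (sym (Mv-source n (Mv.ax k) (Mv.bx k))) m) m₁))

    exactly-two : Σ (List ℕ) λ la → Σ (List ℕ) λ mu → Two (+ s) (+ t) κ ρ (size κ ℕ.+ s) la mu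
      × Diff₂ (z + + s) (z - + t) z z′ (bead la) (bead mu)
    exactly-two = l₁ , l₂ , record { cla = c₁ ; cmu = c₂ ; sla = s₁ ; smu = s₂
      ; la≢mu = λ e → bool-clash (Diff₂.La diff) (trans (cong (λ l → bead l (z + + s)) e) (Diff₂.Ma diff)) ; only = only } , diff

-- Arbitrary cores: transfer to κ and ρ and back

coprime⇒∤ : ∀ {s t} → 1 < t → Coprime s t → ¬ Cong (+ t) (+ s) 0ℤ
coprime⇒∤ {s} {t} 1<t cop (cgr k e) = ℕₚ.<⇒≢ 1<t (sym (cop (divides ℤ.∣ k ∣
  (trans (cong ℤ.∣_∣ (trans e (ℤₚ.+-identityˡ (k * + t)))) (ℤₚ.abs-* k (+ t))) , ∣-refl)))

module Main (s′ t′ : ℕ) (1<s : 1 < suc s′) (1<t : 1 < suc t′) (cop : Coprime (suc s′) (suc t′))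
  {σ τ : List ℕ} (Cσ : IsCore (suc s′) σ) (Cτ : IsCore (suc t′) τ) where

  private
    s = suc s′
    t = suc t′
    0<s : 0 < s
    0<s = s≤s z≤n
    0<t : 0 < t
    0<t = s≤s z≤n
    s≢t : s ≢ t
    s≢t refl = ℕₚ.<⇒≢ 1<s (sym (cop (∣-refl , ∣-refl)))
    t∤s : ¬ Cong (+ t) (+ s) 0ℤ
    t∤s = coprime⇒∤ 1<t cop
    s∤t : ¬ Cong (+ s) (+ t) 0ℤ
    s∤t = coprime⇒∤ 1<s λ { (p , q) → cop (q , p) }
    Pσ : Ptn σ
    Pσ = toPtn {σ} (proj₁ Cσ)
    Pτ : Ptn τ
    Pτ = toPtn {τ} (proj₁ Cτ)

    τ-reduction = reduce s′ t′ t∤s {σ} Pτ (core⇒closed 0<t Cτ)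
    ρ = proj₁ τ-reduction
    σ-reduction = reduce t′ s′ s∤t {ρ} Pσ (core⇒closed 0<s Cσ)
    κ = proj₁ σ-reduction
    Pρ : Ptn ρ
    Pρ = proj₁ (proj₂ τ-reduction)
    ρt : Closed (+ t) (bead ρ)
    ρt = proj₁ (proj₂ (proj₂ τ-reduction))
    ρs : Closed (+ s) (bead ρ)
    ρs = proj₁ (proj₂ (proj₂ (proj₂ τ-reduction)))
    Pκ : Ptn κ
    Pκ = proj₁ (proj₂ σ-reduction)
    κs : Closed (+ s) (bead κ)
    κs = proj₁ (proj₂ (proj₂ σ-reduction))
    κt : Closed (+ t) (bead κ)
    κt = proj₁ (proj₂ (proj₂ (proj₂ σ-reduction)))
    T : Transfer (+ s) (+ t) σ τ κ ρ
    T = Transfer-trans (proj₂ (proj₂ (proj₂ (proj₂ (proj₂ τ-reduction)))))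
                       (Transfer-swap (proj₂ (proj₂ (proj₂ (proj₂ (proj₂ σ-reduction))))))
    Hρ : HasCore s τ ρ
    Hρ = Eqv⇒HasCore 0<s Pτ (closed⇒core Pρ ρs) (proj₁ (proj₂ (proj₂ (proj₂ (proj₂ τ-reduction)))))
    Hκ : HasCore t σ κ
    Hκ = Eqv⇒HasCore 0<t Pσ (closed⇒core Pκ κt) (proj₁ (proj₂ (proj₂ (proj₂ (proj₂ σ-reduction)))))

    open Reduced s t 1<s 1<t s≢t Pκ Pρ κs κt ρs ρt

    wei-size : ∀ {r la ka w} → 0 < r → Ptn la → HasCore r la ka → Wei r la w → size la ≡ size ka ℕ.+ w ℕ.* r
    wei-size 0<r P H (ka′ , R) with HasCore-unique 0<r P (_ , R) H
    ... | refl = Reach-size (proj₁ R)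

    good⇒common : ∀ {n la} → Good s t σ τ n la → Common (+ s) (+ t) σ τ la
    good⇒common {la = la} (p , _ , Hs , Ht) = toPtn {la} p , HasCore⇒Eqv Hs , HasCore⇒Eqv Ht

    common⇒good : ∀ {n la} → Common (+ s) (+ t) σ τ la → size la ≡ n → Good s t σ τ n la
    common⇒good (P , u , v) e = fromPtn P , e , Eqv⇒HasCore 0<s P Cσ u , Eqv⇒HasCore 0<t P Cτ v

    cond1⇒two : ∀ {n} (c : Cond1 s t σ τ n) → Two (+ s) (+ t) σ τ n (proj₁ c) (proj₁ (proj₂ c))
    cond1⇒two (la , mu , gl , gm , ne , _ , only) = record
      { cla = good⇒common gl ; cmu = good⇒common gm ; sla = proj₁ (proj₂ gl) ; smu = proj₁ (proj₂ gm)
      ; la≢mu = ne ; only = λ c e → only _ (common⇒good c e) }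

    -- The core of `conj la` is α by hypothesis and `conj α` by reflection of the path from `la` to
    -- α.
    self-conjugate : ∀ {r α la} → 0 < r → IsCore r α → Ptn la → Eqv (+ r) la α → Eqv (+ r) (conj la) α → conj α ≡ α
    self-conjugate 0<r C P u v = core-unique 0<r (conj-core 0<r C) C (Eqv-trans (Eqv-sym (conj-Ptn P) (Eqv-conj P u)) v)

    self-conjugates : ∀ {n} → Cond1 s t σ τ n → conj σ ≡ σ × conj τ ≡ τ
    self-conjugates (la , _ , gl , gm , _ , refl , _) with good⇒common gl | good⇒common gm
    ... | P , u , v | _ , u′ , v′ = self-conjugate 0<s Cσ P u u′ , self-conjugate 0<t Cτ P v v′

    -- Here `k` = |κ|, `r` = |ρ| and `N` is the transferred size. One hook s over κ, together with
    -- the u hooks separating τ from ρ, gives the u + 1 in the theorem.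
    size-from : ∀ n k r N σ τ s u → n ℕ.+ (k ℕ.+ r) ≡ N ℕ.+ (σ ℕ.+ τ) → N ≡ k ℕ.+ s → τ ≡ r ℕ.+ u ℕ.* s → n ≡ σ ℕ.+ s ℕ.* (u ℕ.+ 1)
    size-from n k r N σ τ s u p refl refl = ℕₚ.+-cancelʳ-≡ (k ℕ.+ r) n _ (trans p (e k r σ s u))
      where e : ∀ k r σ s u → k ℕ.+ s ℕ.+ (σ ℕ.+ (r ℕ.+ u ℕ.* s)) ≡ σ ℕ.+ s ℕ.* (u ℕ.+ 1) ℕ.+ (k ℕ.+ r)
            e = ℕ-solve-∀

    module FromTwo {n} (c : Cond1 s t σ τ n) where
      W = cond1⇒two c
      X = Two-transfer T W
      n′ = proj₁ (proj₂ (proj₂ X))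
      W′ = proj₁ (proj₂ (proj₂ (proj₂ X)))
      balance : n ℕ.+ (size κ ℕ.+ size ρ) ≡ n′ ℕ.+ (size σ ℕ.+ size τ)
      balance = ℤₚ.+-injective (proj₁ (proj₂ (proj₂ (proj₂ (proj₂ X)))))
      n′-s : n′ ≡ size κ ℕ.+ s
      n′-s = two-size W′
      n′-t : n′ ≡ size ρ ℕ.+ t
      n′-t = Reduced.two-size t s 1<t 1<s (λ e → s≢t (sym e)) Pρ Pκ ρt ρs κt κs (Two-swap W′)
      size-cond : SizeCond s t σ τ n
      size-cond =
          (proj₁ Hρ , (ρ , proj₂ Hρ) , size-from n (size κ) (size ρ) n′ (size σ) (size τ) s (proj₁ Hρ) balance n′-s (Reach-size (proj₁ (proj₂ Hρ))))
        , (proj₁ Hκ , (κ , proj₂ Hκ) , size-from n (size ρ) (size κ) n′ (size τ) (size σ) t (proj₁ Hκ)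
             (trans (cong (n ℕ.+_) (ℕₚ.+-comm (size ρ) (size κ))) (trans balance (cong (n′ ℕ.+_) (ℕₚ.+-comm (size σ) (size τ)))))
             n′-t (Reach-size (proj₁ (proj₂ Hκ))))
      hook : RimHookRemoval κ ρ ⊎ RimHookRemoval ρ κ
      hook = orient (link⇒Mv (link (Two.cla W′) (trans (Two.sla W′) n′-s) (trans (Two.sla W′) n′-t)))
        where
        orient : (Σ ℤ λ z → Σ ℤ λ z′ → Mv z z′ (bead κ) (bead ρ)) → RimHookRemoval κ ρ ⊎ RimHookRemoval ρ κ
        orient (z , z′ , m) with split z z′
        ... | inj₂ z′<z = inj₁ (Mv⇒rim-hook Pκ Pρ z′<z m)
        ... | inj₁ z≤z′ = inj₂ (Mv⇒rim-hook Pρ Pκ (≢⇒< z≤z′ (Mv-≢ m)) (Mv-sym m))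

  cond1⇒cond2 : ∀ {n} → Cond1 s t σ τ n → Cond2 s t σ τ n
  cond1⇒cond2 c = proj₁ (self-conjugates c) , proj₂ (self-conjugates c) , (κ , ρ , Hκ , Hρ , hook) , size-cond
    where open FromTwo c

  cond1⇒cond3 : ∀ {n} → Cond1 s t σ τ n → Cond3 s t σ τ n
  cond1⇒cond3 {n} c = proj₁ (self-conjugates c) , proj₂ (self-conjugates c) , ((proj₁ c , proj₁ (proj₂ (proj₂ c))) , least) , size-cond
    where
    open FromTwo c
    least : ∀ m la → Good s t σ τ m la → n ≤ m
    least m la g = ℕₚ.≮⇒≥ λ m<n → Minimal.minimal s t 1<s 1<t s≢t W (good⇒common g) (subst (_< n) (sym (proj₁ (proj₂ g))) m<n)

  private
    module Sizes {n} (c : SizeCond s t σ τ n) where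
      u = proj₁ (proj₁ c)
      v = proj₁ (proj₂ c)
      n-σ : n ≡ size σ ℕ.+ s ℕ.* (u ℕ.+ 1)
      n-σ = proj₂ (proj₂ (proj₁ c))
      n-τ : n ≡ size τ ℕ.+ t ℕ.* (v ℕ.+ 1)
      n-τ = proj₂ (proj₂ (proj₂ c))
      τ-ρ : size τ ≡ size ρ ℕ.+ u ℕ.* s
      τ-ρ = wei-size 0<s Pτ Hρ (proj₁ (proj₂ (proj₁ c)))
      σ-κ : size σ ≡ size κ ℕ.+ v ℕ.* t
      σ-κ = wei-size 0<t Pσ Hκ (proj₁ (proj₂ (proj₂ c)))
      -- The two expressions for n are equated, and us + vt, the total size of the hooks separating
      -- τ from ρ and σ from κ, is cancelled.
      κ-ρ : size κ ℕ.+ s ≡ size ρ ℕ.+ t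
      κ-ρ = solve′ (size κ) (size ρ) (size σ) (size τ) s t u v (trans (sym n-σ) n-τ) σ-κ τ-ρ
        where
        solve′ : ∀ k r σ τ s t u v → σ ℕ.+ s ℕ.* (u ℕ.+ 1) ≡ τ ℕ.+ t ℕ.* (v ℕ.+ 1) → σ ≡ k ℕ.+ v ℕ.* t → τ ≡ r ℕ.+ u ℕ.* s → k ℕ.+ s ≡ r ℕ.+ t
        solve′ k r σ τ s t u v p refl refl = ℕₚ.+-cancelʳ-≡ (u ℕ.* s ℕ.+ v ℕ.* t) _ _ (trans (e₁ k s t u v) (trans p (e₂ r s t u v)))
          where
          e₁ : ∀ k s t u v → k ℕ.+ s ℕ.+ (u ℕ.* s ℕ.+ v ℕ.* t) ≡ k ℕ.+ v ℕ.* t ℕ.+ s ℕ.* (u ℕ.+ 1)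
          e₁ = ℕ-solve-∀
          e₂ : ∀ r s t u v → r ℕ.+ u ℕ.* s ℕ.+ t ℕ.* (v ℕ.+ 1) ≡ r ℕ.+ t ℕ.+ (u ℕ.* s ℕ.+ v ℕ.* t)
          e₂ = ℕ-solve-∀

    -- As σ and τ are self-conjugate, conjugation permutes the two partitions. If it fixed one it
    -- would fix both, which `D` and the equality of sizes exclude.
    conjugate-pair : ∀ {n a b c d la mu} → conj σ ≡ σ → conj τ ≡ τ → Two (+ s) (+ t) σ τ n la mu →
      Diff₂ a b c d (bead la) (bead mu) → Cond1 s t σ τ n
    conjugate-pair {n} {la = la} {mu} eσ eτ W D = la , mu , common⇒good cla sla , common⇒good cmu smu , la≢mu , paired , λ ν g → only (good⇒common g) (proj₁ (proj₂ g))
      where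
      open Two W
      conj-common : ∀ {ν} → Common (+ s) (+ t) σ τ ν → Common (+ s) (+ t) σ τ (conj ν)
      conj-common {ν} (P , u , v) = conj-Ptn P , subst (Eqv (+ s) (conj ν)) eσ (Eqv-conj P u) , subst (Eqv (+ t) (conj ν)) eτ (Eqv-conj P v)
      conj-cases : ∀ {ν} → Common (+ s) (+ t) σ τ ν → size ν ≡ n → conj ν ≡ la ⊎ conj ν ≡ mu
      conj-cases c e = only (conj-common c) (trans (size-conj (proj₁ c)) e)
      paired : conj la ≡ mu
      paired = cases (conj-cases cla sla) (conj-cases cmu smu)
        where
        cases : conj la ≡ la ⊎ conj la ≡ mu → conj mu ≡ la ⊎ conj mu ≡ mu → conj la ≡ mu
        cases (inj₂ e) _ = e
        cases (inj₁ e) (inj₁ f) = ⊥-elim (la≢mu (trans (sym e) (trans (cong conj (sym f)) (conj-involutive (proj₁ cmu)))))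
        cases (inj₁ e) (inj₂ f) = ⊥-elim (not-both-self-conjugate (proj₁ cla) (proj₁ cmu) D (trans sla (sym smu)) e f)

    -- The pair is constructed over κ and ρ and pulled back together with its two-bead difference;
    -- the self-conjugacy of σ and τ is applied only to the pair pulled back.
    from-Mv : ∀ {n z z′} → conj σ ≡ σ → conj τ ≡ τ → SizeCond s t σ τ n → Mv z z′ (bead κ) (bead ρ) → Cond1 s t σ τ n
    from-Mv {n} eσ eτ S k = build (exactly-two k κ-ρ)
      where
      open Sizes S
      T⁻ = Transfer-sym T
      build : (Σ (List ℕ) λ la → Σ (List ℕ) λ mu → Two (+ s) (+ t) κ ρ (size κ ℕ.+ s) la mu × Diff₂ _ _ _ _ (bead la) (bead mu)) → Cond1 s t σ τ n
      build (la , mu , W , D) = finish (Two-transfer T⁻ W)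
        where
        finish : (Σ (List ℕ) λ la′ → Σ (List ℕ) λ mu′ → Σ ℕ λ n′ → Two (+ s) (+ t) σ τ n′ la′ mu′
          × (+ (size κ ℕ.+ s) + (+ size σ + + size τ) ≡ + n′ + (+ size κ + + size ρ))
          × (bead la′ ≗ λ z → bead la (Transfer.f T⁻ z)) × (bead mu′ ≗ λ z → bead mu (Transfer.f T⁻ z))) → Cond1 s t σ τ n
        finish (la′ , mu′ , n′ , W′ , eq , el , em) = subst (Cond1 s t σ τ) n′≡n
            (conjugate-pair eσ eτ W′ (Diff₂-pull (Transfer.f T⁻) (Transfer.g T⁻) (Transfer.f∘g T⁻) (Transfer.g∘f T⁻) el em D))
          where
          n′≡n : n′ ≡ n
          n′≡n = trans (size-from n′ (size κ) (size ρ) (size κ ℕ.+ s) (size σ) (size τ) s u (sym (ℤₚ.+-injective eq)) refl τ-ρ) (sym n-σ)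

  cond2⇒cond1 : ∀ {n} → Cond2 s t σ τ n → Cond1 s t σ τ n
  cond2⇒cond1 {n} (eσ , eτ , (α , β , Hα , Hβ , R) , S) =
    use (subst₂ (λ a b → RimHookRemoval a b ⊎ RimHookRemoval b a) (HasCore-unique 0<t Pσ Hα Hκ) (HasCore-unique 0<s Pτ Hβ Hρ) R)
    where
    use : RimHookRemoval κ ρ ⊎ RimHookRemoval ρ κ → Cond1 s t σ τ n
    use (inj₁ H) = from-Mv eσ eτ S (proj₂ (proj₂ (proj₂ (rim-hook⇒Mv H))))
    use (inj₂ H) = from-Mv eσ eτ S (Mv-sym (proj₂ (proj₂ (proj₂ (rim-hook⇒Mv H)))))

  -- A partition attaining the size n transfers to one lying a single hook above both κ and ρ; its
  -- `Link` supplies the bead move between κ and ρ.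
  cond3⇒cond1 : ∀ {n} → Cond3 s t σ τ n → Cond1 s t σ τ n
  cond3⇒cond1 {n} (eσ , eτ , ((la , g) , _) , S) = build (Transfer.fwd T c)
    where
    open Sizes S
    c : Common (+ s) (+ t) σ τ la
    c = good⇒common g
    build : (Σ (List ℕ) λ la′ → Common (+ s) (+ t) κ ρ la′ × (bead la′ ≗ λ z → bead la (Transfer.f T z))) → Cond1 s t σ τ n
    build (la′ , c′ , e) = from-Mv eσ eτ S (proj₂ (proj₂ (link⇒Mv (link c′ size-s (trans size-s κ-ρ)))))
      where
      cancel : ∀ N k r σ s u → (σ ℕ.+ s ℕ.* (u ℕ.+ 1)) ℕ.+ (k ℕ.+ r) ≡ N ℕ.+ (σ ℕ.+ (r ℕ.+ u ℕ.* s)) → N ≡ k ℕ.+ s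
      cancel N k r σ s u p = ℕₚ.+-cancelʳ-≡ (σ ℕ.+ (r ℕ.+ u ℕ.* s)) N _ (trans (sym p) (e′ k r σ s u))
        where e′ : ∀ k r σ s u → (σ ℕ.+ s ℕ.* (u ℕ.+ 1)) ℕ.+ (k ℕ.+ r) ≡ k ℕ.+ s ℕ.+ (σ ℕ.+ (r ℕ.+ u ℕ.* s))
              e′ = ℕ-solve-∀
      size-s : size la′ ≡ size κ ℕ.+ s
      size-s = cancel (size la′) (size κ) (size ρ) (size σ) s u
        (trans (cong (ℕ._+ (size κ ℕ.+ size ρ)) (trans (sym n-σ) (sym (proj₁ (proj₂ g)))))
          (trans (ℤₚ.+-injective (Transfer.sizes T c (proj₁ c′) e)) (cong (λ k → size la′ ℕ.+ (size σ ℕ.+ k)) τ-ρ)))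

theorem5p13 : (s t : ℕ) → 1 < s → 1 < t → Coprime s t →
    (σ τ : List ℕ) → IsCore s σ → IsCore t τ → (n : ℕ) →
    ((Cond1 s t σ τ n → Cond2 s t σ τ n) × (Cond2 s t σ τ n → Cond1 s t σ τ n)) ×
    ((Cond1 s t σ τ n → Cond3 s t σ τ n) × (Cond3 s t σ τ n → Cond1 s t σ τ n))
theorem5p13 (suc s′) (suc t′) 1<s 1<t cop σ τ Cσ Cτ n = (cond1⇒cond2 , cond2⇒cond1) , (cond1⇒cond3 , cond3⇒cond1)
  where open Main s′ t′ 1<s 1<t cop Cσ Cτ
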